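{- For every positive integer $n$ divisible by $4$, there is a normal element $\alpha$ of $\mathbb{F}_{2^n}$ over $\mathbb{F}_2$ such that the Hamming weight of its corresponding vector $$\left(\mathrm{Tr}_{2^n|2}(\alpha),\ \mathrm{Tr}_{2^n|2}(\alpha^{1+2}),\ \mathrm{Tr}_{2^n|2}(\alpha^{1+4}),\ \ldots,\ \mathrm{Tr}_{2^n|2}(\alpha^{1+2^{n-1}})\right)\in\mathbb{F}_2^n$$ is $3$.
   Context: An element $\alpha\in\mathbb{F}_{2^n}$ is a normal element of $\mathbb{F}_{2^n}$ over $\mathbb{F}_2$ if $\{\alpha,\alpha^2,\alpha^{2^2},\ldots,\alpha^{2^{n-1}}\}$ is a basis of $\mathbb{F}_{2^n}$ over $\mathbb{F}_2$. The trace function is $\mathrm{Tr}_{2^n|2}(x)=\sum_{i=0}^{n-1}x^{2^i}$. The corresponding vector of $\alpha$ is the vector with entries $\mathrm{Tr}_{2^n|2}(\alpha\cdot\alpha^{2^i})$, $0\leq i\leq n-1$ (the entry for $i=0$ is $\mathrm{Tr}_{2^n|2}(\alpha^2)=\mathrm{Tr}_{2^n|2}(\alpha)$). The Hamming weight of a vector is its number of nonzero entries. -}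

module Defs where

open import Algebra.Bundles using (Ring; CommutativeRing)
open import Algebra.Module.Bundles using (LeftModule)
open import Data.Bool.Base using (Bool; true; false; if_then_else_)
open import Data.Bool.Properties using (xor-∧-commutativeRing)
open import Data.Empty using (⊥-elim)
open import Data.Fin.Base using (Fin; toℕ)
import Data.Fin.Properties as Fin
open import Data.Fin.Permutation using (Permutation′; permutation)
open import Data.Nat.Base as ℕ using (ℕ; zero; suc)
open import Data.Product.Base using (_×_; _,_; proj₁; proj₂; ∃)
open import Data.Vec.Base using (Vec; tabulate; count)
open import Data.Vec.Functional using (Vector; replicate)
open import Function.Bundles using (Inverse)
open import Function.Properties.Inverse using (Inverse⇒Injection)
open import Level using (Level; _⊔_) renaming (suc to lsuc)
open import Relation.Binary.Definitions using (Decidable)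
open import Relation.Binary.PropositionalEquality as ≡ using (_≡_)
open import Relation.Nullary.Decidable using (yes; no; ¬?; via-injection)

import Algebra.Definitions.RawMonoid as RawMonoidDefs
import Algebra.Properties.Ring as RingProperties
import Algebra.Properties.CommutativeMonoid.Sum as CommutativeMonoidSum
import Algebra.Properties.Semiring.Exp as SemiringExp
import Algebra.Properties.Semiring.Mult as SemiringMult
import Relation.Binary.Reasoning.Setoid as SetoidReasoning

private
  variable
    r ℓr m ℓm : Level

------------------------------------------------------------------------
-- Bases of modules

module _ {R : Ring r ℓr} (M : LeftModule R m ℓm) where

  open Ring R using (Carrier; _≈_; 0#)
  open LeftModule M
  open RawMonoidDefs +ᴹ-rawMonoid using (sum)

  linearCombination : ∀ {k} → Vector Carrier k → Vector Carrierᴹ k → Carrierᴹ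
  linearCombination c v = sum (λ i → c i *ₗ v i)

  LinearlyIndependent : ∀ {k} → Vector Carrierᴹ k → Set _
  LinearlyIndependent v =
    ∀ c → linearCombination c v ≈ᴹ 0ᴹ → ∀ i → c i ≈ 0#

  Spanning : ∀ {k} → Vector Carrierᴹ k → Set _
  Spanning v = ∀ x → ∃ λ c → linearCombination c v ≈ᴹ x

  IsBasis : ∀ {k} → Vector Carrierᴹ k → Set _
  IsBasis v = LinearlyIndependent v × Spanning v

------------------------------------------------------------------------
-- Finite fields

record FiniteField (q : ℕ) c ℓ : Set (lsuc (c ⊔ ℓ)) where
  field
    commutativeRing : CommutativeRing c ℓ

  open CommutativeRing commutativeRing public

  field
    1≉0         : 1# ≉ 0#
    inverse     : ∀ x → x ≉ 0# → ∃ λ y → x * y ≈ 1#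
    enumeration : Inverse setoid (≡.setoid (Fin q))

  infix 4 _≟_

  _≟_ : Decidable _≈_
  _≟_ = via-injection (Inverse⇒Injection enumeration) Fin._≟_

-- The field with two elements, with addition _xor_ and multiplication _∧_.
𝔽₂ : CommutativeRing _ _
𝔽₂ = xor-∧-commutativeRing

module _ {c ℓ} (n : ℕ) (F : FiniteField (2 ℕ.^ n) c ℓ) where

  open FiniteField F
  open RingProperties ring using (+-identityʳ-unique)
  open CommutativeMonoidSum +-commutativeMonoid
  open SemiringExp semiring using (_^_)
  open SemiringMult semiring
    using (×1-homo-*; ×-homo-1) renaming (_×_ to _·_)
  open SetoidReasoning setoid

  -- Translation by 1 permutes the field, so the sum of all elements is
  -- unchanged when 1 is added to each of the 2 ^ n summands; this forces
  -- (2 ^ n) · 1 ≈ 0, and hence characteristic 2.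
  private
    module E = Inverse enumeration

    translation : Permutation′ (2 ℕ.^ n)
    translation = permutation
      (λ i → E.to (E.from i + 1#))
      (λ i → E.to (E.from i + - 1#))
      (λ i → inv i (- 1#) 1# (-‿inverseˡ 1#))
      (λ i → inv i 1# (- 1#) (-‿inverseʳ 1#))
      where
      inv : ∀ i a b → a + b ≈ 0# → E.to (E.from (E.to (E.from i + a)) + b) ≡ i
      inv i a b a+b≈0 = E.inverseˡ (begin
        E.from (E.to (E.from i + a)) + b  ≈⟨ +-congʳ (E.strictlyInverseʳ _) ⟩
        (E.from i + a) + b                ≈⟨ +-assoc _ _ _ ⟩
        E.from i + (a + b)                ≈⟨ +-congˡ a+b≈0 ⟩
        E.from i + 0#                     ≈⟨ +-identityʳ _ ⟩
        E.from i                          ∎)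

    order·1≈0 : (2 ℕ.^ n) · 1# ≈ 0#
    order·1≈0 = +-identityʳ-unique (sum E.from) _ (begin
      sum E.from + (2 ℕ.^ n) · 1#
        ≈⟨ +-congˡ (sum-replicate (2 ℕ.^ n)) ⟨
      sum E.from + sum {2 ℕ.^ n} (replicate _ 1#)
        ≈⟨ ∑-distrib-+ E.from (replicate _ 1#) ⟨
      sum (λ i → E.from i + 1#)
        ≈⟨ sum-cong-≋ {2 ℕ.^ n} (λ i → E.strictlyInverseʳ _) ⟨
      sum (λ i → E.from (E.to (E.from i + 1#)))
        ≈⟨ sum-permute E.from translation ⟨
      sum E.from ∎)

    cancel-2 : ∀ k → (2 ℕ.^ k) · 1# ≈ 0# → 2 · 1# ≈ 0#
    cancel-2 zero    1·1≈0 = ⊥-elim (1≉0 (trans (sym (×-homo-1 1#)) 1·1≈0))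
    cancel-2 (suc k) eq with 2 · 1# ≟ 0#
    ... | yes 2≈0 = 2≈0
    ... | no  2≉0 = cancel-2 k (begin
      z              ≈⟨ *-identityˡ z ⟨
      1# * z         ≈⟨ *-congʳ (proj₂ (inverse t 2≉0)) ⟨
      (t * y) * z    ≈⟨ *-congʳ (*-comm t y) ⟩
      (y * t) * z    ≈⟨ *-assoc y t z ⟩
      y * (t * z)    ≈⟨ *-congˡ (×1-homo-* 2 (2 ℕ.^ k)) ⟨
      y * ((2 ℕ.^ suc k) · 1#)  ≈⟨ *-congˡ eq ⟩
      y * 0#         ≈⟨ zeroʳ y ⟩
      0#             ∎)
      where
      t = 2 · 1#
      y = proj₁ (inverse t 2≉0)
      z = (2 ℕ.^ k) · 1#

  characteristic-2 : ∀ x → x + x ≈ 0#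
  characteristic-2 x = begin
    x + x            ≈⟨ +-cong (*-identityˡ x) (*-identityˡ x) ⟨
    1# * x + 1# * x  ≈⟨ distribʳ x 1# 1# ⟨
    (1# + 1#) * x    ≈⟨ *-congʳ (+-congˡ (+-identityʳ 1#)) ⟨
    (2 · 1#) * x     ≈⟨ *-congʳ (cancel-2 n order·1≈0) ⟩
    0# * x           ≈⟨ zeroˡ x ⟩
    0#               ∎

  infixr 7 _*₂_

  _*₂_ : Bool → Carrier → Carrier
  b *₂ x = if b then x else 0#

  vectorSpace : LeftModule (CommutativeRing.ring 𝔽₂) c ℓ
  vectorSpace = record
    { Carrierᴹ = Carrier
    ; _≈ᴹ_ = _≈_
    ; _+ᴹ_ = _+_
    ; _*ₗ_ = _*₂_
    ; 0ᴹ = 0#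
    ; -ᴹ_ = -_
    ; isLeftModule = record
      { isLeftSemimodule = record
        { +ᴹ-isCommutativeMonoid = +-isCommutativeMonoid
        ; isPreleftSemimodule = record
          { *ₗ-cong = λ { {false} ≡.refl _ → refl ; {true} ≡.refl eq → eq }
          ; *ₗ-zeroˡ = λ _ → refl
          ; *ₗ-distribʳ = λ
            { x false b → sym (+-identityˡ _)
            ; x true false → sym (+-identityʳ _)
            ; x true true → sym (characteristic-2 x)
            }
          ; *ₗ-identityˡ = λ _ → refl
          ; *ₗ-assoc = λ { false _ _ → refl ; true _ _ → refl }
          ; *ₗ-zeroʳ = λ { false → refl ; true → refl }
          ; *ₗ-distribˡ = λ
            { false _ _ → sym (+-identityˡ _) ; true _ _ → refl }
          }
        }
      ; -ᴹ‿cong = -‿cong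
      ; -ᴹ‿inverse = -‿inverse
      }
    }

  IsNormal : Carrier → Set _
  IsNormal α = IsBasis vectorSpace {n} (λ i → α ^ (2 ℕ.^ toℕ i))

  -- The trace is taken in the big field; its values lie in the prime
  -- subfield {0#, 1#}.
  Tr : Carrier → Carrier
  Tr x = ∑[ i < n ] (x ^ (2 ℕ.^ toℕ i))

  correspondingVector : Carrier → Vec Carrier n
  correspondingVector α = tabulate (λ i → Tr (α * α ^ (2 ℕ.^ toℕ i)))

  hammingWeight : ∀ {k} → Vec Carrier k → ℕ
  hammingWeight = count (λ x → ¬? (x ≟ 0#))

{-# OPTIONS --safe #-}

-- Let σ be the Frobenius automorphism of F and attach to α the element C α α = Σᵢ Tr(α σⁱα) xⁱ of
-- the group ring A = 𝔽₂[x]/(xⁿ − 1), which acts on F through x ↦ σ.  Then C(bα, bα) = b b* C(α, α)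
-- for b ∈ A, where * inverts x, and α is normal as soon as C α α is a unit.  So it is enough to
-- reach 1 + xᵐ + x⁻ᵐ, with m odd and this element a unit, from some C θ θ by a norm b b*.
--
-- Put w = x + x⁻¹.  Every C θ θ lies in 𝔽₂[w], since the coefficient of x^(n/2) vanishes.  Choose
-- Q = 2ˢ with x^(Q²) = x^Q, so that φ(a) = a^Q is a projection of A with nilpotent kernel, and take
-- m = Q − 1, for which φ(xᵐ) = 1.
--
-- * Some θ has φ(C θ θ) = 1.  Running through all δ ∈ F one enlarges the idempotent ε = φ(C θ θ)
--   until f = 1 + ε kills every φ(C δ δ).  Polarising and using that the form C is faithful gives
--   f φ(x) = f, whence f φ(C δ δ) = Tr(δ) f, and f = 0.
-- * Because 4 ∣ n, such a C θ θ, like 1 + xᵐ + x⁻ᵐ, lies in 1 + w + w² 𝔽₂[w]: the coefficient of w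
--   is the norm to 𝔽₂ of the trace of θ to 𝔽₄.  With ν = w + φ(w), which is nilpotent, both are
--   therefore in 1 + ν + ν w 𝔽₂[w].
-- * Up to the norm of 1 + ν their quotient is 1 + w² y with y ∈ ν 𝔽₂[w] nilpotent, and this is the
--   norm of 1 + x w k for k = Σ_{i<s} y^(2ⁱ), as k + k² = y.
module Submission where

open import Defs
open import Algebra.Bundles using (CommutativeMonoid; CommutativeRing)
open import Algebra.Module.Bundles using (LeftModule)
import Algebra.Properties.CommutativeMonoid.Sum as CommutativeMonoidSum
import Algebra.Properties.CommutativeSemigroup as CommutativeSemigroupProperties
import Algebra.Properties.Semiring.Exp as SemiringExp
import Algebra.Solver.Ring
open import Algebra.Solver.Ring.AlmostCommutativeRing
  using (fromCommutativeRing; _-Raw-AlmostCommutative⟶_)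
open import Data.Bool.Base using (Bool; true; false; not; if_then_else_; _xor_; T)
open import Data.Fin.Base as Fin using (Fin; toℕ; punchIn; finToFun; funToFin; combine)
open import Data.Fin.Permutation using (Permutation′; permutation)
import Data.Fin.Properties as Fin
open import Data.List.Base as List using (List; []; _∷_; _++_; map)
open import Data.List.Relation.Unary.All as All using (All; []; _∷_)
import Data.List.Relation.Unary.All.Properties as All
open import Data.Maybe.Base using (just; nothing)
open import Data.Nat.Base as ℕ using (ℕ; zero; suc)
open import Data.Nat.Divisibility using (_∣_; divides)
open import Data.Nat.DivMod using (_%_; _/_; _mod_; m≡m%n+[m/n]*n; m%n<n)
import Data.Nat.Properties as ℕ
open import Data.Product using (Σ-syntax; _×_; _,_; proj₁; proj₂; ∃-syntax)
open import Data.Sum.Base using (_⊎_; inj₁; inj₂; fromInj₂)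
open import Data.Unit.Base using (tt)
open import Data.Vec.Base using (tabulate)
open import Function.Base using (_∘_)
open import Function.Bundles using (Inverse)
open import Level using (_⊔_) renaming (suc to lsuc)
open import Relation.Binary.Definitions using (WeaklyDecidable)
open import Relation.Binary.PropositionalEquality as ≡ using (_≡_; _≢_)
import Relation.Binary.Reasoning.Setoid as SetoidReasoning
open import Relation.Nullary.Decidable
  using (Dec; yes; no; does; dec-true; dec-false; decidable-stable)
open import Relation.Nullary.Negation using (¬_; contradiction)

-- Since n is even, A is not reduced, and inverses and idempotents cannot be read off a product of
-- fields. The projection φ replaces that decomposition: if φ(a) = 1, then a^(Q - 1) inverts a, and
-- if φ(a) = a, then a^(Q - 1) is the idempotent carrying a. So every inverse and every idempotent
-- below is an explicit power. The involution * fixes 𝔽₂[w] pointwise, so an element d of 𝔽₂[w] has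
-- norm d², and 1 + x h with h in 𝔽₂[w] has norm 1 + w h + h². Such norms with h = w k contain no
-- term linear in w, which is why the coefficient of w has to agree before any correction is made.
-- The exponent m = Q - 1 may exceed n. Its residue modulo n is odd because n is even, whereas n / 2
-- is even because 4 divides n; hence 0, m and -m are distinct modulo n, and the weight is exactly
-- 3.

-- Sums over initial segments of the natural numbers

module RangeSum {c ℓ} (M : CommutativeMonoid c ℓ) where

  open CommutativeMonoid M
  open CommutativeMonoidSum M using (sum)
  open import Algebra.Properties.CommutativeSemigroup commutativeSemigroup using (x∙yz≈y∙xz; interchange)
  open SetoidReasoning setoid

  -- Summands defined on all of ℕ, rather than on `Fin n`, let exponents be shifted, doubled and
  -- reflected by plain arithmetic.
  ∑< : ℕ → (ℕ → Carrier) → Carrier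
  ∑< zero    f = ε
  ∑< (suc n) f = f 0 ∙ ∑< n (f ∘ suc)

  sum≈∑< : ∀ n (f : ℕ → Carrier) → sum {n} (λ i → f (toℕ i)) ≈ ∑< n f
  sum≈∑< zero    f = refl
  sum≈∑< (suc n) f = ∙-congˡ (sum≈∑< n (f ∘ suc))

  ∑<-cong : ∀ n {f g : ℕ → Carrier} → (∀ i → f i ≈ g i) → ∑< n f ≈ ∑< n g
  ∑<-cong zero    f≈g = refl
  ∑<-cong (suc n) f≈g = ∙-cong (f≈g 0) (∑<-cong n (f≈g ∘ suc))

  ∑<-ε : ∀ n {f : ℕ → Carrier} → (∀ i → f i ≈ ε) → ∑< n f ≈ ε
  ∑<-ε zero    f≈ε = refl
  ∑<-ε (suc n) f≈ε = trans (∙-cong (f≈ε 0) (∑<-ε n (f≈ε ∘ suc))) (identityˡ ε)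

  ∑<-∙ : ∀ n (f g : ℕ → Carrier) → ∑< n (λ i → f i ∙ g i) ≈ ∑< n f ∙ ∑< n g
  ∑<-∙ zero    f g = sym (identityˡ ε)
  ∑<-∙ (suc n) f g = trans (∙-congˡ (∑<-∙ n (f ∘ suc) (g ∘ suc))) (interchange _ _ _ _)

  ∑<-last : ∀ n (f : ℕ → Carrier) → ∑< (suc n) f ≈ ∑< n f ∙ f n
  ∑<-last zero    f = comm _ _
  ∑<-last (suc n) f = trans (∙-congˡ (∑<-last n (f ∘ suc))) (sym (assoc _ _ _))

  ∑<-split : ∀ m n (f : ℕ → Carrier) → ∑< (m ℕ.+ n) f ≈ ∑< m f ∙ ∑< n (λ i → f (m ℕ.+ i))
  ∑<-split zero    n f = sym (identityˡ _)
  ∑<-split (suc m) n f = trans (∙-congˡ (∑<-split m n (f ∘ suc))) (sym (assoc _ _ _))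

  ∑<-rotate : ∀ n (f : ℕ → Carrier) → f n ≈ f 0 → ∑< n (f ∘ suc) ≈ ∑< n f
  ∑<-rotate zero    f eq = refl
  ∑<-rotate (suc n) f eq = begin
    ∑< (suc n) (f ∘ suc)              ≈⟨ ∑<-last n (f ∘ suc) ⟩
    ∑< n (f ∘ suc) ∙ f (suc n)        ≈⟨ comm _ _ ⟩
    f (suc n) ∙ ∑< n (f ∘ suc)        ≈⟨ ∙-congʳ eq ⟩
    f 0 ∙ ∑< n (f ∘ suc)              ∎

  ∑<-swap : ∀ m n (f : ℕ → ℕ → Carrier) →
            ∑< m (λ i → ∑< n (f i)) ≈ ∑< n (λ j → ∑< m (λ i → f i j))
  ∑<-swap zero    n f = sym (∑<-ε n (λ _ → refl))
  ∑<-swap (suc m) n f = trans (∙-congˡ (∑<-swap m n (f ∘ suc))) (sym (∑<-∙ n (f 0) (λ j → ∑< m (λ i → f (suc i) j))))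

  ∑<-interleave : ∀ k (f : ℕ → Carrier) →
    ∑< (k ℕ.+ k) f ≈ ∑< k (λ l → f (l ℕ.+ l)) ∙ ∑< k (λ l → f (suc (l ℕ.+ l)))
  ∑<-interleave zero    f = sym (identityˡ ε)
  ∑<-interleave (suc k) f rewrite ℕ.+-suc k k = begin
    f 0 ∙ (f 1 ∙ ∑< (k ℕ.+ k) (f ∘ suc ∘ suc))
      ≈⟨ ∙-congˡ (∙-congˡ (∑<-interleave k (f ∘ suc ∘ suc))) ⟩
    f 0 ∙ (f 1 ∙ (∑< k (λ l → f (suc (suc (l ℕ.+ l)))) ∙ ∑< k (λ l → f (suc (suc (suc (l ℕ.+ l)))))))
      ≈⟨ ∙-congˡ (x∙yz≈y∙xz _ _ _) ⟩
    f 0 ∙ (∑< k (λ l → f (suc (suc (l ℕ.+ l)))) ∙ (f 1 ∙ ∑< k (λ l → f (suc (suc (suc (l ℕ.+ l)))))))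
      ≈⟨ assoc _ _ _ ⟨
    f 0 ∙ ∑< k (λ l → f (suc (suc (l ℕ.+ l)))) ∙ (f 1 ∙ ∑< k (λ l → f (suc (suc (suc (l ℕ.+ l))))))
      ≈⟨ ∙-cong (∙-congˡ (∑<-cong k (λ l → reflexive (≡.cong f (≡.sym (ℕ.+-suc (suc l) l))))))
                (∙-congˡ (∑<-cong k (λ l → reflexive (≡.cong (f ∘ suc) (≡.sym (ℕ.+-suc (suc l) l)))))) ⟩
    ∑< (suc k) (λ l → f (l ℕ.+ l)) ∙ ∑< (suc k) (λ l → f (suc (l ℕ.+ l))) ∎

  -- Peeling off both ends pairs each index with its mirror image. The hypothesis describes the
  -- partner by an equation, which keeps truncated subtraction out.
  ∑<-fold : ∀ k (f g : ℕ → Carrier) →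
    (∀ i j → suc (i ℕ.+ j) ≡ k ℕ.+ k → f i ∙ f j ≈ g i) → ∑< (k ℕ.+ k) f ≈ ∑< k g
  ∑<-fold zero    f g pair = refl
  ∑<-fold (suc k) f g pair rewrite ℕ.+-suc k k = begin
    f 0 ∙ ∑< (suc (k ℕ.+ k)) (f ∘ suc)                  ≈⟨ ∙-congˡ (∑<-last (k ℕ.+ k) (f ∘ suc)) ⟩
    f 0 ∙ (∑< (k ℕ.+ k) (f ∘ suc) ∙ f (suc (k ℕ.+ k)))  ≈⟨ ∙-congˡ (comm _ _) ⟩
    f 0 ∙ (f (suc (k ℕ.+ k)) ∙ ∑< (k ℕ.+ k) (f ∘ suc))  ≈⟨ assoc _ _ _ ⟨
    f 0 ∙ f (suc (k ℕ.+ k)) ∙ ∑< (k ℕ.+ k) (f ∘ suc)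
      ≈⟨ ∙-cong (pair 0 (suc (k ℕ.+ k)) ≡.refl)
                (∑<-fold k (f ∘ suc) (g ∘ suc)
                  (λ i j eq → pair (suc i) (suc j)
                    (≡.cong suc (≡.cong suc (≡.trans (ℕ.+-suc i j) eq))))) ⟩
    g 0 ∙ ∑< k (g ∘ suc) ∎

  -- The middle index `k` is its own mirror image, so its term is left over.
  ∑<-fold-odd : ∀ k (f g : ℕ → Carrier) →
    (∀ i j → i ℕ.+ j ≡ k ℕ.+ k → f i ∙ f j ≈ g i) → ∑< (suc (k ℕ.+ k)) f ≈ ∑< k g ∙ f k
  ∑<-fold-odd zero    f g pair = comm _ _
  ∑<-fold-odd (suc k) f g pair rewrite ℕ.+-suc k k = begin
    f 0 ∙ ∑< (suc (suc (k ℕ.+ k))) (f ∘ suc)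
      ≈⟨ ∙-congˡ (∑<-last (suc (k ℕ.+ k)) (f ∘ suc)) ⟩
    f 0 ∙ (∑< (suc (k ℕ.+ k)) (f ∘ suc) ∙ f (suc (suc (k ℕ.+ k))))
      ≈⟨ ∙-congˡ (comm _ _) ⟩
    f 0 ∙ (f (suc (suc (k ℕ.+ k))) ∙ ∑< (suc (k ℕ.+ k)) (f ∘ suc))
      ≈⟨ assoc _ _ _ ⟨
    f 0 ∙ f (suc (suc (k ℕ.+ k))) ∙ ∑< (suc (k ℕ.+ k)) (f ∘ suc)
      ≈⟨ ∙-cong (pair 0 (suc (suc (k ℕ.+ k))) ≡.refl)
                (∑<-fold-odd k (f ∘ suc) (g ∘ suc)
                  (λ i j eq → pair (suc i) (suc j)
                    (≡.cong suc (≡.trans (ℕ.+-suc i j) (≡.cong suc eq))))) ⟩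
    g 0 ∙ (∑< k (g ∘ suc) ∙ f (suc k))  ≈⟨ assoc _ _ _ ⟨
    g 0 ∙ ∑< k (g ∘ suc) ∙ f (suc k)    ∎

  ∑<-single : ∀ n (f : ℕ → Carrier) {r} → r ℕ.< n →
    ∑< n (λ i → if i ℕ.≡ᵇ r then f i else ε) ≈ f r
  ∑<-single (suc n) f {zero}  r<n =
    trans (∙-congˡ (∑<-ε n (λ _ → refl))) (identityʳ _)
  ∑<-single (suc n) f {suc r} (ℕ.s≤s r<n) =
    trans (identityˡ _) (∑<-single n (f ∘ suc) r<n)

double-+ : ∀ i j → (i ℕ.+ i) ℕ.+ (j ℕ.+ j) ≡ (i ℕ.+ j) ℕ.+ (i ℕ.+ j)
double-+ i j = CommutativeSemigroupProperties.interchange ℕ.+-commutativeSemigroup i i j j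

odd-reflection : ∀ i j q → suc (i ℕ.+ j) ≡ q ℕ.+ q →
  suc (i ℕ.+ i) ℕ.+ suc (j ℕ.+ j) ≡ (q ℕ.+ q) ℕ.+ (q ℕ.+ q)
odd-reflection i j q eq = begin
  suc (i ℕ.+ i) ℕ.+ suc (j ℕ.+ j)        ≡⟨ ≡.cong suc (ℕ.+-suc (i ℕ.+ i) (j ℕ.+ j)) ⟩
  suc (suc ((i ℕ.+ i) ℕ.+ (j ℕ.+ j)))    ≡⟨ ≡.cong (suc ∘ suc) (double-+ i j) ⟩
  suc (suc ((i ℕ.+ j) ℕ.+ (i ℕ.+ j)))    ≡⟨ ≡.cong suc (ℕ.+-suc (i ℕ.+ j) (i ℕ.+ j)) ⟨
  suc (i ℕ.+ j) ℕ.+ suc (i ℕ.+ j)        ≡⟨ ≡.cong₂ ℕ._+_ eq eq ⟩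
  (q ℕ.+ q) ℕ.+ (q ℕ.+ q)                ∎
  where open ≡.≡-Reasoning

-- Even exponents are listed as doubles of successors: exponent 0 is its own mirror image modulo n
-- and is split off beforehand.
even-reflection : ∀ i j q → i ℕ.+ j ≡ q ℕ.+ q →
  (suc i ℕ.+ suc i) ℕ.+ (suc j ℕ.+ suc j) ≡ (suc q ℕ.+ suc q) ℕ.+ (suc q ℕ.+ suc q)
even-reflection i j q eq = ≡.trans (double-+ (suc i) (suc j)) (≡.cong₂ ℕ._+_ shift shift)
  where
  shift : suc i ℕ.+ suc j ≡ suc q ℕ.+ suc q
  shift = ≡.cong suc (≡.trans (ℕ.+-suc i j) (≡.trans (≡.cong suc eq) (≡.sym (ℕ.+-suc q q))))

-- Frobenius powers and 𝔽₂-polynomials in characteristic 2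

module Char2 {c ℓ} (R : CommutativeRing c ℓ)
  (x+x≈0 : ∀ x → CommutativeRing._≈_ R (CommutativeRing._+_ R x x) (CommutativeRing.0# R)) where

  open CommutativeRing R
  open SetoidReasoning setoid
  open SemiringExp semiring using (_^_; ^-homo-*; ^-assocʳ; ^-congˡ; ^-congʳ)
  open RangeSum +-commutativeMonoid

  ⟦_⟧₂ : Bool → Carrier
  ⟦ b ⟧₂ = if b then 1# else 0#

  private
    coefficients : CommutativeRing.rawRing 𝔽₂ -Raw-AlmostCommutative⟶ fromCommutativeRing R
    coefficients = record
      { ⟦_⟧ = ⟦_⟧₂
      ; +-homo = λ where
          false _     → sym (+-identityˡ _)
          true  false → sym (+-identityʳ _)
          true  true  → sym (x+x≈0 1#)
      ; *-homo = λ where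
          false _ → sym (zeroˡ _)
          true  _ → sym (*-identityˡ _)
      ; -‿homo = λ where
          false → trans (sym (-‿inverseʳ 0#)) (+-identityˡ _)
          true  → trans (sym (+-identityʳ _)) (trans (+-congˡ (sym (-‿inverseʳ 1#)))
                    (trans (sym (+-assoc _ _ _)) (trans (+-congʳ (x+x≈0 1#)) (+-identityˡ _))))
      ; 0-homo = refl
      ; 1-homo = refl
      }

    ⟦⟧-≟ : WeaklyDecidable (λ a b → ⟦ a ⟧₂ ≈ ⟦ b ⟧₂)
    ⟦⟧-≟ false false = just refl
    ⟦⟧-≟ true  true  = just refl
    ⟦⟧-≟ _     _     = nothing

  open Algebra.Solver.Ring (CommutativeRing.rawRing 𝔽₂) (fromCommutativeRing R) coefficients
    ⟦⟧-≟ public using (solve; _:=_; _:+_; _:*_; con)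

  +≈0⇒≈ : ∀ {a b} → a + b ≈ 0# → a ≈ b
  +≈0⇒≈ {a} {b} eq = begin
    a            ≈⟨ solve 2 (λ a b → a := (a :+ b) :+ b) refl a b ⟩
    (a + b) + b  ≈⟨ +-congʳ eq ⟩
    0# + b       ≈⟨ +-identityˡ b ⟩
    b            ∎

  ≈⇒+≈0 : ∀ {a b} → a ≈ b → a + b ≈ 0#
  ≈⇒+≈0 {a} {b} eq = trans (+-congʳ eq) (x+x≈0 b)

  -- Iterated squaring instead of `a ^ (2 ℕ.^ i)`: composites then agree propositionally, and
  -- additivity needs the expansion of a single square.
  frob : ℕ → Carrier → Carrier
  frob zero    a = a
  frob (suc i) a = frob i a * frob i a

  frob-cong : ∀ i {a b} → a ≈ b → frob i a ≈ frob i b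
  frob-cong zero    eq = eq
  frob-cong (suc i) eq = *-cong (frob-cong i eq) (frob-cong i eq)

  frob-+ : ∀ i a b → frob i (a + b) ≈ frob i a + frob i b
  frob-+ zero    a b = refl
  frob-+ (suc i) a b = trans (*-cong (frob-+ i a b) (frob-+ i a b))
    (solve 2 (λ a b → (a :+ b) :* (a :+ b) := a :* a :+ b :* b) refl _ _)

  frob-* : ∀ i a b → frob i (a * b) ≈ frob i a * frob i b
  frob-* zero    a b = refl
  frob-* (suc i) a b = trans (*-cong (frob-* i a b) (frob-* i a b))
    (solve 2 (λ a b → (a :* b) :* (a :* b) := (a :* a) :* (b :* b)) refl _ _)

  frob-0 : ∀ i → frob i 0# ≈ 0#
  frob-0 zero    = refl
  frob-0 (suc i) = trans (*-congʳ (frob-0 i)) (zeroˡ _)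

  frob-1 : ∀ i → frob i 1# ≈ 1#
  frob-1 zero    = refl
  frob-1 (suc i) = trans (*-cong (frob-1 i) (frob-1 i)) (*-identityˡ _)

  frob-⟦⟧ : ∀ i b → frob i ⟦ b ⟧₂ ≈ ⟦ b ⟧₂
  frob-⟦⟧ i false = frob-0 i
  frob-⟦⟧ i true  = frob-1 i

  frob-∘ : ∀ i j a → frob (i ℕ.+ j) a ≡ frob i (frob j a)
  frob-∘ zero    j a = ≡.refl
  frob-∘ (suc i) j a = ≡.cong₂ _*_ (frob-∘ i j a) (frob-∘ i j a)

  frob≈^ : ∀ i a → frob i a ≈ a ^ (2 ℕ.^ i)
  frob≈^ zero    a = sym (*-identityʳ a)
  frob≈^ (suc i) a = begin
    frob i a * frob i a              ≈⟨ *-cong (frob≈^ i a) (frob≈^ i a) ⟩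
    a ^ (2 ℕ.^ i) * a ^ (2 ℕ.^ i)    ≈⟨ ^-homo-* a (2 ℕ.^ i) (2 ℕ.^ i) ⟨
    a ^ (2 ℕ.^ i ℕ.+ 2 ℕ.^ i)        ≡⟨ ≡.cong (λ k → a ^ (2 ℕ.^ i ℕ.+ k)) (≡.sym (ℕ.+-identityʳ (2 ℕ.^ i))) ⟩
    a ^ (2 ℕ.^ suc i)                ∎

  frob-∑ : ∀ i n (f : ℕ → Carrier) → frob i (∑< n f) ≈ ∑< n (λ j → frob i (f j))
  frob-∑ i zero    f = frob-0 i
  frob-∑ i (suc n) f = trans (frob-+ i _ _) (+-congˡ (frob-∑ i n (f ∘ suc)))

  *-∑ : ∀ n a (f : ℕ → Carrier) → a * ∑< n f ≈ ∑< n (λ j → a * f j)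
  *-∑ zero    a f = zeroʳ a
  *-∑ (suc n) a f = trans (distribˡ a _ _) (+-congˡ (*-∑ n a (f ∘ suc)))

  ∑-* : ∀ n (f : ℕ → Carrier) a → ∑< n f * a ≈ ∑< n (λ j → f j * a)
  ∑-* n f a = trans (*-comm _ a) (trans (*-∑ n a f) (∑<-cong n (λ j → *-comm a (f j))))

  -- pow⁻ i a = a ^ (2 ^ i ∸ 1)
  pow⁻ : ℕ → Carrier → Carrier
  pow⁻ zero    a = 1#
  pow⁻ (suc i) a = pow⁻ i a * pow⁻ i a * a

  *-pow⁻ : ∀ i a → a * pow⁻ i a ≈ frob i a
  *-pow⁻ zero    a = *-identityʳ a
  *-pow⁻ (suc i) a = trans
    (solve 2 (λ a p → a :* (p :* p :* a) := (a :* p) :* (a :* p)) refl a (pow⁻ i a))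
    (*-cong (*-pow⁻ i a) (*-pow⁻ i a))

  pow⁻-cong : ∀ i {a b} → a ≈ b → pow⁻ i a ≈ pow⁻ i b
  pow⁻-cong zero    eq = refl
  pow⁻-cong (suc i) eq = *-cong (*-cong (pow⁻-cong i eq) (pow⁻-cong i eq)) eq

  frob-pow⁻ : ∀ j i a → frob j (pow⁻ i a) ≈ pow⁻ i (frob j a)
  frob-pow⁻ j zero    a = frob-1 j
  frob-pow⁻ j (suc i) a = trans (frob-* j _ a)
    (*-congʳ (trans (frob-* j _ _) (*-cong (frob-pow⁻ j i a) (frob-pow⁻ j i a))))

  -- Membership in the subring 𝔽₂[v], witnessed by a Horner scheme. Different schemes may give the
  -- same element, since `v` may satisfy relations.
  data Poly (v : Carrier) : Carrier → Set (c ⊔ ℓ) where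
    null   : ∀ {a} → a ≈ 0# → Poly v a
    horner : ∀ {a g} b → Poly v g → a ≈ ⟦ b ⟧₂ + v * g → Poly v a

  module _ {v : Carrier} where

    Poly-resp : ∀ {a b} → a ≈ b → Poly v a → Poly v b
    Poly-resp a≈b (null eq)       = null (trans (sym a≈b) eq)
    Poly-resp a≈b (horner s g eq) = horner s g (trans (sym a≈b) eq)

    Poly-0 : Poly v 0#
    Poly-0 = null refl

    Poly-⟦⟧ : ∀ b → Poly v ⟦ b ⟧₂
    Poly-⟦⟧ b = horner b Poly-0 (trans (sym (+-identityʳ _)) (+-congˡ (sym (zeroʳ v))))

    Poly-1 : Poly v 1#
    Poly-1 = Poly-⟦⟧ true

    Poly-v* : ∀ {a} → Poly v a → Poly v (v * a)
    Poly-v* p = horner false p (sym (+-identityˡ _))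

    Poly-v : Poly v v
    Poly-v = Poly-resp (*-identityʳ v) (Poly-v* Poly-1)

    Poly-+ : ∀ {a b} → Poly v a → Poly v b → Poly v (a + b)
    Poly-+ (null eq) q = Poly-resp (sym (trans (+-congʳ eq) (+-identityˡ _))) q
    Poly-+ p@(horner _ _ _) (null eq) = Poly-resp (sym (trans (+-congˡ eq) (+-identityʳ _))) p
    Poly-+ {a} {b} (horner {g = g} s p eq) (horner {g = h} t q eq′) = horner (s xor t) (Poly-+ p q) (begin
      a + b                              ≈⟨ +-cong eq eq′ ⟩
      ⟦ s ⟧₂ + v * g + (⟦ t ⟧₂ + v * h)
        ≈⟨ solve 5 (λ s t v g h → s :+ v :* g :+ (t :+ v :* h) := (s :+ t) :+ v :* (g :+ h)) refl ⟦ s ⟧₂ ⟦ t ⟧₂ v g h ⟩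
      (⟦ s ⟧₂ + ⟦ t ⟧₂) + v * (g + h)
        ≈⟨ +-congʳ (_-Raw-AlmostCommutative⟶_.+-homo coefficients s t) ⟨
      ⟦ s xor t ⟧₂ + v * (g + h)         ∎)

    Poly-⟦⟧* : ∀ b {a} → Poly v a → Poly v (⟦ b ⟧₂ * a)
    Poly-⟦⟧* false p = null (zeroˡ _)
    Poly-⟦⟧* true  p = Poly-resp (sym (*-identityˡ _)) p

    Poly-* : ∀ {a b} → Poly v a → Poly v b → Poly v (a * b)
    Poly-* (null eq) q = null (trans (*-congʳ eq) (zeroˡ _))
    Poly-* {a} {b} (horner {g = g} s p eq) q =
      Poly-resp (sym (trans (*-congʳ eq)
                  (solve 4 (λ s v g b → (s :+ v :* g) :* b := s :* b :+ v :* (g :* b)) refl ⟦ s ⟧₂ v g b)))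
                (Poly-+ (Poly-⟦⟧* s q) (Poly-v* (Poly-* p q)))

    Poly-frob : ∀ i {a} → Poly v a → Poly v (frob i a)
    Poly-frob zero    p = p
    Poly-frob (suc i) p = Poly-* (Poly-frob i p) (Poly-frob i p)

    Poly-pow⁻ : ∀ i {a} → Poly v a → Poly v (pow⁻ i a)
    Poly-pow⁻ zero    p = Poly-1
    Poly-pow⁻ (suc i) p = Poly-* (Poly-* (Poly-pow⁻ i p) (Poly-pow⁻ i p)) p

    Poly-∑ : ∀ n {f : ℕ → Carrier} → (∀ i → Poly v (f i)) → Poly v (∑< n f)
    Poly-∑ zero    p = Poly-0
    Poly-∑ (suc n) p = Poly-+ (p 0) (Poly-∑ n (p ∘ suc))

    -- `frob i` fixes coefficients in 𝔽₂, so on 𝔽₂[v] it is determined by its effect on `v`.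
    Poly-frob-idem : ∀ i → frob i (frob i v) ≈ frob i v → ∀ {a} → Poly v a → frob i (frob i a) ≈ frob i a
    Poly-frob-idem i idem (null eq) = frob-cong i (trans (trans (frob-cong i eq) (frob-0 i)) (sym eq))
    Poly-frob-idem i idem {a} (horner {g = g} b p eq) = begin
      frob i (frob i a)                              ≈⟨ frob-cong i expand ⟩
      frob i (⟦ b ⟧₂ + frob i v * frob i g)          ≈⟨ trans (frob-+ i _ _) (+-cong (frob-⟦⟧ i b) (frob-* i _ _)) ⟩
      ⟦ b ⟧₂ + frob i (frob i v) * frob i (frob i g) ≈⟨ +-congˡ (*-cong idem (Poly-frob-idem i idem p)) ⟩
      ⟦ b ⟧₂ + frob i v * frob i g                   ≈⟨ expand ⟨
      frob i a                                       ∎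
      where
      expand : frob i a ≈ ⟦ b ⟧₂ + frob i v * frob i g
      expand = trans (frob-cong i eq) (trans (frob-+ i _ _) (+-cong (frob-⟦⟧ i b) (frob-* i v g)))

    -- `frob i a` is the same polynomial evaluated at `frob i v`, and the difference of two
    -- arguments divides the difference of the values.
    Poly-frob-diff : ∀ i {a} → Poly v a →
      ∃[ g ] Poly v g × a + frob i a ≈ (v + frob i v) * g
    Poly-frob-diff i (null eq) = 0# , Poly-0 ,
      trans (trans (+-cong eq (trans (frob-cong i eq) (frob-0 i))) (x+x≈0 0#)) (sym (zeroʳ _))
    Poly-frob-diff i {a} (horner {g = g} s p eq) with Poly-frob-diff i p
    ... | g₁ , p₁ , eq₁ = g + frob i v * g₁ ,
      Poly-+ p (Poly-* (Poly-frob i Poly-v) p₁) , (begin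
        a + frob i a
          ≈⟨ +-cong eq (trans (frob-cong i eq) (trans (frob-+ i _ _) (+-cong (frob-⟦⟧ i s) (frob-* i v g)))) ⟩
        ⟦ s ⟧₂ + v * g + (⟦ s ⟧₂ + frob i v * frob i g)
          ≈⟨ solve 5 (λ s v g z f → s :+ v :* g :+ (s :+ z :* f) := (v :+ z) :* g :+ z :* (g :+ f))
               refl ⟦ s ⟧₂ v g (frob i v) (frob i g) ⟩
        (v + frob i v) * g + frob i v * (g + frob i g)
          ≈⟨ +-congˡ (*-congˡ eq₁) ⟩
        (v + frob i v) * g + frob i v * ((v + frob i v) * g₁)
          ≈⟨ solve 4 (λ m g z h → m :* g :+ z :* (m :* h) := m :* (g :+ z :* h))
               refl (v + frob i v) g (frob i v) g₁ ⟩
        (v + frob i v) * (g + frob i v * g₁) ∎)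

  *-inverse-unique : ∀ {a b c} → a * b ≈ 1# → a * c ≈ 1# → b ≈ c
  *-inverse-unique {a} {b} {c} ab ac = begin
    b            ≈⟨ *-identityˡ b ⟨
    1# * b       ≈⟨ *-congʳ ac ⟨
    a * c * b    ≈⟨ solve 3 (λ a b c → a :* c :* b := a :* b :* c) refl a b c ⟩
    a * b * c    ≈⟨ *-congʳ ab ⟩
    1# * c       ≈⟨ *-identityˡ c ⟩
    c            ∎

  1^ : ∀ k → 1# ^ k ≈ 1#
  1^ zero    = refl
  1^ (suc k) = trans (*-identityˡ _) (1^ k)

  ^-% : ∀ {a} n .{{_ : ℕ.NonZero n}} → a ^ n ≈ 1# → ∀ k → a ^ k ≈ a ^ (k % n)
  ^-% {a} n aⁿ≈1 k = begin
    a ^ k                                ≡⟨ ≡.cong (a ^_) (m≡m%n+[m/n]*n k n) ⟩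
    a ^ (k % n ℕ.+ k / n ℕ.* n)          ≈⟨ ^-homo-* a (k % n) (k / n ℕ.* n) ⟩
    a ^ (k % n) * a ^ (k / n ℕ.* n)      ≡⟨ ≡.cong (λ m → a ^ (k % n) * a ^ m) (ℕ.*-comm (k / n) n) ⟩
    a ^ (k % n) * a ^ (n ℕ.* (k / n))    ≈⟨ *-congˡ (^-assocʳ a n (k / n)) ⟨
    a ^ (k % n) * (a ^ n) ^ (k / n)      ≈⟨ *-congˡ (trans (^-congˡ (k / n) aⁿ≈1) (1^ (k / n))) ⟩
    a ^ (k % n) * 1#                     ≈⟨ *-identityʳ _ ⟩
    a ^ (k % n)                          ∎

  -- The powers of 2 repeat modulo n, from the i-th on with period d; any multiple s ≥ i of d works.
  frob-stabilises : ∀ {a} n .{{_ : ℕ.NonZero n}} → a ^ n ≈ 1# →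
    ∃[ s ] frob (suc s) (frob (suc s) a) ≈ frob (suc s) a
  frob-stabilises {a} n aⁿ≈1 = d ℕ.+ i ℕ.* suc d , (begin
    frob S (frob S a)     ≡⟨ frob-∘ S S a ⟨
    frob (S ℕ.+ S) a      ≈⟨ multiples (suc i) S (ℕ.≤-trans (ℕ.n≤1+n i) (ℕ.m≤m*n (suc i) (suc d))) ⟩
    frob S a              ∎)
    where
    collision : ∃[ k ] ∃[ l ] k Fin.< l × (2 ℕ.^ toℕ k) mod n ≡ (2 ℕ.^ toℕ l) mod n
    collision = Fin.pigeonhole (ℕ.n<1+n n) (λ k → (2 ℕ.^ toℕ k) mod n)

    i j d S : ℕ
    i = toℕ (proj₁ collision)
    j = toℕ (proj₁ (proj₂ collision))
    d = j ℕ.∸ suc i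
    S = suc i ℕ.* suc d

    d+i≡j : suc d ℕ.+ i ≡ j
    d+i≡j = ≡.trans (≡.sym (ℕ.+-suc d i)) (ℕ.m∸n+n≡m (proj₁ (proj₂ (proj₂ collision))))

    residues : (2 ℕ.^ i) % n ≡ (2 ℕ.^ j) % n
    residues = ≡.trans (≡.sym (Fin.toℕ-fromℕ< (m%n<n (2 ℕ.^ i) n)))
      (≡.trans (≡.cong toℕ (proj₂ (proj₂ (proj₂ collision)))) (Fin.toℕ-fromℕ< (m%n<n (2 ℕ.^ j) n)))

    repeat : frob j a ≈ frob i a
    repeat = begin
      frob j a               ≈⟨ trans (frob≈^ j a) (^-% n aⁿ≈1 _) ⟩
      a ^ ((2 ℕ.^ j) % n)    ≡⟨ ≡.cong (a ^_) residues ⟨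
      a ^ ((2 ℕ.^ i) % n)    ≈⟨ trans (frob≈^ i a) (^-% n aⁿ≈1 _) ⟨
      frob i a               ∎

    period : ∀ m → i ℕ.≤ m → frob (suc d ℕ.+ m) a ≈ frob m a
    period m i≤m = begin
      frob (suc d ℕ.+ m) a             ≡⟨ ≡.cong (λ k → frob (suc d ℕ.+ k) a) (ℕ.m∸n+n≡m i≤m) ⟨
      frob (suc d ℕ.+ (t ℕ.+ i)) a     ≡⟨ ≡.cong (λ k → frob k a) (x∙yz≈y∙xz (suc d) t i) ⟩
      frob (t ℕ.+ (suc d ℕ.+ i)) a     ≡⟨ ≡.cong (λ k → frob (t ℕ.+ k) a) d+i≡j ⟩
      frob (t ℕ.+ j) a                 ≡⟨ frob-∘ t j a ⟩
      frob t (frob j a)                ≈⟨ frob-cong t repeat ⟩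
      frob t (frob i a)                ≡⟨ frob-∘ t i a ⟨
      frob (t ℕ.+ i) a                 ≡⟨ ≡.cong (λ k → frob k a) (ℕ.m∸n+n≡m i≤m) ⟩
      frob m a                         ∎
      where
      t = m ℕ.∸ i
      open CommutativeSemigroupProperties ℕ.+-commutativeSemigroup using (x∙yz≈y∙xz)

    multiples : ∀ k m → i ℕ.≤ m → frob (k ℕ.* suc d ℕ.+ m) a ≈ frob m a
    multiples zero    m i≤m = refl
    multiples (suc k) m i≤m = begin
      frob (suc d ℕ.+ k ℕ.* suc d ℕ.+ m) a    ≡⟨ ≡.cong (λ u → frob u a) (ℕ.+-assoc (suc d) (k ℕ.* suc d) m) ⟩
      frob (suc d ℕ.+ (k ℕ.* suc d ℕ.+ m)) a  ≈⟨ period (k ℕ.* suc d ℕ.+ m) (ℕ.≤-trans i≤m (ℕ.m≤n+m m _)) ⟩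
      frob (k ℕ.* suc d ℕ.+ m) a              ≈⟨ multiples k m i≤m ⟩
      frob m a                                ∎

  inverse-^ : ∀ {x x̄} → x * x̄ ≈ 1# → ∀ i → x ^ i * x̄ ^ i ≈ 1#
  inverse-^ xx̄≈1 zero    = *-identityˡ 1#
  inverse-^ {x} {x̄} xx̄≈1 (suc i) = begin
    x * x ^ i * (x̄ * x̄ ^ i)    ≈⟨ solve 4 (λ x y a b → x :* a :* (y :* b) := x :* y :* (a :* b)) refl x x̄ (x ^ i) (x̄ ^ i) ⟩
    x * x̄ * (x ^ i * x̄ ^ i)    ≈⟨ *-cong xx̄≈1 (inverse-^ xx̄≈1 i) ⟩
    1# * 1#                    ≈⟨ *-identityˡ 1# ⟩
    1#                         ∎

  ^-complement : ∀ {x x̄ n} → x * x̄ ≈ 1# → x ^ n ≈ 1# → ∀ i j → i ℕ.+ j ≡ n → x ^ j ≈ x̄ ^ i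
  ^-complement {x} xx̄≈1 xⁿ≈1 i j ≡.refl = *-inverse-unique (trans (sym (^-homo-* x i j)) xⁿ≈1) (inverse-^ xx̄≈1 i)

  -- Norms and nilpotent corrections over 𝔽₂[w]

  module Norm (x x̄ : Carrier) (xx̄≈1 : x * x̄ ≈ 1#) (s′ : ℕ)
    (φφx≈φx : frob (suc s′) (frob (suc s′) x) ≈ frob (suc s′) x) where

    -- A positive exponent makes Q = 2 ^ s even. Hence Q - 1 is odd, and w * w divides φ(w) = w ^ Q.
    s : ℕ
    s = suc s′

    φ : Carrier → Carrier
    φ = frob s

    -- `e` is the cofactor of `w` in ν = w + w ^ Q. Trading a factor `ν` for `w * e` is how extra
    -- powers of `w` are gained below.
    w ν e : Carrier
    w = x + x̄
    ν = w + φ w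
    e = 1# + pow⁻ s w

    φxφx̄≈1 : φ x * φ x̄ ≈ 1#
    φxφx̄≈1 = trans (sym (frob-* s x x̄)) (trans (frob-cong s xx̄≈1) (frob-1 s))

    φφx̄≈φx̄ : φ (φ x̄) ≈ φ x̄
    φφx̄≈φx̄ = *-inverse-unique
      (trans (*-congʳ (sym φφx≈φx)) (trans (sym (frob-* s _ _)) (trans (frob-cong s φxφx̄≈1) (frob-1 s))))
      φxφx̄≈1

    φν≈0 : φ ν ≈ 0#
    φν≈0 = begin
      φ (w + φ w)               ≈⟨ frob-+ s _ _ ⟩
      φ w + φ (φ w)             ≈⟨ +-congˡ (frob-cong s (frob-+ s x x̄)) ⟩
      φ w + φ (φ x + φ x̄)       ≈⟨ +-congˡ (frob-+ s _ _) ⟩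
      φ w + (φ (φ x) + φ (φ x̄)) ≈⟨ +-cong (frob-+ s x x̄) (+-cong φφx≈φx φφx̄≈φx̄) ⟩
      φ x + φ x̄ + (φ x + φ x̄)   ≈⟨ x+x≈0 _ ⟩
      0#                        ∎

    ν≈we : ν ≈ w * e
    ν≈we = trans (+-congˡ (sym (*-pow⁻ s w)))
      (solve 2 (λ w p → w :+ w :* p := w :* (con true :+ p)) refl w (pow⁻ s w))

    Poly-ν : Poly w ν
    Poly-ν = Poly-+ Poly-v (Poly-frob s Poly-v)

    Poly-e : Poly w e
    Poly-e = Poly-+ Poly-1 (Poly-pow⁻ s Poly-v)

    -- As functions of `w` these are the Dickson polynomials of the first kind with parameter 1.
    D : ℕ → Carrier
    D i = x ^ i + x̄ ^ i

    D-suc : ∀ i → D (suc (suc i)) ≈ w * D (suc i) + D i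
    D-suc i = sym (begin
      w * D (suc i) + D i
        ≈⟨ solve 4 (λ x y X Y → (x :+ y) :* (x :* X :+ y :* Y) :+ (X :+ Y)
                      := x :* (x :* X) :+ y :* (y :* Y) :+ (x :* y :* (X :+ Y) :+ (X :+ Y)))
             refl x x̄ (x ^ i) (x̄ ^ i) ⟩
      D (suc (suc i)) + (x * x̄ * D i + D i)
        ≈⟨ +-congˡ (≈⇒+≈0 (trans (*-congʳ xx̄≈1) (*-identityˡ _))) ⟩
      D (suc (suc i)) + 0#   ≈⟨ +-identityʳ _ ⟩
      D (suc (suc i)) ∎)

    -- Modulo `w * w` the recursion `D-suc` produces 0, w, 0, w and so on, so only odd exponents
    -- contribute to the coefficient of `w`.
    D-even : ∀ l → ∃[ g ] Poly w g × D (l ℕ.+ l) ≈ w * w * g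
    D-odd : ∀ l → ∃[ g ] Poly w g × D (suc (l ℕ.+ l)) ≈ w + w * w * g

    D-even zero = 0# , Poly-0 , trans (x+x≈0 1#) (sym (zeroʳ _))
    D-even (suc l) rewrite ℕ.+-suc l l with D-even l | D-odd l
    ... | g , p , eq | h , q , eq′ = 1# + w * h + g , Poly-+ (Poly-+ Poly-1 (Poly-v* q)) p , (begin
      D (suc (suc (l ℕ.+ l)))                   ≈⟨ D-suc (l ℕ.+ l) ⟩
      w * D (suc (l ℕ.+ l)) + D (l ℕ.+ l)       ≈⟨ +-cong (*-congˡ eq′) eq ⟩
      w * (w + w * w * h) + w * w * g
        ≈⟨ solve 3 (λ w h g → w :* (w :+ w :* w :* h) :+ w :* w :* g := w :* w :* (con true :+ w :* h :+ g)) refl w h g ⟩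
      w * w * (1# + w * h + g) ∎)

    D-odd zero = 0# , Poly-0 ,
      trans (+-cong (*-identityʳ x) (*-identityʳ x̄)) (sym (trans (+-congˡ (zeroʳ _)) (+-identityʳ w)))
    D-odd (suc l) with D-even (suc l) | D-odd l
    ... | g , p , eq | h , q , eq′ = w * g + h , Poly-+ (Poly-v* p) q , (begin
      D (suc (suc l ℕ.+ suc l))                          ≈⟨ reflexive (≡.cong (D ∘ suc ∘ suc) (ℕ.+-suc l l)) ⟩
      D (suc (suc (suc (l ℕ.+ l))))                      ≈⟨ D-suc (suc (l ℕ.+ l)) ⟩
      w * D (suc (suc (l ℕ.+ l))) + D (suc (l ℕ.+ l))    ≈⟨ +-cong (*-congˡ (reflexive (≡.cong (D ∘ suc) (≡.sym (ℕ.+-suc l l))))) eq′ ⟩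
      w * D (suc l ℕ.+ suc l) + (w + w * w * h)          ≈⟨ +-congʳ (*-congˡ eq) ⟩
      w * (w * w * g) + (w + w * w * h)
        ≈⟨ solve 3 (λ w h g → w :* (w :* w :* g) :+ (w :+ w :* w :* h) := w :+ w :* w :* (w :* g :+ h)) refl w h g ⟩
      w + w * w * (w * g + h) ∎)

    D-poly : ∀ i → Poly w (D i)
    D-poly zero          = Poly-resp (sym (x+x≈0 1#)) Poly-0
    D-poly (suc zero)    = Poly-resp (sym (+-cong (*-identityʳ x) (*-identityʳ x̄))) Poly-v
    D-poly (suc (suc i)) = Poly-resp (sym (D-suc i)) (Poly-+ (Poly-v* (D-poly (suc i))) (D-poly i))

    -- The common shape of the correlation at hand and of the trinomial aimed at: 1 + w to first
    -- order, and 1 up to a nilpotent, as a + 1 has vanishing Q-th power. Any two such elements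
    -- differ by a norm, by `norm-equivalent`.
    record Tangent (a : Carrier) : Set (c ⊔ ℓ) where
      field
        {tail}    : Carrier
        Poly-tail : Poly w tail
        expansion : a ≈ 1# + w + w * w * tail
        unipotent : φ a ≈ 1#

      Poly-self : Poly w a
      Poly-self = Poly-resp (sym expansion)
        (Poly-+ (Poly-+ Poly-1 Poly-v) (Poly-* (Poly-v* Poly-v) Poly-tail))

      -- In a = φ(a) + (a + φ(a)) the first summand is 1, and the second pairs each term of the
      -- expansion with its Q-th power, which yields a factor `ν`. Beyond the linear term a factor
      -- `w` survives as well, from ν = w e or from φ(w).
      ν-expansion : ∃[ g ] Poly w g × a ≈ 1# + ν + ν * w * g
      ν-expansion with Poly-frob-diff s Poly-tail
      ... | g₁ , p₁ , eq₁ = e * g + pow⁻ s w * φ w * g₁ ,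
        Poly-+ (Poly-* Poly-e Poly-tail) (Poly-* (Poly-* (Poly-pow⁻ s Poly-v) (Poly-frob s Poly-v)) p₁) , (begin
          a                 ≈⟨ solve 2 (λ a b → a := b :+ (a :+ b)) refl a (φ a) ⟩
          φ a + (a + φ a)
            ≈⟨ +-cong unipotent (+-cong expansion (trans (frob-cong s expansion)
                 (trans (frob-+ s _ _) (+-cong (trans (frob-+ s _ _) (+-congʳ (frob-1 s)))
                   (trans (frob-* s _ _) (*-congʳ (frob-* s _ _))))))) ⟩
          1# + (1# + w + w * w * g + (1# + z + z * z * φ g))
            ≈⟨ solve 4 (λ w z g f → con true :+ (con true :+ w :+ w :* w :* g :+ (con true :+ z :+ z :* z :* f))
                 := con true :+ (w :+ z) :+ ((w :+ z) :* (w :+ z) :* g :+ z :* z :* (g :+ f)))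
                 refl w z g (φ g) ⟩
          1# + ν + (ν * ν * g + z * z * (g + φ g))
            ≈⟨ +-congˡ (+-cong (*-congʳ (*-congˡ ν≈we))
                 (*-cong (*-congʳ (sym (*-pow⁻ s w))) eq₁)) ⟩
          1# + ν + (ν * (w * e) * g + w * pow⁻ s w * z * (ν * g₁))
            ≈⟨ solve 7 (λ w v e g p z h → con true :+ v :+ (v :* (w :* e) :* g :+ w :* p :* z :* (v :* h))
                 := con true :+ v :+ v :* w :* (e :* g :+ p :* z :* h)) refl w ν e g (pow⁻ s w) z g₁ ⟩
          1# + ν + ν * w * (e * g + pow⁻ s w * z * g₁) ∎)
        where
        g = tail
        z = φ w

    -- Since x x̄ = 1, the product is 1 + w h + h * h. Taking h = w k puts the same factor w * w on
    -- both k and k * k; hence the shape of the right-hand side.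
    artin-schreier : ∀ {g} → Poly w g →
      ∃[ h ] Poly w h × (1# + x * h) * (1# + x̄ * h) ≈ 1# + w * w * (ν * g)
    artin-schreier {g} p = w * k , Poly-v* (Poly-∑ s (λ i → Poly-frob i (Poly-* Poly-ν p))) , (begin
      (1# + x * (w * k)) * (1# + x̄ * (w * k))
        ≈⟨ solve 3 (λ x y h → (con true :+ x :* h) :* (con true :+ y :* h)
             := con true :+ (x :+ y) :* h :+ x :* y :* (h :* h)) refl x x̄ (w * k) ⟩
      1# + w * (w * k) + x * x̄ * (w * k * (w * k))
        ≈⟨ +-congˡ (trans (*-congʳ xx̄≈1) (*-identityˡ _)) ⟩
      1# + w * (w * k) + w * k * (w * k)
        ≈⟨ solve 2 (λ w k → con true :+ w :* (w :* k) :+ w :* k :* (w :* k)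
             := con true :+ w :* w :* (k :+ k :* k)) refl w k ⟩
      1# + w * w * (k + k * k)   ≈⟨ +-congˡ (*-congˡ (telescope s)) ⟩
      1# + w * w * (y + φ y)     ≈⟨ +-congˡ (*-congˡ (+-congˡ (trans (frob-* s ν g) (trans (*-congʳ φν≈0) (zeroˡ _))))) ⟩
      1# + w * w * (y + 0#)      ≈⟨ +-congˡ (*-congˡ (+-identityʳ y)) ⟩
      1# + w * w * y             ∎)
      where
      y = ν * g
      k = ∑< s (λ i → frob i y)
      telescope : ∀ m → let k = ∑< m (λ i → frob i y) in k + k * k ≈ y + frob m y
      telescope zero    = trans (+-congˡ (zeroˡ _)) (trans (+-identityʳ 0#) (sym (x+x≈0 y)))
      telescope (suc m) = begin
        k₁ + k₁ * k₁       ≈⟨ +-cong k≈ (*-cong k≈ k≈) ⟩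
        (k′ + z) + (k′ + z) * (k′ + z)
          ≈⟨ solve 2 (λ k z → (k :+ z) :+ (k :+ z) :* (k :+ z) := (k :+ k :* k) :+ (z :+ z :* z)) refl k′ z ⟩
        (k′ + k′ * k′) + (z + z * z)   ≈⟨ +-congʳ (telescope m) ⟩
        (y + z) + (z + z * z)          ≈⟨ solve 2 (λ y z → (y :+ z) :+ (z :+ z :* z) := y :+ z :* z) refl y z ⟩
        y + z * z                      ∎
        where
        k₁ = ∑< (suc m) (λ i → frob i y)
        k′ = ∑< m (λ i → frob i y)
        z = frob m y
        k≈ : k₁ ≈ k′ + z
        k≈ = ∑<-last m (λ i → frob i y)

    unipotent-inverse : ∀ {a} → φ a ≈ 1# → a * pow⁻ s a ≈ 1#
    unipotent-inverse {a} eq = trans (*-pow⁻ s a) eq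

    private
      -- Removes the term linear in `w`. If the constant coefficient of `G` is 1, the unwanted ν w
      -- is paired with the ν * ν that the choice t = ν brings in: their sum is ν φ(w), and φ(w) is
      -- divisible by w * w because Q is at least 2.
      clear : ∀ {G} → Poly w G → ∃[ t ] ∃[ G₂ ] Poly w t × φ t ≈ 0# × Poly w G₂ ×
        (1# + t * t) * (1# + ν * w * G) ≈ 1# + w * w * (ν * G₂)
      clear (null eq) = 0# , 0# , Poly-0 , frob-0 s , Poly-0 ,
        trans (*-congˡ (+-congˡ (*-congˡ eq)))
          (solve 2 (λ w v → (con true :+ con false :* con false) :* (con true :+ v :* w :* con false)
            := con true :+ w :* w :* (v :* con false)) refl w ν)
      clear (horner {g = G′} false p eq) = 0# , G′ , Poly-0 , frob-0 s , p ,
        trans (*-congˡ (+-congˡ (*-congˡ eq)))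
          (solve 3 (λ w v G → (con true :+ con false :* con false) :* (con true :+ v :* w :* (con false :+ w :* G))
            := con true :+ w :* w :* (v :* G)) refl w ν G′)
      clear {G} (horner {g = G′} true p eq) =
        ν , q * q + G′ + ν * e + ν * ν * G′ , Poly-ν , φν≈0 ,
        Poly-+ (Poly-+ (Poly-+ (Poly-* Pq Pq) p) (Poly-* Poly-ν Poly-e)) (Poly-* (Poly-* Poly-ν Poly-ν) p) , (begin
          (1# + ν * ν) * (1# + ν * w * G)
            ≈⟨ *-congˡ (+-congˡ (*-congˡ eq)) ⟩
          (1# + ν * ν) * (1# + ν * w * (1# + w * G′))
            ≈⟨ solve 3 (λ w v G → (con true :+ v :* v) :* (con true :+ v :* w :* (con true :+ w :* G))
                 := con true :+ v :* w :+ v :* v :+ w :* w :* (v :* G) :+ v :* v :* w :* v :+ w :* w :* (v :* (v :* v :* G)))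
                 refl w ν G′ ⟩
          1# + ν * w + ν * ν + w * w * (ν * G′) + ν * ν * w * ν + w * w * (ν * (ν * ν * G′))
            ≈⟨ +-congʳ (+-cong (+-congʳ (+-congˡ (*-congˡ ν≈we))) (*-congˡ ν≈we)) ⟩
          1# + ν * w + ν * (w * (1# + q * q * w)) + w * w * (ν * G′) + ν * ν * w * (w * e) + w * w * (ν * (ν * ν * G′))
            ≈⟨ solve 5 (λ w v G q e →
                 con true :+ v :* w :+ v :* (w :* (con true :+ q :* q :* w)) :+ w :* w :* (v :* G) :+ v :* v :* w :* (w :* e) :+ w :* w :* (v :* (v :* v :* G))
                 := con true :+ w :* w :* (v :* (q :* q :+ G :+ v :* e :+ v :* v :* G))) refl w ν G′ q e ⟩
          1# + w * w * (ν * (q * q + G′ + ν * e + ν * ν * G′)) ∎)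
        where
        q = pow⁻ s′ w
        Pq = Poly-pow⁻ s′ Poly-v

    -- `d` is the inverse of 1 + t and undoes the multiplier (1 + t)² introduced by `clear`. As it
    -- lies in 𝔽₂[w], it equals its own conjugate, so d * d is a norm.
    norm-equivalent : ∀ {a b} → Tangent a → Tangent b → ∃[ h ] ∃[ d ] Poly w h × Poly w d ×
      (1# + x * h) * (1# + x̄ * h) * (d * d) * a ≈ b
    norm-equivalent {a} {b} A B = h , d , proj₁ (proj₂ normed) , Poly-pow⁻ s (Poly-+ Poly-1 Poly-t) , (begin
        (1# + x * h) * (1# + x̄ * h) * (d * d) * a
          ≈⟨ *-congʳ (*-congʳ (trans (proj₂ (proj₂ normed)) (sym cleared-eq))) ⟩
        (1# + t * t) * (1# + ν * w * ((g + g′) * a⁻¹)) * (d * d) * a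
          ≈⟨ *-congʳ (*-congʳ (*-congˡ ratio)) ⟩
        (1# + t * t) * (b * a⁻¹) * (d * d) * a
          ≈⟨ solve 5 (λ t b a i d → (con true :+ t :* t) :* (b :* i) :* (d :* d) :* a
               := ((con true :+ t) :* d) :* ((con true :+ t) :* d) :* (a :* i) :* b) refl t b a a⁻¹ d ⟩
        (1# + t) * d * ((1# + t) * d) * (a * a⁻¹) * b
          ≈⟨ *-congʳ (*-cong (*-cong td td) (unipotent-inverse (Tangent.unipotent A))) ⟩
        1# * 1# * 1# * b
          ≈⟨ solve 1 (λ b → con true :* con true :* con true :* b := b) refl b ⟩
        b ∎)
      where
      g = proj₁ (Tangent.ν-expansion A)
      g′ = proj₁ (Tangent.ν-expansion B)
      cleared = clear (Poly-* (Poly-+ (proj₁ (proj₂ (Tangent.ν-expansion A))) (proj₁ (proj₂ (Tangent.ν-expansion B))))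
                              (Poly-pow⁻ s (Tangent.Poly-self A)))
      t = proj₁ cleared
      G = proj₁ (proj₂ cleared)
      Poly-t = proj₁ (proj₂ (proj₂ cleared))
      φt≈0 = proj₁ (proj₂ (proj₂ (proj₂ cleared)))
      Poly-G = proj₁ (proj₂ (proj₂ (proj₂ (proj₂ cleared))))
      cleared-eq = proj₂ (proj₂ (proj₂ (proj₂ (proj₂ cleared))))
      normed = artin-schreier Poly-G
      h = proj₁ normed
      a⁻¹ = pow⁻ s a
      d = pow⁻ s (1# + t)
      td : (1# + t) * d ≈ 1#
      td = unipotent-inverse (trans (frob-+ s _ _) (trans (+-cong (frob-1 s) φt≈0) (+-identityʳ 1#)))
      -- Both expansions share 1 + ν, so `a` and `b` differ by a multiple of ν w.
      ratio : 1# + ν * w * ((g + g′) * a⁻¹) ≈ b * a⁻¹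
      ratio = begin
        1# + ν * w * ((g + g′) * a⁻¹)
          ≈⟨ +-congʳ (unipotent-inverse (Tangent.unipotent A)) ⟨
        a * a⁻¹ + ν * w * ((g + g′) * a⁻¹)
          ≈⟨ +-congʳ (*-congʳ (proj₂ (proj₂ (Tangent.ν-expansion A)))) ⟩
        (1# + ν + ν * w * g) * a⁻¹ + ν * w * ((g + g′) * a⁻¹)
          ≈⟨ solve 5 (λ v w g h i → (con true :+ v :+ v :* w :* g) :* i :+ v :* w :* ((g :+ h) :* i)
               := (con true :+ v :+ v :* w :* h) :* i) refl ν w g g′ a⁻¹ ⟩
        (1# + ν + ν * w * g′) * a⁻¹
          ≈⟨ *-congʳ (proj₂ (proj₂ (Tangent.ν-expansion B))) ⟨
        b * a⁻¹ ∎

    -- Sesquilinear forms and the enlargement of the idempotent φ(C θ θ)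

    record HermitianForm v : Set (c ⊔ ℓ ⊔ lsuc v) where
      infixl 5 _⊹_
      infixr 6 _▷_
      field
        {V}       : Set v
        𝟎         : V
        _⊹_       : V → V → V
        _▷_       : Carrier → V → V
        C         : V → V → Carrier
        C-0       : C 𝟎 𝟎 ≈ 0#
        C-+ˡ      : ∀ δ δ′ η → C (δ ⊹ δ′) η ≈ C δ η + C δ′ η
        C-+ʳ      : ∀ δ η η′ → C δ (η ⊹ η′) ≈ C δ η + C δ η′
        C-▷ˡ      : ∀ a δ η → C (a ▷ δ) η ≈ a * C δ η
        C-x▷ʳ     : ∀ δ η → C δ (x ▷ η) ≈ x̄ * C δ η
        -- The second argument is conjugate-linear for the exchange of `x` and `x̄`; elements of
        -- 𝔽₂[w] are self-conjugate and come out unchanged.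
        C-▷ʳ      : ∀ {h} → Poly w h → ∀ δ η → C δ (h ▷ η) ≈ h * C δ η
        C-poly    : ∀ δ → Poly w (C δ δ)
        faithful  : ∀ {a} → (∀ δ η → a * C δ η ≈ 0#) → a ≈ 0#

    module _ (x-generates : ∀ a → Poly x a) {v} (form : HermitianForm v) where

      open HermitianForm form

      φφ : ∀ a → φ (φ a) ≈ φ a
      φφ a = Poly-frob-idem s φφx≈φx (x-generates a)

      φ-idempotent : ∀ {f} → f * f ≈ f → φ f ≈ f
      φ-idempotent {f} ff≈f = go s
        where
        go : ∀ i → frob i f ≈ f
        go zero    = refl
        go (suc i) = trans (*-cong (go i) (go i)) ff≈f

      C-square : ∀ δ η → C (δ ⊹ η) (δ ⊹ η) ≈ C δ δ + (C δ η + C η δ) + C η η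
      C-square δ η = begin
        C (δ ⊹ η) (δ ⊹ η)                          ≈⟨ C-+ˡ δ η (δ ⊹ η) ⟩
        C δ (δ ⊹ η) + C η (δ ⊹ η)                  ≈⟨ +-cong (C-+ʳ δ δ η) (C-+ʳ η δ η) ⟩
        C δ δ + C δ η + (C η δ + C η η)
          ≈⟨ solve 4 (λ a b c d → a :+ b :+ (c :+ d) := a :+ (b :+ c) :+ d) refl (C δ δ) (C δ η) (C η δ) (C η η) ⟩
        C δ δ + (C δ η + C η δ) + C η η            ∎

      module Orthogonal {f} (ff≈f : f * f ≈ f) (f⊥ : ∀ δ → f * φ (C δ δ) ≈ 0#) where

        polarised : ∀ δ η → f * (φ (C δ η) + φ (C η δ)) ≈ 0#
        polarised δ η = begin
          f * (p + q)
            ≈⟨ solve 5 (λ f a p q d → f :* (p :+ q) := f :* (a :+ (p :+ q) :+ d) :+ (f :* a :+ f :* d))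
                 refl f (φ (C δ δ)) p q (φ (C η η)) ⟩
          f * (φ (C δ δ) + (p + q) + φ (C η η)) + (f * φ (C δ δ) + f * φ (C η η))
            ≈⟨ +-cong (*-congˡ φ-square) (+-cong (sym (f⊥ δ)) (sym (f⊥ η))) ⟨
          f * φ (C (δ ⊹ η) (δ ⊹ η)) + (0# + 0#)
            ≈⟨ +-cong (f⊥ (δ ⊹ η)) (+-identityˡ 0#) ⟩
          0# + 0#
            ≈⟨ +-identityˡ 0# ⟩
          0# ∎
          where
          p = φ (C δ η)
          q = φ (C η δ)
          φ-square : φ (C (δ ⊹ η) (δ ⊹ η)) ≈ φ (C δ δ) + (p + q) + φ (C η η)
          φ-square = trans (frob-cong s (C-square δ η))
            (trans (frob-+ s _ _) (+-congʳ (trans (frob-+ s _ _) (+-congˡ (frob-+ s _ _)))))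

        -- `μ` is nilpotent and divides a + φ(a) for every `a`, hence it divides every `a` that φ
        -- kills.
        g H μ : Carrier
        g = f * w
        H = φ g
        μ = x + φ x

        -- Compare `polarised` at (δ, η) and at (x ▷ δ, η): the second relation carries φ(x) on one
        -- mixed term and φ(x̄) on the other, so eliminating C η δ leaves the factor φ(x) + φ(x̄) =
        -- φ(w).
        gC-nilpotent : ∀ δ η → φ (g * C δ η) ≈ 0#
        gC-nilpotent δ η = begin
          φ (g * C δ η)
            ≈⟨ trans (frob-* s _ _) (*-congʳ (trans (frob-* s _ _) (*-cong (φ-idempotent ff≈f) (frob-+ s x x̄)))) ⟩
          f * (φ x + φ x̄) * p
            ≈⟨ solve 5 (λ f x y p q → f :* (x :+ y) :* p := f :* (x :* p :+ y :* q) :+ y :* (f :* (p :+ q)))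
                 refl f (φ x) (φ x̄) p q ⟩
          f * (φ x * p + φ x̄ * q) + φ x̄ * (f * (p + q))
            ≈⟨ +-cong (*-congˡ (+-cong (trans (sym (frob-* s _ _)) (frob-cong s (sym (C-▷ˡ x δ η))))
                                       (trans (sym (frob-* s _ _)) (frob-cong s (sym (C-x▷ʳ η δ))))))
                      (*-congˡ (polarised δ η)) ⟩
          f * (φ (C (x ▷ δ) η) + φ (C η (x ▷ δ))) + φ x̄ * 0#
            ≈⟨ +-cong (polarised (x ▷ δ) η) (zeroʳ _) ⟩
          0# + 0#
            ≈⟨ +-identityˡ 0# ⟩
          0# ∎
          where
          p = φ (C δ η)
          q = φ (C η δ)

        Cancellable : Carrier → Set _
        Cancellable v = ∀ a → a * H * v ≈ 0# → a * H ≈ 0#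

        -- A nilpotent g * C δ η is a multiple of μ, so a * H * μ ≈ 0# forces a * H * g * C δ η ≈ 0#.
        cancel-μ : Cancellable μ
        cancel-μ a aHμ≈0 = begin
          a * H                        ≈⟨ *-congˡ (trans (*-pow⁻ s H) (φφ g)) ⟨
          a * (H * (r * r * H))        ≈⟨ *-congˡ (*-congˡ (*-congˡ (*-pow⁻ s g))) ⟨
          a * (H * (r * r * (g * t)))
            ≈⟨ solve 5 (λ a h r g t → a :* (h :* (r :* r :* (g :* t))) := a :* h :* g :* (r :* r :* t)) refl a H r g t ⟩
          a * H * g * (r * r * t)      ≈⟨ *-congʳ (faithful aHgC≈0) ⟩
          0# * (r * r * t)             ≈⟨ zeroˡ _ ⟩
          0#                           ∎
          where
          r = pow⁻ s′ H
          t = pow⁻ s g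
          aHgC≈0 : ∀ δ η → a * H * g * C δ η ≈ 0#
          aHgC≈0 δ η = begin
            a * H * g * C δ η                            ≈⟨ *-assoc (a * H) g _ ⟩
            a * H * (g * C δ η)                          ≈⟨ *-congˡ (trans (+-congˡ (gC-nilpotent δ η)) (+-identityʳ _)) ⟨
            a * H * (g * C δ η + φ (g * C δ η))          ≈⟨ *-congˡ (proj₂ (proj₂ quotient)) ⟩
            a * H * (μ * proj₁ quotient)                 ≈⟨ *-assoc (a * H) μ _ ⟨
            a * H * μ * proj₁ quotient                   ≈⟨ *-congʳ aHμ≈0 ⟩
            0# * proj₁ quotient                          ≈⟨ zeroˡ _ ⟩
            0#                                           ∎
            where quotient = Poly-frob-diff s (x-generates (g * C δ η))

        -- A square is cancelled by cancelling twice. At exponent `s` the element to cancel has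
        -- become φ(μ) = 0, and this forces `H` to vanish.
        cancel-frob-μ : ∀ i → Cancellable (frob i μ)
        cancel-frob-μ zero    = cancel-μ
        cancel-frob-μ (suc i) a eq = cancel-frob-μ i a (begin
          a * H * frob i μ          ≈⟨ solve 3 (λ a h m → a :* h :* m := a :* m :* h) refl a H (frob i μ) ⟩
          a * frob i μ * H          ≈⟨ cancel-frob-μ i (a * frob i μ) (trans
            (solve 3 (λ a h m → a :* m :* h :* m := a :* h :* (m :* m)) refl a H (frob i μ)) eq) ⟩
          0#                        ∎)

        H≈0 : H ≈ 0#
        H≈0 = trans (sym (*-identityˡ H)) (cancel-frob-μ s 1# (trans (*-congˡ φμ≈0) (zeroʳ _)))
          where
          φμ≈0 : φ μ ≈ 0#
          φμ≈0 = trans (frob-+ s x (φ x)) (≈⇒+≈0 (sym φφx≈φx))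

        -- H = 0 says f φ(x) = f φ(x̄), hence f φ(x)² = f. Since φ(x) equals its own Q-th power,
        -- further squaring leads back to f φ(x).
        fφx≈f : f * φ x ≈ f
        fφx≈f = trans (*-congˡ (sym φφx≈φx)) (iterate s′)
          where
          base : f * (φ x * φ x) ≈ f
          base = begin
            f * (φ x * φ x)
              ≈⟨ solve 3 (λ f x y → f :* (x :* x) := x :* (f :* (x :+ y)) :+ f :* (x :* y)) refl f (φ x) (φ x̄) ⟩
            φ x * (f * (φ x + φ x̄)) + f * (φ x * φ x̄)
              ≈⟨ +-cong (*-congˡ (*-cong (sym (φ-idempotent ff≈f)) (sym (frob-+ s x x̄)))) (*-congˡ φxφx̄≈1) ⟩
            φ x * (φ f * φ w) + f * 1#
              ≈⟨ +-cong (*-congˡ (trans (sym (frob-* s f w)) H≈0)) (*-identityʳ f) ⟩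
            φ x * 0# + f
              ≈⟨ trans (+-congʳ (zeroʳ _)) (+-identityˡ f) ⟩
            f ∎
          iterate : ∀ i → f * frob (suc i) (φ x) ≈ f
          iterate zero    = base
          iterate (suc i) = trans (sym (*-assoc _ _ _)) (trans (*-congʳ (iterate i)) (iterate i))

      Covers : V → V → Set _
      Covers θ δ = (1# + φ (C θ θ)) * φ (C δ δ) ≈ 0#

      -- Cross terms between ε θ and a multiple of f δ vanish because ε f = 0. The part of φ(C δ δ)
      -- still uncovered is a = f φ(C δ δ), which φ fixes, so a ^ (Q - 1) is the idempotent carrying
      -- it; adding b f δ enlarges ε by exactly this idempotent.
      extend : ∀ θ δ → φ (C θ θ) * φ (C θ θ) ≈ φ (C θ θ) →
        ∃[ θ′ ] φ (C θ′ θ′) * φ (C θ′ θ′) ≈ φ (C θ′ θ′) × Covers θ′ δ × (∀ {η} → Covers θ η → Covers θ′ η)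
      extend θ δ εε≈ε = θ′ , idem , covers-δ , covers-old
        where
        ε = φ (C θ θ)
        p = φ (C δ δ)
        f = 1# + ε
        a = f * p
        -- This is a ^ (Q / 2 - 1). A scalar enters the form twice, and φ(C δ δ) supplies one more
        -- factor `a`, which makes up the odd exponent Q - 1.
        b = pow⁻ s′ a
        ε₁ = b * b * a
        θ′ = ε ▷ θ ⊹ b * f ▷ δ

        Poly-ε : Poly w ε
        Poly-ε = Poly-frob s (C-poly θ)
        Poly-f : Poly w f
        Poly-f = Poly-+ Poly-1 Poly-ε
        Poly-bf : Poly w (b * f)
        Poly-bf = Poly-* (Poly-pow⁻ s′ (Poly-* Poly-f (Poly-frob s (C-poly δ)))) Poly-f

        εf≈0 : ε * f ≈ 0#
        εf≈0 = trans (solve 1 (λ e → e :* (con true :+ e) := e :+ e :* e) refl ε) (≈⇒+≈0 (sym εε≈ε))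
        ff≈f : f * f ≈ f
        ff≈f = trans (solve 1 (λ e → (con true :+ e) :* (con true :+ e) := con true :+ e :* e) refl ε) (+-congˡ εε≈ε)
        fa≈a : f * a ≈ a
        fa≈a = trans (sym (*-assoc f f p)) (*-congʳ ff≈f)
        φa≈a : φ a ≈ a
        φa≈a = trans (frob-* s f p) (*-cong (φ-idempotent ff≈f) (φφ (C δ δ)))
        aε₁≈a : a * ε₁ ≈ a
        aε₁≈a = trans (*-pow⁻ s a) φa≈a
        ε₁ε₁≈ε₁ : ε₁ * ε₁ ≈ ε₁
        ε₁ε₁≈ε₁ = trans (*-assoc (b * b) a ε₁) (*-congˡ aε₁≈a)
        fε₁≈ε₁ : f * ε₁ ≈ ε₁
        fε₁≈ε₁ = trans (solve 3 (λ f b a → f :* (b :* b :* a) := b :* b :* (f :* a)) refl f b a) (*-congˡ fa≈a)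

        C-scaled : ∀ {k l} → Poly w k → Poly w l → ∀ δ η → C (k ▷ δ) (l ▷ η) ≈ k * l * C δ η
        C-scaled {k} {l} _ Pl δ η = trans (C-▷ˡ k δ (l ▷ η)) (trans (*-congˡ (C-▷ʳ Pl δ η)) (sym (*-assoc k l _)))

        C-θ′ : C θ′ θ′ ≈ ε * C θ θ + b * b * f * C δ δ
        C-θ′ = begin
          C θ′ θ′
            ≈⟨ C-square (ε ▷ θ) (b * f ▷ δ) ⟩
          C (ε ▷ θ) (ε ▷ θ) + (C (ε ▷ θ) (b * f ▷ δ) + C (b * f ▷ δ) (ε ▷ θ)) + C (b * f ▷ δ) (b * f ▷ δ)
            ≈⟨ +-cong (+-cong (C-scaled Poly-ε Poly-ε θ θ) (+-cong (C-scaled Poly-ε Poly-bf θ δ) (C-scaled Poly-bf Poly-ε δ θ)))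
                      (C-scaled Poly-bf Poly-bf δ δ) ⟩
          ε * ε * C θ θ + (ε * (b * f) * C θ δ + b * f * ε * C δ θ) + b * f * (b * f) * C δ δ
            ≈⟨ solve 7 (λ e b f t p q d → e :* e :* t :+ (e :* (b :* f) :* p :+ b :* f :* e :* q) :+ b :* f :* (b :* f) :* d
                 := e :* e :* t :+ e :* f :* (b :* (p :+ q)) :+ b :* b :* (f :* f) :* d)
                 refl ε b f (C θ θ) (C θ δ) (C δ θ) (C δ δ) ⟩
          ε * ε * C θ θ + ε * f * (b * (C θ δ + C δ θ)) + b * b * (f * f) * C δ δ
            ≈⟨ +-cong (+-cong (*-congʳ εε≈ε) (trans (*-congʳ εf≈0) (zeroˡ _))) (*-congʳ (*-congˡ ff≈f)) ⟩
          ε * C θ θ + 0# + b * b * f * C δ δ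
            ≈⟨ +-congʳ (+-identityʳ _) ⟩
          ε * C θ θ + b * b * f * C δ δ ∎

        ε′≈ : φ (C θ′ θ′) ≈ ε + ε₁
        ε′≈ = begin
          φ (C θ′ θ′)
            ≈⟨ trans (frob-cong s C-θ′) (frob-+ s _ _) ⟩
          φ (ε * C θ θ) + φ (b * b * f * C δ δ)
            ≈⟨ +-cong (frob-* s _ _) (trans (frob-* s _ _) (*-congʳ (trans (frob-* s _ _) (*-congʳ (frob-* s _ _))))) ⟩
          φ ε * ε + φ b * φ b * φ f * p
            ≈⟨ +-cong (*-congʳ (φφ (C θ θ))) (*-congʳ (*-cong (*-cong φb≈b φb≈b) (φ-idempotent ff≈f))) ⟩
          ε * ε + b * b * f * p
            ≈⟨ +-cong εε≈ε (*-assoc (b * b) f p) ⟩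
          ε + ε₁ ∎
          where
          φb≈b : φ b ≈ b
          φb≈b = trans (frob-pow⁻ s s′ a) (pow⁻-cong s′ φa≈a)

        idem : φ (C θ′ θ′) * φ (C θ′ θ′) ≈ φ (C θ′ θ′)
        idem = begin
          φ (C θ′ θ′) * φ (C θ′ θ′)        ≈⟨ *-cong ε′≈ ε′≈ ⟩
          (ε + ε₁) * (ε + ε₁)              ≈⟨ solve 2 (λ e d → (e :+ d) :* (e :+ d) := e :* e :+ d :* d) refl ε ε₁ ⟩
          ε * ε + ε₁ * ε₁                  ≈⟨ +-cong εε≈ε ε₁ε₁≈ε₁ ⟩
          ε + ε₁                           ≈⟨ ε′≈ ⟨
          φ (C θ′ θ′)                      ∎

        residual : ∀ p → (1# + φ (C θ′ θ′)) * p ≈ f * p + ε₁ * (f * p)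
        residual p = begin
          (1# + φ (C θ′ θ′)) * p      ≈⟨ *-congʳ (+-congˡ ε′≈) ⟩
          (1# + (ε + ε₁)) * p         ≈⟨ solve 3 (λ e d p → (con true :+ (e :+ d)) :* p := (con true :+ e) :* p :+ d :* p) refl ε ε₁ p ⟩
          f * p + ε₁ * p              ≈⟨ +-congˡ (*-congʳ (sym fε₁≈ε₁)) ⟩
          f * p + f * ε₁ * p          ≈⟨ +-congˡ (solve 3 (λ f d p → f :* d :* p := d :* (f :* p)) refl f ε₁ p) ⟩
          f * p + ε₁ * (f * p)        ∎

        covers-δ : Covers θ′ δ
        covers-δ = trans (residual p) (≈⇒+≈0 (trans (sym aε₁≈a) (*-comm a ε₁)))

        covers-old : ∀ {η} → Covers θ η → Covers θ′ η
        covers-old {η} fp≈0 = trans (residual (φ (C η η)))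
          (trans (+-cong fp≈0 (trans (*-congˡ fp≈0) (zeroʳ ε₁))) (+-identityˡ 0#))

      cover-list : ∀ (δs : List V) → ∃[ θ ] φ (C θ θ) * φ (C θ θ) ≈ φ (C θ θ) × All (Covers θ) δs
      cover-list []       = 𝟎 , trans (*-cong ε≈0 ε≈0) (trans (zeroˡ 0#) (sym ε≈0)) , []
        where
        ε≈0 : φ (C 𝟎 𝟎) ≈ 0#
        ε≈0 = trans (frob-cong s C-0) (frob-0 s)
      cover-list (δ ∷ δs) = proj₁ extended , proj₁ (proj₂ extended) ,
        proj₁ (proj₂ (proj₂ extended)) ∷ All.map (proj₂ (proj₂ (proj₂ extended))) (proj₂ (proj₂ rest))
        where
        rest = cover-list δs
        extended = extend (proj₁ rest) δ (proj₁ (proj₂ rest))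

    -- Multiplying by φ(a) gives φ(a ^ Q) = φ(φ(a)) = φ(a), and φ(a) is a unit.
    φ-power≈1 : ∀ {a a⁻¹} → a * a⁻¹ ≈ 1# → φ (φ a) ≈ φ a → ∀ {k} → suc k ≡ 2 ℕ.^ s → φ (a ^ k) ≈ 1#
    φ-power≈1 {a} {a⁻¹} aa⁻¹≈1 φφa≈φa {k} eq = begin
      φ (a ^ k)                          ≈⟨ *-identityʳ _ ⟨
      φ (a ^ k) * 1#                     ≈⟨ *-congˡ φaφa⁻¹≈1 ⟨
      φ (a ^ k) * (φ a * φ a⁻¹)          ≈⟨ solve 3 (λ p a b → p :* (a :* b) := a :* p :* b) refl _ _ _ ⟩
      φ a * φ (a ^ k) * φ a⁻¹            ≈⟨ *-congʳ (frob-* s a (a ^ k)) ⟨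
      φ (a ^ suc k) * φ a⁻¹              ≈⟨ *-congʳ (frob-cong s (trans (^-congʳ a eq) (sym (frob≈^ s a)))) ⟩
      φ (φ a) * φ a⁻¹                    ≈⟨ *-congʳ φφa≈φa ⟩
      φ a * φ a⁻¹                        ≈⟨ φaφa⁻¹≈1 ⟩
      1#                                 ∎
      where
      φaφa⁻¹≈1 : φ a * φ a⁻¹ ≈ 1#
      φaφa⁻¹≈1 = trans (sym (frob-* s a a⁻¹)) (trans (frob-cong s aa⁻¹≈1) (frob-1 s))

    target : ∃[ k ] Tangent (1# + D (suc (k ℕ.+ k)))
    target = k , record
      { Poly-tail = proj₁ (proj₂ (D-odd k))
      ; expansion = trans (+-congˡ (proj₂ (proj₂ (D-odd k)))) (sym (+-assoc _ _ _))
      ; unipotent = begin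
          φ (1# + (x ^ m + x̄ ^ m))      ≈⟨ trans (frob-+ s _ _) (+-cong (frob-1 s) (frob-+ s _ _)) ⟩
          1# + (φ (x ^ m) + φ (x̄ ^ m))
            ≈⟨ +-congˡ (+-cong (φ-power≈1 xx̄≈1 φφx≈φx eq) (φ-power≈1 (trans (*-comm x̄ x) xx̄≈1) φφx̄≈φx̄ eq)) ⟩
          1# + (1# + 1#)                ≈⟨ trans (+-congˡ (x+x≈0 1#)) (+-identityʳ 1#) ⟩
          1#                            ∎
      }
      where
      -- Chosen so that 2 k + 1 = 2 ^ s - 1 = Q - 1.
      k = ℕ.pred (2 ℕ.^ s′)
      m = suc (k ℕ.+ k)
      suc-k : suc k ≡ 2 ℕ.^ s′
      suc-k = ℕ.suc-pred (2 ℕ.^ s′) {{ℕ.m^n≢0 2 s′}}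
      eq : suc m ≡ 2 ℕ.^ s
      eq = ≡.trans (≡.cong suc (≡.sym (ℕ.+-suc k k)))
        (≡.cong₂ ℕ._+_ suc-k (≡.trans suc-k (≡.sym (ℕ.+-identityʳ (2 ℕ.^ s′)))))

    -- Symmetric elements of A as polynomials in w

    module _ (q′ : ℕ)
      (xⁿ≈1 : x ^ ((suc q′ ℕ.+ suc q′) ℕ.+ (suc q′ ℕ.+ suc q′)) ≈ 1#)
      (b : ℕ → Bool)
      (b-symmetric : ∀ i j → i ℕ.+ j ≡ (suc q′ ℕ.+ suc q′) ℕ.+ (suc q′ ℕ.+ suc q′) → ⟦ b i ⟧₂ ≈ ⟦ b j ⟧₂)
      (b-middle : ⟦ b (suc q′ ℕ.+ suc q′) ⟧₂ ≈ 0#) where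

      private
        q h : ℕ
        q = suc q′
        h = q ℕ.+ q

        term : ℕ → Carrier
        term i = ⟦ b i ⟧₂ * x ^ i

        pair : ∀ i j → i ℕ.+ j ≡ h ℕ.+ h → term i + term j ≈ ⟦ b i ⟧₂ * D i
        pair i j eq = trans (+-congˡ (*-cong (sym (b-symmetric i j eq)) (^-complement xx̄≈1 xⁿ≈1 i j eq)))
          (sym (distribˡ _ _ _))

      even-part : Carrier
      even-part = ∑< q′ (λ l → ⟦ b (suc l ℕ.+ suc l) ⟧₂ * D (suc l ℕ.+ suc l))

      odd-part : Carrier
      odd-part = ∑< q (λ l → ⟦ b (suc (l ℕ.+ l)) ⟧₂ * D (suc (l ℕ.+ l)))

      fold-symmetric : ∑< (h ℕ.+ h) term ≈ ⟦ b 0 ⟧₂ + even-part + odd-part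
      fold-symmetric = trans (∑<-interleave h term)
        (+-cong evens (∑<-fold q (λ l → term (suc (l ℕ.+ l))) _ (λ i j eq → pair _ _ (odd-reflection i j q eq))))
        where
        evens : ∑< h (λ l → term (l ℕ.+ l)) ≈ ⟦ b 0 ⟧₂ + even-part
        evens = +-cong (*-identityʳ _) (begin
          ∑< (q′ ℕ.+ suc q′) even-term         ≡⟨ ≡.cong (λ m → ∑< m even-term) (ℕ.+-suc q′ q′) ⟩
          ∑< (suc (q′ ℕ.+ q′)) even-term       ≈⟨ ∑<-fold-odd q′ even-term _ (λ i j eq → pair _ _ (even-reflection i j q′ eq)) ⟩
          even-part + even-term q′             ≈⟨ +-congˡ (trans (*-congʳ b-middle) (zeroˡ _)) ⟩
          even-part + 0#               ≈⟨ +-identityʳ _ ⟩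
          even-part                    ∎)
          where
          even-term : ℕ → Carrier
          even-term l = term (suc l ℕ.+ suc l)

      Poly-symmetric : Poly w (∑< (h ℕ.+ h) term)
      Poly-symmetric = Poly-resp (sym fold-symmetric)
        (Poly-+ (Poly-+ (Poly-⟦⟧ (b 0)) (Poly-∑ q′ (λ l → Poly-⟦⟧* (b (suc l ℕ.+ suc l)) (D-poly (suc l ℕ.+ suc l)))))
                (Poly-∑ q (λ l → Poly-⟦⟧* (b (suc (l ℕ.+ l))) (D-poly (suc (l ℕ.+ l))))))

      -- Modulo w * w each even `D` vanishes and each odd `D` is `w`, so the coefficient of `w` is
      -- the sum of the bits at the odd exponents below n / 2.
      tangent-symmetric : ⟦ b 0 ⟧₂ ≈ 1# → ∑< q (λ l → ⟦ b (suc (l ℕ.+ l)) ⟧₂) ≈ 1# →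
        φ (∑< (h ℕ.+ h) term) ≈ 1# → Tangent (∑< (h ℕ.+ h) term)
      tangent-symmetric b₀≈1 odd-sum≈1 unip = record
        { Poly-tail = Poly-+ (Poly-∑ q′ (λ l → Poly-⟦⟧* (b (suc l ℕ.+ suc l)) (proj₁ (proj₂ (D-even (suc l))))))
                             (Poly-∑ q (λ l → Poly-⟦⟧* (b (suc (l ℕ.+ l))) (proj₁ (proj₂ (D-odd l)))))
        ; expansion = begin
            ∑< (h ℕ.+ h) term                        ≈⟨ fold-symmetric ⟩
            ⟦ b 0 ⟧₂ + even-part + odd-part          ≈⟨ +-cong (+-cong b₀≈1 evens) odds ⟩
            1# + w * w * E + (w + w * w * O)
              ≈⟨ solve 3 (λ w e o → con true :+ w :* w :* e :+ (w :+ w :* w :* o) := con true :+ w :+ w :* w :* (e :+ o)) refl w E O ⟩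
            1# + w + w * w * (E + O)                 ∎
        ; unipotent = unip
        }
        where
        E = ∑< q′ (λ l → ⟦ b (suc l ℕ.+ suc l) ⟧₂ * proj₁ (D-even (suc l)))
        O = ∑< q (λ l → ⟦ b (suc (l ℕ.+ l)) ⟧₂ * proj₁ (D-odd l))

        evens : even-part ≈ w * w * E
        evens = trans
          (∑<-cong q′ (λ l → trans (*-congˡ (proj₂ (proj₂ (D-even (suc l)))))
            (solve 3 (λ b v g → b :* (v :* g) := v :* (b :* g)) refl ⟦ b (suc l ℕ.+ suc l) ⟧₂ (w * w) (proj₁ (D-even (suc l))))))
          (sym (*-∑ q′ (w * w) _))

        odds : odd-part ≈ w + w * w * O
        odds = begin
          odd-part
            ≈⟨ ∑<-cong q (λ l → trans (*-congˡ (proj₂ (proj₂ (D-odd l))))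
                 (solve 3 (λ b w g → b :* (w :+ w :* w :* g) := w :* b :+ w :* w :* (b :* g)) refl ⟦ b (suc (l ℕ.+ l)) ⟧₂ w (proj₁ (D-odd l)))) ⟩
          ∑< q (λ l → w * ⟦ b (suc (l ℕ.+ l)) ⟧₂ + w * w * (⟦ b (suc (l ℕ.+ l)) ⟧₂ * proj₁ (D-odd l)))
            ≈⟨ ∑<-∙ q (λ l → w * ⟦ b (suc (l ℕ.+ l)) ⟧₂) (λ l → w * w * (⟦ b (suc (l ℕ.+ l)) ⟧₂ * proj₁ (D-odd l))) ⟩
          ∑< q (λ l → w * ⟦ b (suc (l ℕ.+ l)) ⟧₂) + ∑< q (λ l → w * w * (⟦ b (suc (l ℕ.+ l)) ⟧₂ * proj₁ (D-odd l)))
            ≈⟨ +-cong (*-∑ q w (λ l → ⟦ b (suc (l ℕ.+ l)) ⟧₂)) (*-∑ q (w * w) (λ l → ⟦ b (suc (l ℕ.+ l)) ⟧₂ * proj₁ (D-odd l))) ⟨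
          w * ∑< q (λ l → ⟦ b (suc (l ℕ.+ l)) ⟧₂) + w * w * O
            ≈⟨ +-congʳ (trans (*-congˡ odd-sum≈1) (*-identityʳ w)) ⟩
          w + w * w * O ∎

-- Fermat's little theorem in a finite field

module FieldProperties {q c ℓ} (F : FiniteField q c ℓ) where

  open FiniteField F
  open SemiringExp semiring using (_^_)
  open SetoidReasoning setoid
  private module E = Inverse enumeration

  from-injective : ∀ {i j} → E.from i ≈ E.from j → i ≡ j
  from-injective {i} {j} eq =
    ≡.trans (≡.sym (E.strictlyInverseˡ i)) (≡.trans (E.to-cong eq) (E.strictlyInverseˡ j))

  *-cancelˡ-0 : ∀ {x y} → x ≉ 0# → x * y ≈ 0# → y ≈ 0#
  *-cancelˡ-0 {x} {y} x≉0 xy≈0 with inverse x x≉0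
  ... | x⁻¹ , xx⁻¹≈1 = begin
    y              ≈⟨ *-identityˡ y ⟨
    1# * y         ≈⟨ *-congʳ xx⁻¹≈1 ⟨
    x * x⁻¹ * y    ≈⟨ *-congʳ (*-comm x x⁻¹) ⟩
    x⁻¹ * x * y    ≈⟨ *-assoc x⁻¹ x y ⟩
    x⁻¹ * (x * y)  ≈⟨ *-congˡ xy≈0 ⟩
    x⁻¹ * 0#       ≈⟨ zeroʳ x⁻¹ ⟩
    0#             ∎

  private
    open CommutativeMonoidSum *-commutativeMonoid renaming (sum to ∏)

    ∏≉0 : ∀ {k} (f : Fin k → Carrier) → (∀ i → f i ≉ 0#) → ∏ f ≉ 0#
    ∏≉0 {zero}  f f≉0 = 1≉0
    ∏≉0 {suc k} f f≉0 eq = ∏≉0 (f ∘ Fin.suc) (f≉0 ∘ Fin.suc) (*-cancelˡ-0 (f≉0 Fin.zero) eq)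

    -- Putting 1 at the zero element lets products over the nonzero elements run over all of
    -- `Fin q`.
    replaceZero : Carrier → Carrier → Carrier
    replaceZero a x = if does (x ≟ 0#) then 1# else a

    replaceZero≈ : ∀ {x} a → x ≉ 0# → replaceZero a x ≈ a
    replaceZero≈ {x} a x≉0 = reflexive (≡.cong (if_then 1# else a) (dec-false (x ≟ 0#) x≉0))

    replaceZero≈1 : ∀ {x} a → x ≈ 0# → replaceZero a x ≈ 1#
    replaceZero≈1 {x} a x≈0 = reflexive (≡.cong (if_then 1# else a) (dec-true (x ≟ 0#) x≈0))

    module _ (a : Carrier) (a≉0 : a ≉ 0#) where

      a⁻¹ = proj₁ (inverse a a≉0)
      aa⁻¹≈1 = proj₂ (inverse a a≉0)

      scaling : Permutation′ q
      scaling = permutation (λ i → E.to (a * E.from i)) (λ i → E.to (a⁻¹ * E.from i))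
        (λ i → inv i a⁻¹ a aa⁻¹≈1) (λ i → inv i a a⁻¹ (trans (*-comm _ _) aa⁻¹≈1))
        where
        inv : ∀ i b c → c * b ≈ 1# → E.to (c * E.from (E.to (b * E.from i))) ≡ i
        inv i b c cb≈1 = E.inverseˡ (begin
          c * E.from (E.to (b * E.from i)) ≈⟨ *-congˡ (E.strictlyInverseʳ _) ⟩
          c * (b * E.from i)               ≈⟨ *-assoc _ _ _ ⟨
          c * b * E.from i                 ≈⟨ *-congʳ cb≈1 ⟩
          1# * E.from i                    ≈⟨ *-identityˡ _ ⟩
          E.from i                         ∎)

      units : Fin q → Carrier
      units i = replaceZero (E.from i) (E.from i)

      units≉0 : ∀ i → units i ≉ 0#
      units≉0 i eq = by-cases (E.from i ≟ 0#)
        where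
        by-cases : ¬ Dec (E.from i ≈ 0#)
        by-cases (yes x≈0) = 1≉0 (trans (sym (replaceZero≈1 _ x≈0)) eq)
        by-cases (no x≉0)  = x≉0 (trans (sym (replaceZero≈ _ x≉0)) eq)

      units-scaling : ∀ i → units (E.to (a * E.from i)) ≈ replaceZero a (E.from i) * units i
      units-scaling i = by-cases (E.from i ≟ 0#)
        where
        x′ = E.from (E.to (a * E.from i))
        x′≈ : x′ ≈ a * E.from i
        x′≈ = E.strictlyInverseʳ _
        by-cases : Dec (E.from i ≈ 0#) → units (E.to (a * E.from i)) ≈ replaceZero a (E.from i) * units i
        by-cases (yes x≈0) = begin
          replaceZero x′ x′  ≈⟨ replaceZero≈1 x′ (trans x′≈ (trans (*-congˡ x≈0) (zeroʳ a))) ⟩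
          1#                 ≈⟨ *-identityˡ 1# ⟨
          1# * 1#            ≈⟨ *-cong (replaceZero≈1 a x≈0) (replaceZero≈1 _ x≈0) ⟨
          replaceZero a (E.from i) * units i ∎
        by-cases (no x≉0) = begin
          replaceZero x′ x′  ≈⟨ replaceZero≈ x′ (λ eq → x≉0 (*-cancelˡ-0 a≉0 (trans (sym x′≈) eq))) ⟩
          x′                 ≈⟨ x′≈ ⟩
          a * E.from i       ≈⟨ *-cong (replaceZero≈ a x≉0) (replaceZero≈ _ x≉0) ⟨
          replaceZero a (E.from i) * units i ∎

      -- Multiplication by `a` permutes the nonzero elements: their product takes in one factor `a`
      -- for each of them and yet is unchanged, and it can be cancelled.
      ∏-replaceZero≈1 : ∏ (replaceZero a ∘ E.from) ≈ 1#
      ∏-replaceZero≈1 with inverse (∏ units) (∏≉0 units units≉0)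
      ... | p⁻¹ , pp⁻¹≈1 = begin
        k                    ≈⟨ *-identityʳ k ⟨
        k * 1#               ≈⟨ *-congˡ pp⁻¹≈1 ⟨
        k * (∏ units * p⁻¹)  ≈⟨ *-assoc _ _ _ ⟨
        k * ∏ units * p⁻¹    ≈⟨ *-congʳ (∑-distrib-+ (replaceZero a ∘ E.from) units) ⟨
        ∏ (λ i → replaceZero a (E.from i) * units i) * p⁻¹
                             ≈⟨ *-congʳ (sum-cong-≋ {q} units-scaling) ⟨
        ∏ (λ i → units (E.to (a * E.from i))) * p⁻¹
                             ≈⟨ *-congʳ (sum-permute units scaling) ⟨
        ∏ units * p⁻¹        ≈⟨ pp⁻¹≈1 ⟩
        1#                   ∎
        where k = ∏ (replaceZero a ∘ E.from)

    -- The extra factor `a` fills the place of the one index at which `f` is 1, so the exponent is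
    -- `k` and not its predecessor.
    ∏-punctured : ∀ k (f : Fin k → Carrier) (z : Fin k) a →
      f z ≈ 1# → (∀ i → i ≡ z ⊎ f i ≈ a) → a * ∏ f ≈ a ^ k
    ∏-punctured (suc k) f z a fz≈1 f≈a = *-congˡ (begin
      ∏ f                              ≈⟨ sum-remove {k} {z} f ⟩
      f z * ∏ (λ j → f (punchIn z j))  ≈⟨ *-congʳ fz≈1 ⟩
      1# * ∏ (λ j → f (punchIn z j))   ≈⟨ *-identityˡ _ ⟩
      ∏ (λ j → f (punchIn z j))        ≈⟨ sum-cong-≋ {k} others ⟩
      ∏ {k} (λ _ → a)                  ≈⟨ sum-replicate k ⟩
      a ^ k                            ∎)
      where
      others : ∀ j → f (punchIn z j) ≈ a
      others j with f≈a (punchIn z j)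
      ... | inj₁ eq = contradiction eq (Fin.punchInᵢ≢i z j)
      ... | inj₂ eq = eq

  fermat : ∀ a → a ^ q ≈ a
  fermat a with a ≟ 0#
  ... | yes a≈0 = trans (0^ q (E.to a)) (sym a≈0)
    where
    -- The element of `Fin k` certifies that the exponent is positive.
    0^ : ∀ k → Fin k → a ^ k ≈ 0#
    0^ (suc k) _ = trans (*-congʳ a≈0) (zeroˡ _)
  ... | no a≉0 = begin
    a ^ q                                ≈⟨ ∏-punctured q _ (E.to 0#) a (replaceZero≈1 a (E.strictlyInverseʳ 0#)) cases ⟨
    a * ∏ (replaceZero a ∘ E.from)       ≈⟨ *-congˡ (∏-replaceZero≈1 a a≉0) ⟩
    a * 1#                               ≈⟨ *-identityʳ a ⟩
    a                                    ∎
    where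
    cases : ∀ i → i ≡ E.to 0# ⊎ replaceZero a (E.from i) ≈ a
    cases i = by-cases (E.from i ≟ 0#)
      where
      by-cases : Dec (E.from i ≈ 0#) → i ≡ E.to 0# ⊎ replaceZero a (E.from i) ≈ a
      by-cases (yes x≈0) = inj₁ (≡.sym (E.inverseˡ (sym x≈0)))
      by-cases (no  x≉0) = inj₂ (replaceZero≈ a x≉0)

-- Linear independence of the Frobenius powers and the absolute trace

module Frobenius {c ℓ} (n : ℕ) (F : FiniteField (2 ℕ.^ n) c ℓ) where

  open FiniteField F
  open FieldProperties F
  open Char2 commutativeRing (characteristic-2 n F)
  open RangeSum +-commutativeMonoid
  open SemiringExp semiring using (_^_; ^-homo-*)
  open SetoidReasoning setoid
  private module E = Inverse enumeration

  frob-n : ∀ v → frob n v ≈ v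
  frob-n v = trans (frob≈^ n v) (fermat v)

  -- f is a polynomial function of degree at most k with a as the coefficient of degree k.
  PolyFun : ℕ → Carrier → (Carrier → Carrier) → Set (c ⊔ ℓ)
  PolyFun zero    a f = ∀ x → f x ≈ a
  PolyFun (suc k) a f = ∃[ g ] ∃[ c₀ ] PolyFun k a g × (∀ x → f x ≈ x * g x + c₀)

  PolyFun-resp : ∀ k {a b f g} → a ≈ b → (∀ x → f x ≈ g x) → PolyFun k a f → PolyFun k b g
  PolyFun-resp zero    a≈b f≈g p = λ x → trans (sym (f≈g x)) (trans (p x) a≈b)
  PolyFun-resp (suc k) a≈b f≈g (h , c₀ , p , eq) =
    h , c₀ , PolyFun-resp k a≈b (λ _ → refl) p , (λ x → trans (sym (f≈g x)) (eq x))

  PolyFun-+ : ∀ k {a b f g} → PolyFun k a f → PolyFun k b g → PolyFun k (a + b) (λ x → f x + g x)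
  PolyFun-+ zero    p q = λ x → +-cong (p x) (q x)
  PolyFun-+ (suc k) (g , c₀ , p , eq) (h , d₀ , q , eq′) =
    (λ x → g x + h x) , c₀ + d₀ , PolyFun-+ k p q , λ x → trans (+-cong (eq x) (eq′ x))
      (solve 5 (λ x g h c d → (x :* g :+ c) :+ (x :* h :+ d) := x :* (g :+ h) :+ (c :+ d)) refl x (g x) (h x) c₀ d₀)

  PolyFun-* : ∀ k {a f} b → PolyFun k a f → PolyFun k (b * a) (λ x → b * f x)
  PolyFun-* zero    b p = λ x → *-congˡ (p x)
  PolyFun-* (suc k) b (g , c₀ , p , eq) =
    (λ x → b * g x) , b * c₀ , PolyFun-* k b p , λ x → trans (*-congˡ (eq x))
      (solve 4 (λ x g b c → b :* (x :* g :+ c) := x :* (b :* g) :+ b :* c) refl x (g x) b c₀)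

  PolyFun-suc : ∀ k {a f} → PolyFun k a f → PolyFun (suc k) 0# f
  PolyFun-suc zero {a} p = (λ _ → 0#) , a , (λ _ → refl) ,
    λ x → trans (p x) (sym (trans (+-congʳ (zeroʳ x)) (+-identityˡ a)))
  PolyFun-suc (suc k) (g , c₀ , p , eq) = g , c₀ , PolyFun-suc k p , eq

  PolyFun-≤ : ∀ {k m f} → k ℕ.≤′ m → PolyFun k 0# f → PolyFun m 0# f
  PolyFun-≤ ℕ.≤′-refl     p = p
  PolyFun-≤ (ℕ.≤′-step l) p = PolyFun-suc _ (PolyFun-≤ l p)

  PolyFun-^ : ∀ k → PolyFun k 1# (_^ k)
  PolyFun-^ zero    = λ _ → refl
  PolyFun-^ (suc k) = (_^ k) , 0# , PolyFun-^ k , λ x → sym (+-identityʳ _)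

  PolyFun-divide : ∀ k {a f} → PolyFun (suc k) a f → ∀ r →
    ∃[ g ] PolyFun k a g × (∀ x → f x + f r ≈ (x + r) * g x)
  PolyFun-divide zero {f = f} (g , c₀ , p , eq) r = g , p , λ x → begin
    f x + f r                      ≈⟨ +-cong (eq x) (eq r) ⟩
    x * g x + c₀ + (r * g r + c₀)  ≈⟨ +-congˡ (+-congʳ (*-congˡ (trans (p r) (sym (p x))))) ⟩
    x * g x + c₀ + (r * g x + c₀)
      ≈⟨ solve 4 (λ x g r c → x :* g :+ c :+ (r :* g :+ c) := (x :+ r) :* g) refl x (g x) r c₀ ⟩
    (x + r) * g x                  ∎
  PolyFun-divide (suc k) {f = f} (g , c₀ , p , eq) r with PolyFun-divide k p r
  ... | h , q , eq′ = (λ x → g x + r * h x) ,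
    PolyFun-resp (suc k) (+-identityʳ _) (λ _ → refl) (PolyFun-+ (suc k) p (PolyFun-suc k (PolyFun-* k r q))) ,
    λ x → begin
      f x + f r                            ≈⟨ +-cong (eq x) (eq r) ⟩
      x * g x + c₀ + (r * g r + c₀)
        ≈⟨ solve 5 (λ x g r c y → x :* g :+ c :+ (r :* y :+ c) := (x :+ r) :* g :+ r :* (g :+ y)) refl x (g x) r c₀ (g r) ⟩
      (x + r) * g x + r * (g x + g r)      ≈⟨ +-congˡ (*-congˡ (eq′ x)) ⟩
      (x + r) * g x + r * ((x + r) * h x)
        ≈⟨ solve 4 (λ x g r h → (x :+ r) :* g :+ r :* ((x :+ r) :* h) := (x :+ r) :* (g :+ r :* h)) refl x (g x) r (h x) ⟩
      (x + r) * (g x + r * h x)            ∎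

  -- Dividing by the linear factor of one root lowers the degree, keeps the leading coefficient and
  -- leaves the other points as roots.
  root-bound : ∀ k {a f} → PolyFun k a f → (pt : Fin (suc k) → Carrier) →
    (∀ {i j} → pt i ≈ pt j → i ≡ j) → (∀ i → f (pt i) ≈ 0#) → a ≈ 0#
  root-bound zero    p pt inj zeros = trans (sym (p (pt Fin.zero))) (zeros Fin.zero)
  root-bound (suc k) {f = f} p pt inj zeros with PolyFun-divide k p (pt Fin.zero)
  ... | g , q , eq = root-bound k q (pt ∘ Fin.suc) (Fin.suc-injective ∘ inj) λ i →
    *-cancelˡ-0 {pt (Fin.suc i) + pt Fin.zero} (λ e → Fin.0≢1+n (≡.sym (inj (+≈0⇒≈ e)))) (begin
      (pt (Fin.suc i) + pt Fin.zero) * g (pt (Fin.suc i))  ≈⟨ eq (pt (Fin.suc i)) ⟨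
      f (pt (Fin.suc i)) + f (pt Fin.zero)                 ≈⟨ +-cong (zeros (Fin.suc i)) (zeros Fin.zero) ⟩
      0# + 0#                                              ≈⟨ +-identityˡ 0# ⟩
      0#                                                   ∎)

  -- The terms before the last have degree at most 2 ^ (k - 1), below 2 ^ k, so they do not touch
  -- the leading coefficient.
  linearized : ∀ (a : ℕ → Carrier) k →
    PolyFun (2 ℕ.^ k) (a k) (λ v → ∑< (suc k) (λ i → a i * frob i v))
  linearized a k = PolyFun-resp (2 ℕ.^ k)
    (trans (+-identityˡ _) (*-identityʳ (a k)))
    (λ v → trans (+-congˡ (*-congˡ (sym (frob≈^ k v)))) (sym (∑<-last k (λ i → a i * frob i v))))
    (PolyFun-+ (2 ℕ.^ k) (lower k) (PolyFun-* (2 ℕ.^ k) (a k) (PolyFun-^ (2 ℕ.^ k))))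
    where
    lower : ∀ k → PolyFun (2 ℕ.^ k) 0# (λ v → ∑< k (λ i → a i * frob i v))
    lower zero    = PolyFun-suc 0 (λ _ → refl {0#})
    lower (suc k) = PolyFun-≤ (ℕ.≤⇒≤′ (ℕ.^-monoʳ-< 2 (ℕ.s≤s (ℕ.s≤s ℕ.z≤n)) (ℕ.n<1+n k)))
                              (PolyFun-suc (2 ℕ.^ k) (linearized a k))

  -- A combination with top index k < n has degree at most 2 ^ k but vanishes at all 2 ^ n elements,
  -- so its top coefficient is 0; then descend on k.
  frob-independent : ∀ (a : ℕ → Carrier) → (∀ v → ∑< n (λ i → a i * frob i v) ≈ 0#) →
    ∀ {i} → i ℕ.< n → a i ≈ 0#
  frob-independent a = go n ℕ.≤-refl
    where
    go : ∀ k → k ℕ.≤ n → (∀ v → ∑< k (λ i → a i * frob i v) ≈ 0#) → ∀ {i} → i ℕ.< k → a i ≈ 0#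
    go (suc k) k<n vanish {i} i≤k = by-cases (ℕ.m<1+n⇒m<n∨m≡n i≤k)
      where
      top : a k ≈ 0#
      top = root-bound (2 ℕ.^ k) (linearized a k)
        (λ i → E.from (Fin.inject≤ i (ℕ.^-monoʳ-< 2 (ℕ.s≤s (ℕ.s≤s ℕ.z≤n)) k<n)))
        (λ eq → Fin.inject≤-injective _ _ _ _ (from-injective eq))
        (λ i → vanish _)
      by-cases : i ℕ.< k ⊎ i ≡ k → a i ≈ 0#
      by-cases (inj₁ i<k) = go k (ℕ.<⇒≤ k<n) (λ v → begin
        ∑< k (λ i → a i * frob i v)                   ≈⟨ +-identityʳ _ ⟨
        ∑< k (λ i → a i * frob i v) + 0#              ≈⟨ +-congˡ (trans (*-congʳ top) (zeroˡ _)) ⟨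
        ∑< k (λ i → a i * frob i v) + a k * frob k v  ≈⟨ ∑<-last k (λ i → a i * frob i v) ⟨
        ∑< (suc k) (λ i → a i * frob i v)             ≈⟨ vanish v ⟩
        0#                                            ∎) i<k
      by-cases (inj₂ ≡.refl) = top

  tr : Carrier → Carrier
  tr v = ∑< n (λ i → frob i v)

  Tr≈tr : ∀ v → Tr n F v ≈ tr v
  Tr≈tr v = trans (sum≈∑< n (λ i → v ^ (2 ℕ.^ i))) (∑<-cong n (λ i → sym (frob≈^ i v)))

  tr-cong : ∀ {u v} → u ≈ v → tr u ≈ tr v
  tr-cong eq = ∑<-cong n (λ i → frob-cong i eq)

  tr-+ : ∀ u v → tr (u + v) ≈ tr u + tr v
  tr-+ u v = trans (∑<-cong n (λ i → frob-+ i u v)) (∑<-∙ n (λ i → frob i u) (λ i → frob i v))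

  tr-0 : tr 0# ≈ 0#
  tr-0 = ∑<-ε n frob-0

  frob-∘′ : ∀ i v → frob i (v * v) ≈ frob (suc i) v
  frob-∘′ i v = frob-* i v v

  tr-frob₁ : ∀ v → tr (v * v) ≈ tr v
  tr-frob₁ v = trans (∑<-cong n (λ i → frob-∘′ i v)) (∑<-rotate n (λ i → frob i v) (frob-n v))

  tr-frob : ∀ i v → tr (frob i v) ≈ tr v
  tr-frob zero    v = refl
  tr-frob (suc i) v = trans (tr-frob₁ (frob i v)) (tr-frob i v)

  tr² : ∀ v → tr v * tr v ≈ tr v
  tr² v = trans (frob-∑ 1 n (λ i → frob i v)) (∑<-rotate n (λ i → frob i v) (frob-n v))

  idempotent⇒0∨1 : ∀ {t} → t * t ≈ t → t ≈ 0# ⊎ t ≈ 1#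
  idempotent⇒0∨1 {t} eq with t ≟ 0#
  ... | yes t≈0 = inj₁ t≈0
  ... | no  t≉0 = inj₂ (+≈0⇒≈ (*-cancelˡ-0 t≉0 (begin
    t * (t + 1#)  ≈⟨ solve 1 (λ t → t :* (t :+ con true) := t :* t :+ t) refl t ⟩
    t * t + t     ≈⟨ ≈⇒+≈0 eq ⟩
    0#            ∎)))

  -- If all traces vanished, the sum of the Frobenius powers would be a forbidden linear relation.
  -- The finite enumeration makes the search for a witness effective.
  trace-one : 0 ℕ.< n → ∃[ θ ] tr θ ≈ 1#
  trace-one 0<n = E.from (proj₁ nonzero) , fromInj₂ (λ tr≈0 → contradiction tr≈0 (proj₂ nonzero)) (idempotent⇒0∨1 (tr² _))
    where
    not-all-zero : ¬ (∀ i → tr (E.from i) ≈ 0#)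
    not-all-zero tr≈0 = 1≉0 (frob-independent (λ _ → 1#) (λ v → begin
      ∑< n (λ i → 1# * frob i v)   ≈⟨ ∑<-cong n (λ i → *-identityˡ (frob i v)) ⟩
      tr v                         ≈⟨ tr-cong (E.strictlyInverseʳ v) ⟨
      tr (E.from (E.to v))         ≈⟨ tr≈0 (E.to v) ⟩
      0#                           ∎) 0<n)
    nonzero : ∃[ i ] tr (E.from i) ≉ 0#
    nonzero = Fin.¬∀⟶∃¬ (2 ℕ.^ n) (λ i → tr (E.from i) ≈ 0#) (λ i → tr (E.from i) ≟ 0#) not-all-zero

  trace-nondegenerate : 0 ℕ.< n → ∀ {δ} → (∀ η → tr (δ * η) ≈ 0#) → δ ≈ 0#
  trace-nondegenerate 0<n {δ} vanish = decidable-stable (δ ≟ 0#) λ δ≉0 →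
    let δ⁻¹ , δδ⁻¹≈1 = inverse δ δ≉0
        θ , trθ≈1 = trace-one 0<n
    in 1≉0 (begin
    1#                    ≈⟨ trθ≈1 ⟨
    tr θ                  ≈⟨ tr-cong (*-identityˡ θ) ⟨
    tr (1# * θ)           ≈⟨ tr-cong (*-congʳ δδ⁻¹≈1) ⟨
    tr (δ * δ⁻¹ * θ)      ≈⟨ tr-cong (*-assoc δ δ⁻¹ θ) ⟩
    tr (δ * (δ⁻¹ * θ))    ≈⟨ vanish _ ⟩
    0#                    ∎)

-- The ring 𝔽₂[σ] of linear operators generated by the Frobenius automorphism σ:
-- a list of exponents stands for the sum of the corresponding powers of σ, and two
-- lists are identified when they act in the same way.
module FrobeniusOperators {c ℓ} (n : ℕ) (F : FiniteField (2 ℕ.^ n) c ℓ) where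

  open FiniteField F
  open Frobenius n F
  open Char2 commutativeRing (characteristic-2 n F)
  open SetoidReasoning setoid
  open import Algebra.Properties.CommutativeSemigroup
    (CommutativeMonoid.commutativeSemigroup +-commutativeMonoid) using (interchange)

  act : List ℕ → Carrier → Carrier
  act []      v = 0#
  act (i ∷ a) v = frob i v + act a v

  record _≋_ (a b : List ℕ) : Set (c ⊔ ℓ) where
    constructor ext
    field
      app : ∀ v → act a v ≈ act b v

  open _≋_ public

  _⊛_ : List ℕ → List ℕ → List ℕ
  []      ⊛ b = []
  (i ∷ a) ⊛ b = map (i ℕ.+_) b ++ a ⊛ b

  act-cong : ∀ a {u v} → u ≈ v → act a u ≈ act a v
  act-cong []      eq = refl
  act-cong (i ∷ a) eq = +-cong (frob-cong i eq) (act-cong a eq)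

  act-+ : ∀ a u v → act a (u + v) ≈ act a u + act a v
  act-+ []      u v = sym (+-identityˡ 0#)
  act-+ (i ∷ a) u v = trans (+-cong (frob-+ i u v) (act-+ a u v)) (interchange _ _ _ _)

  act-0 : ∀ a → act a 0# ≈ 0#
  act-0 []      = refl
  act-0 (i ∷ a) = trans (+-cong (frob-0 i) (act-0 a)) (+-identityˡ 0#)

  act-++ : ∀ a b v → act (a ++ b) v ≈ act a v + act b v
  act-++ []      b v = sym (+-identityˡ _)
  act-++ (i ∷ a) b v = trans (+-congˡ (act-++ a b v)) (sym (+-assoc _ _ _))

  act-shift : ∀ i b v → act (map (i ℕ.+_) b) v ≈ frob i (act b v)
  act-shift i []      v = sym (frob-0 i)
  act-shift i (j ∷ b) v = begin
    frob (i ℕ.+ j) v + act (map (i ℕ.+_) b) v  ≈⟨ +-cong (reflexive (frob-∘ i j v)) (act-shift i b v) ⟩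
    frob i (frob j v) + frob i (act b v)       ≈⟨ frob-+ i _ _ ⟨
    frob i (frob j v + act b v)                ∎

  act-⊛ : ∀ a b v → act (a ⊛ b) v ≈ act a (act b v)
  act-⊛ []      b v = refl
  act-⊛ (i ∷ a) b v = trans (act-++ (map (i ℕ.+_) b) (a ⊛ b) v) (+-cong (act-shift i b v) (act-⊛ a b v))

  act-frob : ∀ a i v → act a (frob i v) ≈ frob i (act a v)
  act-frob []      i v = sym (frob-0 i)
  act-frob (j ∷ a) i v = begin
    frob j (frob i v) + act a (frob i v)
      ≈⟨ +-cong (reflexive (≡.trans (≡.sym (frob-∘ j i v)) (≡.trans (≡.cong (λ k → frob k v) (ℕ.+-comm j i)) (frob-∘ i j v))))
                (act-frob a i v) ⟩
    frob i (frob j v) + frob i (act a v)  ≈⟨ frob-+ i _ _ ⟨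
    frob i (frob j v + act a v)           ∎

  act-comm : ∀ a b v → act a (act b v) ≈ act b (act a v)
  act-comm []      b v = sym (act-0 b)
  act-comm (i ∷ a) b v = begin
    frob i (act b v) + act a (act b v)    ≈⟨ +-cong (sym (act-frob b i v)) (act-comm a b v) ⟩
    act b (frob i v) + act b (act a v)    ≈⟨ act-+ b _ _ ⟨
    act b (frob i v + act a v)            ∎

  operators-characteristic-2 : ∀ a → (a ++ a) ≋ []
  operators-characteristic-2 a = ext λ v → trans (act-++ a a v) (characteristic-2 n F _)

  operators : CommutativeRing _ _
  operators = record
    { Carrier = List ℕ
    ; _≈_ = _≋_
    ; _+_ = _++_
    ; _*_ = _⊛_
    ; -_ = λ a → a
    ; 0# = []
    ; 1# = 0 ∷ []
    ; isCommutativeRing = record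
      { isRing = record
        { +-isAbelianGroup = record
          { isGroup = record
            { isMonoid = record
              { isSemigroup = record
                { isMagma = record
                  { isEquivalence = record
                    { refl = ext λ v → refl
                    ; sym = λ p → ext λ v → sym (app p v)
                    ; trans = λ p q → ext λ v → trans (app p v) (app q v)
                    }
                  ; ∙-cong = λ {a} {b} {d} {e} p q → ext λ v →
                      trans (act-++ a d v) (trans (+-cong (app p v) (app q v)) (sym (act-++ b e v)))
                  }
                ; assoc = λ a b d → ext λ v → begin
                    act ((a ++ b) ++ d) v          ≈⟨ trans (act-++ (a ++ b) d v) (+-congʳ (act-++ a b v)) ⟩
                    act a v + act b v + act d v    ≈⟨ +-assoc _ _ _ ⟩
                    act a v + (act b v + act d v)  ≈⟨ trans (act-++ a (b ++ d) v) (+-congˡ (act-++ b d v)) ⟨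
                    act (a ++ (b ++ d)) v          ∎
                }
              ; identity = (λ a → ext λ v → refl) ,
                           (λ a → ext λ v → trans (act-++ a [] v) (+-identityʳ _))
              }
            ; inverse = operators-characteristic-2 , operators-characteristic-2
            ; ⁻¹-cong = λ p → p
            }
          ; comm = λ a b → ext λ v →
              trans (act-++ a b v) (trans (+-comm _ _) (sym (act-++ b a v)))
          }
        ; *-cong = λ {a} {b} {d} {e} p q → ext λ v → begin
            act (a ⊛ d) v      ≈⟨ act-⊛ a d v ⟩
            act a (act d v)    ≈⟨ act-cong a (app q v) ⟩
            act a (act e v)    ≈⟨ app p _ ⟩
            act b (act e v)    ≈⟨ act-⊛ b e v ⟨
            act (b ⊛ e) v      ∎
        ; *-assoc = λ a b d → ext λ v → begin
            act ((a ⊛ b) ⊛ d) v      ≈⟨ trans (act-⊛ (a ⊛ b) d v) (act-⊛ a b _) ⟩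
            act a (act b (act d v))  ≈⟨ trans (act-⊛ a (b ⊛ d) v) (act-cong a (act-⊛ b d v)) ⟨
            act (a ⊛ (b ⊛ d)) v      ∎
        ; *-identity = (λ a → ext λ v → trans (act-⊛ (0 ∷ []) a v) (+-identityʳ _)) ,
                       (λ a → ext λ v → trans (act-⊛ a (0 ∷ []) v) (act-cong a (+-identityʳ v)))
        ; distrib = (λ a b d → ext λ v → begin
                      act (a ⊛ (b ++ d)) v               ≈⟨ trans (act-⊛ a (b ++ d) v) (act-cong a (act-++ b d v)) ⟩
                      act a (act b v + act d v)          ≈⟨ act-+ a _ _ ⟩
                      act a (act b v) + act a (act d v)  ≈⟨ +-cong (act-⊛ a b v) (act-⊛ a d v) ⟨
                      act (a ⊛ b) v + act (a ⊛ d) v      ≈⟨ act-++ (a ⊛ b) (a ⊛ d) v ⟨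
                      act ((a ⊛ b) ++ (a ⊛ d)) v         ∎) ,
                    (λ a b d → ext λ v → begin
                      act ((b ++ d) ⊛ a) v               ≈⟨ trans (act-⊛ (b ++ d) a v) (act-++ b d _) ⟩
                      act b (act a v) + act d (act a v)  ≈⟨ +-cong (act-⊛ b a v) (act-⊛ d a v) ⟨
                      act (b ⊛ a) v + act (d ⊛ a) v      ≈⟨ act-++ (b ⊛ a) (d ⊛ a) v ⟨
                      act ((b ⊛ a) ++ (d ⊛ a)) v         ∎)
        }
      ; *-comm = λ a b → ext λ v → begin
          act (a ⊛ b) v    ≈⟨ act-⊛ a b v ⟩
          act a (act b v)  ≈⟨ act-comm a b v ⟩
          act b (act a v)  ≈⟨ act-⊛ b a v ⟨
          act (b ⊛ a) v    ∎
      }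
    }

-- The correlation form with values in the operator ring

module CorrelationForm {c ℓ} (n : ℕ) (0<n : 0 ℕ.< n) (F : FiniteField (2 ℕ.^ n) c ℓ) where

  open FiniteField F
  open Frobenius n F
  open Char2 commutativeRing (characteristic-2 n F)
  open RangeSum +-commutativeMonoid
  open FrobeniusOperators n F
  module A where
    open CommutativeRing operators public
    open Char2 operators operators-characteristic-2 public
    open RangeSum (CommutativeRing.+-commutativeMonoid operators) public
    open SemiringExp (CommutativeRing.semiring operators) public using (_^_; ^-homo-*)

  x x̄ : A.Carrier
  x = 1 ∷ []
  x̄ = x A.^ ℕ.pred n

  act-x : ∀ v → act x v ≈ v * v
  act-x v = +-identityʳ _

  act-1 : ∀ v → act A.1# v ≈ v
  act-1 v = +-identityʳ v

  act-^ : ∀ i v → act (x A.^ i) v ≈ frob i v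
  act-^ zero    v = act-1 v
  act-^ (suc i) v = begin
    act (x A.* x A.^ i) v          ≈⟨ act-⊛ x (x A.^ i) v ⟩
    act x (act (x A.^ i) v)        ≈⟨ act-cong x (act-^ i v) ⟩
    act x (frob i v)               ≈⟨ act-x _ ⟩
    frob (suc i) v                 ∎
    where open SetoidReasoning setoid

  x^n≋1 : x A.^ n A.≈ A.1#
  x^n≋1 = ext λ v → trans (act-^ n v) (trans (frob-n v) (sym (act-1 v)))

  xx̄≋1 : x A.* x̄ A.≈ A.1#
  xx̄≋1 = ≡.subst (λ m → x A.^ m A.≈ A.1#) (≡.sym (ℕ.suc-pred n {{ℕ.>-nonZero 0<n}})) x^n≋1

  x-generates : ∀ a → A.Poly x a
  x-generates []      = A.Poly-0
  x-generates (i ∷ a) = A.Poly-resp {x} {x A.^ i A.+ a} {i ∷ a}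
    (ext λ v → trans (act-++ (x A.^ i) a v) (+-congʳ (act-^ i v)))
    (A.Poly-+ {x} {x A.^ i} {a} (power i) (x-generates a))
    where
    power : ∀ i → A.Poly x (x A.^ i)
    power zero    = A.Poly-1
    power (suc i) = A.Poly-v* {x} {x A.^ i} (power i)

  act-∑ : ∀ m (f : ℕ → A.Carrier) v → act (A.∑< m f) v ≈ ∑< m (λ i → act (f i) v)
  act-∑ zero    f v = refl
  act-∑ (suc m) f v = trans (act-++ (f 0) _ v) (+-congˡ (act-∑ m (f ∘ suc) v))

  -- Carries a trace, which is 0 or 1 in the big field, over to a scalar of the operator ring.
  bit : Carrier → A.Carrier
  bit t = A.⟦ not (does (t ≟ 0#)) ⟧₂

  act-bit : ∀ {t} → t * t ≈ t → ∀ a v → act (bit t A.* a) v ≈ t * act a v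
  act-bit {t} t²≈t a v = by-cases (t ≟ 0#) (idempotent⇒0∨1 t²≈t)
    where
    by-cases : (t? : Dec (t ≈ 0#)) → t ≈ 0# ⊎ t ≈ 1# → act (A.⟦ not (does t?) ⟧₂ A.* a) v ≈ t * act a v
    by-cases (yes t≈0) _          = sym (trans (*-congʳ t≈0) (zeroˡ _))
    by-cases (no t≉0)  (inj₁ t≈0) = contradiction t≈0 t≉0
    by-cases (no _)    (inj₂ t≈1) = trans (app (A.*-identityˡ a) v) (sym (trans (*-congʳ t≈1) (*-identityˡ _)))

  bit-cong : ∀ {t u} → t * t ≈ t → t ≈ u → bit t A.≈ bit u
  bit-cong {t} {u} t²≈t t≈u = ext λ v → begin
    act (bit t) v             ≈⟨ app (A.*-identityʳ (bit t)) v ⟨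
    act (bit t A.* A.1#) v    ≈⟨ act-bit t²≈t A.1# v ⟩
    t * act A.1# v            ≈⟨ *-congʳ t≈u ⟩
    u * act A.1# v            ≈⟨ act-bit (trans (*-cong (sym t≈u) (sym t≈u)) (trans t²≈t t≈u)) A.1# v ⟨
    act (bit u A.* A.1#) v    ≈⟨ app (A.*-identityʳ (bit u)) v ⟩
    act (bit u) v             ∎
    where open SetoidReasoning setoid

  C : Carrier → Carrier → A.Carrier
  C δ η = A.∑< n (λ i → bit (tr (δ * frob i η)) A.* x A.^ i)

  act-C : ∀ δ η v → act (C δ η) v ≈ ∑< n (λ i → tr (δ * frob i η) * frob i v)
  act-C δ η v = trans (act-∑ n (λ i → bit (tr (δ * frob i η)) A.* x A.^ i) v)
    (∑<-cong n (λ i → trans (act-bit (tr² _) (x A.^ i) v) (*-congˡ (act-^ i v))))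

  C-cong : ∀ {δ δ′ η η′} → δ ≈ δ′ → η ≈ η′ → C δ η A.≈ C δ′ η′
  C-cong {δ} {δ′} {η} {η′} p q = ext λ v → begin
    act (C δ η) v                                    ≈⟨ act-C δ η v ⟩
    ∑< n (λ i → tr (δ * frob i η) * frob i v)        ≈⟨ ∑<-cong n (λ i → *-congʳ (tr-cong (*-cong p (frob-cong i q)))) ⟩
    ∑< n (λ i → tr (δ′ * frob i η′) * frob i v)      ≈⟨ act-C δ′ η′ v ⟨
    act (C δ′ η′) v                                  ∎
    where open SetoidReasoning setoid

  C-+ˡ : ∀ δ δ′ η → C (δ + δ′) η A.≈ C δ η A.+ C δ′ η
  C-+ˡ δ δ′ η = ext λ v → begin
    act (C (δ + δ′) η) v
      ≈⟨ act-C (δ + δ′) η v ⟩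
    ∑< n (λ i → tr ((δ + δ′) * frob i η) * frob i v)
      ≈⟨ ∑<-cong n (λ i → trans (*-congʳ (trans (tr-cong (distribʳ _ δ δ′)) (tr-+ _ _))) (distribʳ _ _ _)) ⟩
    ∑< n (λ i → tr (δ * frob i η) * frob i v + tr (δ′ * frob i η) * frob i v)
      ≈⟨ ∑<-∙ n (λ i → tr (δ * frob i η) * frob i v) (λ i → tr (δ′ * frob i η) * frob i v) ⟩
    ∑< n (λ i → tr (δ * frob i η) * frob i v) + ∑< n (λ i → tr (δ′ * frob i η) * frob i v)
      ≈⟨ +-cong (act-C δ η v) (act-C δ′ η v) ⟨
    act (C δ η) v + act (C δ′ η) v
      ≈⟨ act-++ (C δ η) (C δ′ η) v ⟨
    act (C δ η A.+ C δ′ η) v ∎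
    where open SetoidReasoning setoid

  C-+ʳ : ∀ δ η η′ → C δ (η + η′) A.≈ C δ η A.+ C δ η′
  C-+ʳ δ η η′ = ext λ v → begin
    act (C δ (η + η′)) v
      ≈⟨ act-C δ (η + η′) v ⟩
    ∑< n (λ i → tr (δ * frob i (η + η′)) * frob i v)
      ≈⟨ ∑<-cong n (λ i → trans (*-congʳ (trans (tr-cong (trans (*-congˡ (frob-+ i η η′)) (distribˡ δ _ _))) (tr-+ _ _))) (distribʳ _ _ _)) ⟩
    ∑< n (λ i → tr (δ * frob i η) * frob i v + tr (δ * frob i η′) * frob i v)
      ≈⟨ ∑<-∙ n (λ i → tr (δ * frob i η) * frob i v) (λ i → tr (δ * frob i η′) * frob i v) ⟩
    ∑< n (λ i → tr (δ * frob i η) * frob i v) + ∑< n (λ i → tr (δ * frob i η′) * frob i v)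
      ≈⟨ +-cong (act-C δ η v) (act-C δ η′ v) ⟨
    act (C δ η) v + act (C δ η′) v
      ≈⟨ act-++ (C δ η) (C δ η′) v ⟨
    act (C δ η A.+ C δ η′) v ∎
    where open SetoidReasoning setoid

  private
    shifted : Carrier → Carrier → Carrier → Carrier
    shifted δ η v = ∑< n (λ i → tr (δ * frob i η) * frob (suc i) v)

    x*C : ∀ δ η v → act (x A.* C δ η) v ≈ shifted δ η v
    x*C δ η v = begin
      act (x A.* C δ η) v        ≈⟨ trans (act-⊛ x (C δ η) v) (act-x _) ⟩
      frob 1 (act (C δ η) v)     ≈⟨ frob-cong 1 (act-C δ η v) ⟩
      frob 1 (∑< n (λ i → tr (δ * frob i η) * frob i v))
        ≈⟨ frob-∑ 1 n (λ i → tr (δ * frob i η) * frob i v) ⟩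
      ∑< n (λ i → frob 1 (tr (δ * frob i η) * frob i v))
        ≈⟨ ∑<-cong n (λ i → trans (frob-* 1 _ _) (*-congʳ (tr² _))) ⟩
      shifted δ η v              ∎
      where open SetoidReasoning setoid

    rotate : ∀ δ η v → ∑< n (λ i → tr (δ * frob (suc i) η) * frob (suc i) v) ≈ act (C δ η) v
    rotate δ η v = trans
      (∑<-rotate n (λ i → tr (δ * frob i η) * frob i v) (*-cong (tr-cong (*-congˡ (frob-n η))) (frob-n v)))
      (sym (act-C δ η v))

  -- The trace is invariant under σ, so applying σ to `δ` moves the correlations by one index; the
  -- shift is cyclic because σⁿ is the identity.
  C-σˡ : ∀ δ η → C (δ * δ) η A.≈ x A.* C δ η
  C-σˡ δ η = ext λ v → begin
    act (C (δ * δ) η) v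
      ≈⟨ rotate (δ * δ) η v ⟨
    ∑< n (λ i → tr (δ * δ * frob (suc i) η) * frob (suc i) v)
      ≈⟨ ∑<-cong n (λ i → *-congʳ (trans (tr-cong (sym (frob-* 1 δ (frob i η)))) (tr-frob₁ _))) ⟩
    shifted δ η v
      ≈⟨ x*C δ η v ⟨
    act (x A.* C δ η) v ∎
    where open SetoidReasoning setoid

  C-σʳ : ∀ δ η → x A.* C δ (η * η) A.≈ C δ η
  C-σʳ δ η = ext λ v → begin
    act (x A.* C δ (η * η)) v
      ≈⟨ x*C δ (η * η) v ⟩
    shifted δ (η * η) v
      ≈⟨ ∑<-cong n (λ i → *-congʳ (tr-cong (*-congˡ (frob-∘′ i η)))) ⟩
    ∑< n (λ i → tr (δ * frob (suc i) η) * frob (suc i) v)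
      ≈⟨ rotate δ η v ⟩
    act (C δ η) v ∎
    where open SetoidReasoning setoid

  C-0ˡ : ∀ η → C 0# η A.≈ A.0#
  C-0ˡ η = A.trans (C-cong (sym (zeroˡ 0#)) refl) (A.trans (C-σˡ 0# η) (ext λ v → vanish v))
    where
    vanish : ∀ v → act (x A.* C 0# η) v ≈ 0#
    vanish v = trans (x*C 0# η v) (∑<-ε n (λ i → trans (*-congʳ (trans (tr-cong (zeroˡ _)) tr-0)) (zeroˡ _)))

  C-0ʳ : ∀ δ → C δ 0# A.≈ A.0#
  C-0ʳ δ = ext λ v → trans (act-C δ 0# v)
    (∑<-ε n (λ i → trans (*-congʳ (trans (tr-cong (trans (*-congˡ (frob-0 i)) (zeroʳ δ))) tr-0)) (zeroˡ _)))

  C-actˡ : ∀ a δ η → C (act a δ) η A.≈ a A.* C δ η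
  C-actˡ []      δ η = C-0ˡ η
  C-actˡ (i ∷ a) δ η = A.trans (C-+ˡ (frob i δ) (act a δ) η) (A.trans
    (A.+-cong (C-frob i) (C-actˡ a δ η)) (A.trans
    (A.sym (A.distribʳ (C δ η) (x A.^ i) a))
    (A.*-congʳ {C δ η} {x A.^ i A.+ a} {i ∷ a} (ext λ v → trans (act-++ (x A.^ i) a v) (+-congʳ (act-^ i v))))))
    where
    C-frob : ∀ i → C (frob i δ) η A.≈ x A.^ i A.* C δ η
    C-frob zero    = A.sym (A.*-identityˡ (C δ η))
    C-frob (suc i) = A.trans (C-σˡ (frob i δ) η)
      (A.trans (A.*-congˡ {x} (C-frob i)) (A.sym (A.*-assoc x (x A.^ i) (C δ η))))

  C-xʳ : ∀ δ η → C δ (act x η) A.≈ x̄ A.* C δ η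
  C-xʳ δ η = begin
    C δ (act x η)                        ≈⟨ C-cong refl (act-x η) ⟩
    C δ (η * η)                          ≈⟨ A.*-identityˡ _ ⟨
    A.1# A.* C δ (η * η)                 ≈⟨ A.*-congʳ (A.trans (A.*-comm x̄ x) xx̄≋1) ⟨
    x̄ A.* x A.* C δ (η * η)              ≈⟨ A.*-assoc x̄ x _ ⟩
    x̄ A.* (x A.* C δ (η * η))            ≈⟨ A.*-congˡ {x̄} (C-σʳ δ η) ⟩
    x̄ A.* C δ η                          ∎
    where open SetoidReasoning A.setoid

  C-x̄ʳ : ∀ δ η → C δ (act x̄ η) A.≈ x A.* C δ η
  C-x̄ʳ δ η = begin
    C δ (act x̄ η)                        ≈⟨ A.*-identityˡ _ ⟨
    A.1# A.* C δ (act x̄ η)               ≈⟨ A.*-congʳ xx̄≋1 ⟨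
    x A.* x̄ A.* C δ (act x̄ η)            ≈⟨ A.*-assoc x x̄ _ ⟩
    x A.* (x̄ A.* C δ (act x̄ η))          ≈⟨ A.*-congˡ {x} (C-xʳ δ (act x̄ η)) ⟨
    x A.* C δ (act x (act x̄ η))          ≈⟨ A.*-congˡ {x} (C-cong refl (trans (sym (act-⊛ x x̄ η)) (trans (app xx̄≋1 η) (act-1 η)))) ⟩
    x A.* C δ η                          ∎
    where open SetoidReasoning A.setoid

  w : A.Carrier
  w = x A.+ x̄

  C-wʳ : ∀ δ η → C δ (act w η) A.≈ w A.* C δ η
  C-wʳ δ η = begin
    C δ (act w η)                           ≈⟨ C-cong refl (act-++ x x̄ η) ⟩
    C δ (act x η + act x̄ η)                 ≈⟨ C-+ʳ δ _ _ ⟩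
    C δ (act x η) A.+ C δ (act x̄ η)         ≈⟨ A.+-cong (C-xʳ δ η) (C-x̄ʳ δ η) ⟩
    x̄ A.* C δ η A.+ x A.* C δ η             ≈⟨ A.+-comm (x̄ A.* C δ η) (x A.* C δ η) ⟩
    x A.* C δ η A.+ x̄ A.* C δ η             ≈⟨ A.distribʳ (C δ η) x x̄ ⟨
    w A.* C δ η                             ∎
    where open SetoidReasoning A.setoid

  C-polyʳ : ∀ {h} → A.Poly w h → ∀ δ η → C δ (act h η) A.≈ h A.* C δ η
  C-polyʳ {h} (A.null eq) δ η = begin
    C δ (act h η)    ≈⟨ C-cong refl (app eq η) ⟩
    C δ 0#           ≈⟨ C-0ʳ δ ⟩
    A.0#             ≈⟨ A.zeroˡ (C δ η) ⟨
    A.0# A.* C δ η   ≈⟨ A.*-congʳ eq ⟨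
    h A.* C δ η      ∎
    where open SetoidReasoning A.setoid
  C-polyʳ {h} (A.horner {g = g} b p eq) δ η = begin
    C δ (act h η)
      ≈⟨ C-cong refl (trans (app eq η) (trans (act-++ A.⟦ b ⟧₂ (w A.* g) η) (+-congˡ (act-⊛ w g η)))) ⟩
    C δ (act A.⟦ b ⟧₂ η + act w (act g η))
      ≈⟨ C-+ʳ δ _ _ ⟩
    C δ (act A.⟦ b ⟧₂ η) A.+ C δ (act w (act g η))
      ≈⟨ A.+-cong (scalar b) (A.trans (C-wʳ δ (act g η)) (A.*-congˡ {w} (C-polyʳ p δ η))) ⟩
    A.⟦ b ⟧₂ A.* C δ η A.+ w A.* (g A.* C δ η)
      ≈⟨ A.+-congˡ {A.⟦ b ⟧₂ A.* C δ η} (A.*-assoc w g (C δ η)) ⟨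
    A.⟦ b ⟧₂ A.* C δ η A.+ w A.* g A.* C δ η
      ≈⟨ A.distribʳ (C δ η) A.⟦ b ⟧₂ (w A.* g) ⟨
    (A.⟦ b ⟧₂ A.+ w A.* g) A.* C δ η
      ≈⟨ A.*-congʳ eq ⟨
    h A.* C δ η ∎
    where
    open SetoidReasoning A.setoid
    scalar : ∀ b → C δ (act A.⟦ b ⟧₂ η) A.≈ A.⟦ b ⟧₂ A.* C δ η
    scalar false = C-0ʳ δ
    scalar true  = A.trans (C-cong refl (act-1 η)) (A.sym (A.*-identityˡ (C δ η)))

  -- In the second argument `x` turns into `x̄`, while `g` and `d` lie in 𝔽₂[w] and come out
  -- unchanged.
  C-norm : ∀ {g d} → A.Poly w g → A.Poly w d → ∀ θ →
    let α = act ((A.1# A.+ x A.* g) A.* d) θ in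
    C α α A.≈ (A.1# A.+ x A.* g) A.* (A.1# A.+ x̄ A.* g) A.* (d A.* d) A.* C θ θ
  C-norm {g} {d} Pg Pd θ = begin
    C α α
      ≈⟨ C-actˡ ((A.1# A.+ x A.* g) A.* d) θ α ⟩
    (A.1# A.+ x A.* g) A.* d A.* C θ α
      ≈⟨ A.*-congˡ {(A.1# A.+ x A.* g) A.* d} Cθα ⟩
    (A.1# A.+ x A.* g) A.* d A.* (d A.* C θ θ A.+ x̄ A.* (g A.* (d A.* C θ θ)))
      ≈⟨ A.solve 5 (λ x y g d c → (A.con true A.:+ x A.:* g) A.:* d A.:* (d A.:* c A.:+ y A.:* (g A.:* (d A.:* c)))
           A.:= (A.con true A.:+ x A.:* g) A.:* (A.con true A.:+ y A.:* g) A.:* (d A.:* d) A.:* c) A.refl x x̄ g d (C θ θ) ⟩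
    (A.1# A.+ x A.* g) A.* (A.1# A.+ x̄ A.* g) A.* (d A.* d) A.* C θ θ ∎
    where
    open SetoidReasoning A.setoid
    u α : Carrier
    u = act d θ
    α = act ((A.1# A.+ x A.* g) A.* d) θ
    α≈ : α ≈ u + act x (act g u)
    α≈ = trans (act-⊛ (A.1# A.+ x A.* g) d θ) (trans (act-++ A.1# (x A.* g) u) (+-cong (act-1 u) (act-⊛ x g u)))
    Cθu : C θ u A.≈ d A.* C θ θ
    Cθu = C-polyʳ Pd θ θ
    Cθα : C θ α A.≈ d A.* C θ θ A.+ x̄ A.* (g A.* (d A.* C θ θ))
    Cθα = begin
      C θ α                                            ≈⟨ C-cong refl α≈ ⟩
      C θ (u + act x (act g u))                        ≈⟨ C-+ʳ θ u _ ⟩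
      C θ u A.+ C θ (act x (act g u))                  ≈⟨ A.+-congˡ {C θ u} (C-xʳ θ (act g u)) ⟩
      C θ u A.+ x̄ A.* C θ (act g u)
        ≈⟨ A.+-congˡ {C θ u} (A.*-congˡ {x̄} (C-polyʳ Pg θ u)) ⟩
      C θ u A.+ x̄ A.* (g A.* C θ u)
        ≈⟨ A.+-cong Cθu (A.*-congˡ {x̄} (A.*-congˡ {g} Cθu)) ⟩
      d A.* C θ θ A.+ x̄ A.* (g A.* (d A.* C θ θ))      ∎

  -- Lists are compared only through their action, but by `frob-independent` this action still
  -- determines the coefficients at exponents below n.
  C-coefficient : ∀ {δ η} (a : ℕ → Carrier) → (∀ v → act (C δ η) v ≈ ∑< n (λ i → a i * frob i v)) →
    ∀ {i} → i ℕ.< n → tr (δ * frob i η) ≈ a i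
  C-coefficient {δ} {η} a eq i<n = +≈0⇒≈ (frob-independent (λ i → tr (δ * frob i η) + a i) (λ v → begin
    ∑< n (λ i → (tr (δ * frob i η) + a i) * frob i v)
      ≈⟨ ∑<-cong n (λ i → distribʳ _ _ _) ⟩
    ∑< n (λ i → tr (δ * frob i η) * frob i v + a i * frob i v)
      ≈⟨ ∑<-∙ n (λ i → tr (δ * frob i η) * frob i v) (λ i → a i * frob i v) ⟩
    ∑< n (λ i → tr (δ * frob i η) * frob i v) + ∑< n (λ i → a i * frob i v)
      ≈⟨ ≈⇒+≈0 (trans (sym (act-C δ η v)) (eq v)) ⟩
    0# ∎) i<n)
    where open SetoidReasoning setoid

  C-nondegenerate : ∀ {δ} → (∀ η → C δ η A.≈ A.0#) → δ ≈ 0#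
  C-nondegenerate {δ} vanish = trace-nondegenerate 0<n λ η →
    C-coefficient {δ} {η} (λ _ → 0#)
      (λ v → trans (app (vanish η) v) (sym (∑<-ε n (λ i → zeroˡ _)))) 0<n

  -- a C(δ, η) = C(a δ, η), so nondegeneracy gives a δ = 0 for every δ, which is equality with the
  -- zero operator.
  C-faithful : ∀ {a} → (∀ δ η → a A.* C δ η A.≈ A.0#) → a A.≈ A.0#
  C-faithful {a} vanish = ext λ δ → C-nondegenerate λ η → A.trans (C-actˡ a δ η) (vanish δ η)

  -- Every power of σ fixes 1, so evaluation at 1 is the augmentation of A. The sum of all
  -- correlations is tr(δ tr(δ)), and tr(δ) is 0 or 1.
  act-C-1 : ∀ δ → act (C δ δ) 1# ≈ tr δ
  act-C-1 δ = begin
    act (C δ δ) 1#                                  ≈⟨ act-C δ δ 1# ⟩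
    ∑< n (λ i → tr (δ * frob i δ) * frob i 1#)      ≈⟨ ∑<-cong n (λ i → trans (*-congˡ (frob-1 i)) (*-identityʳ _)) ⟩
    ∑< n (λ i → tr (δ * frob i δ))                  ≈⟨ ∑<-swap n n (λ i j → frob j (δ * frob i δ)) ⟩
    ∑< n (λ j → ∑< n (λ i → frob j (δ * frob i δ))) ≈⟨ ∑<-cong n (λ j → sym (frob-∑ j n (λ i → δ * frob i δ))) ⟩
    tr (∑< n (λ i → δ * frob i δ))                  ≈⟨ tr-cong (sym (*-∑ n δ (λ i → frob i δ))) ⟩
    tr (δ * tr δ)                                   ≈⟨ by-cases (idempotent⇒0∨1 (tr² δ)) ⟩
    tr δ                                            ∎
    where
    open SetoidReasoning setoid
    by-cases : tr δ ≈ 0# ⊎ tr δ ≈ 1# → tr (δ * tr δ) ≈ tr δ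
    by-cases (inj₁ eq) = trans (trans (tr-cong (trans (*-congˡ eq) (zeroʳ δ))) tr-0) (sym eq)
    by-cases (inj₂ eq) = tr-cong (trans (*-congˡ eq) (*-identityʳ δ))

-- Injections of finite sets, and the data to be constructed

-- A missed value `y`, put in front of the values of `f`, would give `suc m` distinct elements of
-- `Fin m`.
injective⇒hits : ∀ {m} (f : Fin m → Fin m) → (∀ {i j} → f i ≡ f j → i ≡ j) → ∀ y → ∃[ i ] f i ≡ y
injective⇒hits {m} f inj y with Fin.any? (λ i → f i Fin.≟ y)
... | yes hit = hit
... | no miss = contradiction (Fin.pigeonhole (ℕ.n<1+n m) y∷f) no-collision
  where
  y∷f : Fin (suc m) → Fin m
  y∷f Fin.zero    = y
  y∷f (Fin.suc i) = f i
  no-collision : ¬ (∃[ i ] ∃[ j ] i Fin.< j × y∷f i ≡ y∷f j)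
  no-collision (Fin.zero  , Fin.suc j , _   , eq) = miss (j , ≡.sym eq)
  no-collision (Fin.suc i , Fin.suc j , i<j , eq) = Fin.<⇒≢ i<j (≡.cong Fin.suc (inj eq))

funToFin-cong : ∀ {m n} {f g : Fin m → Fin n} → (∀ i → f i ≡ g i) → funToFin f ≡ funToFin g
funToFin-cong {zero}  eq = ≡.refl
funToFin-cong {suc m} eq = ≡.cong₂ combine (eq Fin.zero) (funToFin-cong (eq ∘ Fin.suc))

extend : ∀ {a} {A : Set a} {k} → A → (Fin k → A) → ℕ → A
extend {k = zero}  default f _       = default
extend {k = suc k} default f zero    = f Fin.zero
extend {k = suc k} default f (suc j) = extend default (f ∘ Fin.suc) j

extend-toℕ : ∀ {a} {A : Set a} {k} (default : A) (f : Fin k → A) i → extend default f (toℕ i) ≡ f i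
extend-toℕ default f Fin.zero    = ≡.refl
extend-toℕ default f (Fin.suc i) = extend-toℕ default (f ∘ Fin.suc) i

-- The exponent is odd by its form and is left unreduced modulo n; the weight count reduces it
-- later.
record AutocorrelationTrinomial {c ℓ} (n : ℕ) (0<n : 0 ℕ.< n) (F : FiniteField (2 ℕ.^ n) c ℓ) : Set (c ⊔ ℓ) where
  open CorrelationForm n 0<n F
  field
    k : ℕ
  trinomial : A.Carrier
  trinomial = A.1# A.+ (x A.^ suc (k ℕ.+ k) A.+ x̄ A.^ suc (k ℕ.+ k))
  field
    {trinomial⁻¹} : A.Carrier
    invertible    : trinomial A.* trinomial⁻¹ A.≈ A.1#
    {α}           : FiniteField.Carrier F
    C≋trinomial   : C α α A.≈ trinomial

-- An element with φ(C θ θ) = 1 and its correction to a trinomial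

module Construction {c ℓ} (q′ : ℕ)
  (F : FiniteField (2 ℕ.^ ((suc q′ ℕ.+ suc q′) ℕ.+ (suc q′ ℕ.+ suc q′))) c ℓ) where

  q h n : ℕ
  q = suc q′
  h = q ℕ.+ q
  n = h ℕ.+ h

  open FiniteField F
  open Frobenius n F
  open Char2 commutativeRing (characteristic-2 n F)
  open RangeSum +-commutativeMonoid
  open SemiringExp semiring using (_^_)
  open FrobeniusOperators n F
  open CorrelationForm n ℕ.z<s F
  private
    module E = Inverse enumeration
    module ≈-Reasoning = SetoidReasoning setoid
    module ≋-Reasoning = SetoidReasoning A.setoid

  autocorrelation : Carrier → ℕ → Carrier
  autocorrelation δ i = tr (δ * frob i δ)

  -- Applying σʲ inside the trace sends σⁱδ to σⁿδ = δ.
  autocorrelation-symmetric : ∀ δ i j → i ℕ.+ j ≡ n → autocorrelation δ i ≈ autocorrelation δ j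
  autocorrelation-symmetric δ i j i+j≡n = begin
    tr (δ * frob i δ)                       ≈⟨ tr-frob j _ ⟨
    tr (frob j (δ * frob i δ))              ≈⟨ tr-cong (frob-* j δ (frob i δ)) ⟩
    tr (frob j δ * frob j (frob i δ))
      ≈⟨ tr-cong (*-congˡ (trans (reflexive (≡.trans (≡.sym (frob-∘ j i δ))
           (≡.cong (λ k → frob k δ) (≡.trans (ℕ.+-comm j i) i+j≡n)))) (frob-n δ))) ⟩
    tr (frob j δ * δ)                       ≈⟨ tr-cong (*-comm _ δ) ⟩
    tr (δ * frob j δ)                       ∎
    where open ≈-Reasoning

  -- δ · σʰδ lies in the fixed field of σʰ, so its trace counts everything twice.
  autocorrelation-middle : ∀ δ → autocorrelation δ h ≈ 0#
  autocorrelation-middle δ = begin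
    tr N                                                      ≈⟨ ∑<-split h h (λ i → frob i N) ⟩
    ∑< h (λ i → frob i N) + ∑< h (λ i → frob (h ℕ.+ i) N)     ≈⟨ +-congˡ (∑<-cong h folded) ⟩
    ∑< h (λ i → frob i N) + ∑< h (λ i → frob i N)             ≈⟨ characteristic-2 n F _ ⟩
    0#                                                        ∎
    where
    open ≈-Reasoning
    N = δ * frob h δ
    fixed : frob h N ≈ N
    fixed = begin
      frob h (δ * frob h δ)            ≈⟨ frob-* h δ _ ⟩
      frob h δ * frob h (frob h δ)     ≈⟨ *-congˡ (trans (reflexive (≡.sym (frob-∘ h h δ))) (frob-n δ)) ⟩
      frob h δ * δ                     ≈⟨ *-comm _ δ ⟩
      N                                ∎
    folded : ∀ i → frob (h ℕ.+ i) N ≈ frob i N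
    folded i = begin
      frob (h ℕ.+ i) N     ≡⟨ ≡.cong (λ k → frob k N) (ℕ.+-comm h i) ⟩
      frob (i ℕ.+ h) N     ≡⟨ frob-∘ i h N ⟩
      frob i (frob h N)    ≈⟨ frob-cong i fixed ⟩
      frob i N             ∎

  -- The trace to 𝔽₄, the fixed field of σ².
  tr₄ : Carrier → Carrier
  tr₄ y = ∑< h (λ l → frob (l ℕ.+ l) y)

  tr₄-σ : ∀ y → tr₄ (y * y) ≈ tr₄ y * tr₄ y
  tr₄-σ y = trans (∑<-cong h (λ l → frob-* (l ℕ.+ l) y y)) (sym (frob-∑ 1 h (λ l → frob (l ℕ.+ l) y)))

  tr-tr₄ : ∀ y → tr y ≈ tr₄ y + tr₄ y * tr₄ y
  tr-tr₄ y = trans (∑<-interleave h (λ i → frob i y)) (+-congˡ (sym (frob-∑ 1 h (λ l → frob (l ℕ.+ l) y))))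

  tr₄-fixed₂ : ∀ y → frob 2 (tr₄ y) ≈ tr₄ y
  tr₄-fixed₂ y = begin
    frob 2 (tr₄ y)                                ≈⟨ frob-∑ 2 h (λ l → frob (l ℕ.+ l) y) ⟩
    ∑< h (λ l → frob (suc (suc (l ℕ.+ l))) y)     ≈⟨ ∑<-cong h (λ l → reflexive (≡.cong (λ k → frob (suc k) y) (≡.sym (ℕ.+-suc l l)))) ⟩
    ∑< h (λ l → frob (suc l ℕ.+ suc l) y)         ≈⟨ ∑<-rotate h (λ l → frob (l ℕ.+ l) y) (frob-n y) ⟩
    tr₄ y                                         ∎
    where open ≈-Reasoning

  fixed₂⇒fixed-even : ∀ {z} → frob 2 z ≈ z → ∀ j → frob (j ℕ.+ j) z ≈ z
  fixed₂⇒fixed-even fixed zero    = refl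
  fixed₂⇒fixed-even {z} fixed (suc j) = trans
    (reflexive (≡.cong (λ k → frob (suc k) z) (ℕ.+-suc j j)))
    (trans (frob-cong 2 (fixed₂⇒fixed-even fixed j)) fixed)

  tr₄-frob-even : ∀ j y → tr₄ (frob (j ℕ.+ j) y) ≈ tr₄ y
  tr₄-frob-even j y = begin
    ∑< h (λ l → frob (l ℕ.+ l) (frob (j ℕ.+ j) y))   ≈⟨ ∑<-cong h commute ⟩
    ∑< h (λ l → frob (j ℕ.+ j) (frob (l ℕ.+ l) y))   ≈⟨ frob-∑ (j ℕ.+ j) h (λ l → frob (l ℕ.+ l) y) ⟨
    frob (j ℕ.+ j) (tr₄ y)                           ≈⟨ fixed₂⇒fixed-even (tr₄-fixed₂ y) j ⟩
    tr₄ y                                            ∎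
    where
    open ≈-Reasoning
    commute : ∀ l → frob (l ℕ.+ l) (frob (j ℕ.+ j) y) ≈ frob (j ℕ.+ j) (frob (l ℕ.+ l) y)
    commute l = reflexive (≡.trans (≡.sym (frob-∘ (l ℕ.+ l) (j ℕ.+ j) y))
      (≡.trans (≡.cong (λ k → frob k y) (ℕ.+-comm (l ℕ.+ l) (j ℕ.+ j))) (frob-∘ (j ℕ.+ j) (l ℕ.+ l) y)))

  -- With a the trace of θ to 𝔽₄, both sides are the norm a · σa of a, where a + σa = 1.
  odd-autocorrelations : ∀ {θ} → tr θ ≈ 1# → ∑< q (λ l → autocorrelation θ (suc (l ℕ.+ l))) ≈ 1#
  odd-autocorrelations {θ} trθ≈1 = begin
    ∑< q (λ l → autocorrelation θ (suc (l ℕ.+ l)))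
      ≈⟨ ∑<-fold q G _ G-pair ⟨
    ∑< h G
      ≈⟨ ∑<-swap h h (λ l j → frob (j ℕ.+ j) (θ * frob (suc (l ℕ.+ l)) θ)) ⟩
    ∑< h (λ j → ∑< h (λ l → frob (j ℕ.+ j) (θ * frob (suc (l ℕ.+ l)) θ)))
      ≈⟨ ∑<-cong h (λ j → trans (sym (frob-∑ (j ℕ.+ j) h (λ l → θ * frob (suc (l ℕ.+ l)) θ)))
           (frob-cong (j ℕ.+ j) (trans (sym (*-∑ h θ (λ l → frob (suc (l ℕ.+ l)) θ))) (*-congˡ (sym (frob-∑ 1 h (λ l → frob (l ℕ.+ l) θ))))))) ⟩
    ∑< h (λ j → frob (j ℕ.+ j) (θ * (a * a)))
      ≈⟨ ∑<-cong h (λ j → trans (frob-* (j ℕ.+ j) θ (a * a)) (*-congˡ (fixed₂⇒fixed-even σa-fixed j))) ⟩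
    ∑< h (λ j → frob (j ℕ.+ j) θ * (a * a))
      ≈⟨ ∑-* h (λ j → frob (j ℕ.+ j) θ) (a * a) ⟨
    a * (a * a)
      ≈⟨ solve 1 (λ a → a :* (a :* a) := a :* (a :+ a :* a) :+ a :* a) refl a ⟩
    a * (a + a * a) + a * a
      ≈⟨ +-congʳ (trans (*-congˡ a+σa≈1) (*-identityʳ a)) ⟩
    a + a * a
      ≈⟨ a+σa≈1 ⟩
    1# ∎
    where
    open ≈-Reasoning
    a = tr₄ θ
    a+σa≈1 : a + a * a ≈ 1#
    a+σa≈1 = trans (sym (tr-tr₄ θ)) trθ≈1
    G : ℕ → Carrier
    G l = tr₄ (θ * frob (suc (l ℕ.+ l)) θ)
    σa-fixed : frob 2 (a * a) ≈ a * a
    σa-fixed = trans (frob-* 2 a a) (*-cong (tr₄-fixed₂ θ) (tr₄-fixed₂ θ))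
    -- The two odd exponents add up to n, so the second product is `y` moved by an odd power of σ.
    -- Its trace to 𝔽₄ is therefore the other conjugate of `tr₄ y`, and the two conjugates add up to
    -- the full trace.
    G-pair : ∀ i j → suc (i ℕ.+ j) ≡ q ℕ.+ q → G i + G j ≈ autocorrelation θ (suc (i ℕ.+ i))
    G-pair i j eq = begin
      tr₄ y + tr₄ (θ * frob (suc (j ℕ.+ j)) θ)   ≈⟨ +-congˡ (∑<-cong h (λ l → frob-cong (l ℕ.+ l) reflected)) ⟩
      tr₄ y + tr₄ (z * z)                        ≈⟨ +-congˡ (tr₄-σ z) ⟩
      tr₄ y + tr₄ z * tr₄ z                      ≈⟨ +-congˡ (*-cong (tr₄-frob-even j y) (tr₄-frob-even j y)) ⟩
      tr₄ y + tr₄ y * tr₄ y                      ≈⟨ tr-tr₄ y ⟨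
      tr y                                       ∎
      where
      y = θ * frob (suc (i ℕ.+ i)) θ
      z = frob (j ℕ.+ j) y
      reflected : θ * frob (suc (j ℕ.+ j)) θ ≈ frob (suc (j ℕ.+ j)) y
      reflected = begin
        θ * frob (suc (j ℕ.+ j)) θ
          ≈⟨ *-comm θ _ ⟩
        frob (suc (j ℕ.+ j)) θ * θ
          ≈⟨ *-congˡ (trans (reflexive (≡.trans (≡.sym (frob-∘ (suc (j ℕ.+ j)) (suc (i ℕ.+ i)) θ))
               (≡.cong (λ k → frob k θ) (≡.trans (ℕ.+-comm (suc (j ℕ.+ j)) (suc (i ℕ.+ i))) (odd-reflection i j q eq))))) (frob-n θ)) ⟨
        frob (suc (j ℕ.+ j)) θ * frob (suc (j ℕ.+ j)) (frob (suc (i ℕ.+ i)) θ)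
          ≈⟨ frob-* (suc (j ℕ.+ j)) θ _ ⟨
        frob (suc (j ℕ.+ j)) y ∎

  bit-0 : ∀ {t} → t ≈ 0# → bit t A.≈ A.0#
  bit-0 {t} t≈0 = A.reflexive (≡.cong (λ d → A.⟦ not d ⟧₂) (dec-true (t ≟ 0#) t≈0))

  bit-1 : ∀ {t} → t ≈ 1# → bit t A.≈ A.1#
  bit-1 {t} t≈1 = A.reflexive (≡.cong (λ d → A.⟦ not d ⟧₂) (dec-false (t ≟ 0#) (λ t≈0 → 1≉0 (trans (sym t≈1) t≈0))))

  abstract
    stabilisation : ∃[ s′ ] A.frob (suc s′) (A.frob (suc s′) x) A.≈ A.frob (suc s′) x
    stabilisation = A.frob-stabilises n x^n≋1

  s′ : ℕ
  s′ = proj₁ stabilisation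

  module N = A.Norm x x̄ xx̄≋1 s′ (proj₂ stabilisation)

  autocorrelation-bit : Carrier → ℕ → Bool
  autocorrelation-bit δ i = not (does (autocorrelation δ i ≟ 0#))

  bit-symmetric : ∀ δ i j → i ℕ.+ j ≡ n → bit (autocorrelation δ i) A.≈ bit (autocorrelation δ j)
  bit-symmetric δ i j eq = bit-cong (tr² _) (autocorrelation-symmetric δ i j eq)

  bit-middle : ∀ δ → bit (autocorrelation δ h) A.≈ A.0#
  bit-middle δ = bit-0 (autocorrelation-middle δ)

  Poly-C : ∀ δ → A.Poly w (C δ δ)
  Poly-C δ = N.Poly-symmetric q′ x^n≋1 (autocorrelation-bit δ) (bit-symmetric δ) (bit-middle δ)

  ∑-bits : ∀ m (t : ℕ → Carrier) → (∀ i → t i * t i ≈ t i) → ∑< m t ≈ 1# → A.∑< m (λ i → bit (t i)) A.≈ A.1#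
  ∑-bits m t idem ∑≈1 = ext λ v → begin
    act (A.∑< m (λ i → bit (t i))) v      ≈⟨ act-∑ m (λ i → bit (t i)) v ⟩
    ∑< m (λ i → act (bit (t i)) v)
      ≈⟨ ∑<-cong m (λ i → trans (sym (app (A.*-identityʳ (bit (t i))) v)) (trans (act-bit (idem i) A.1# v) (*-congˡ (act-1 v)))) ⟩
    ∑< m (λ i → t i * v)                  ≈⟨ ∑-* m t v ⟨
    ∑< m t * v                            ≈⟨ *-congʳ ∑≈1 ⟩
    1# * v                                ≈⟨ *-identityˡ v ⟩
    v                                     ≈⟨ act-1 v ⟨
    act A.1# v                            ∎
    where open ≈-Reasoning

  form : N.HermitianForm c
  form = record
    { 𝟎 = 0#
    ; _⊹_ = _+_
    ; _▷_ = act
    ; C = C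
    ; C-0 = C-0ˡ 0#
    ; C-+ˡ = C-+ˡ
    ; C-+ʳ = C-+ʳ
    ; C-▷ˡ = C-actˡ
    ; C-x▷ʳ = C-xʳ
    ; C-▷ʳ = C-polyʳ
    ; C-poly = Poly-C
    ; faithful = C-faithful
    }

  abstract
    covering-elements : ∃[ θ ] N.φ (C θ θ) A.* N.φ (C θ θ) A.≈ N.φ (C θ θ) ×
      All (N.Covers x-generates form θ) (List.tabulate E.from)
    covering-elements = N.cover-list x-generates form (List.tabulate E.from)

  θ : Carrier
  θ = proj₁ covering-elements

  f : A.Carrier
  f = A.1# A.+ N.φ (C θ θ)

  covers : ∀ δ → f A.* N.φ (C δ δ) A.≈ A.0#
  covers δ = A.trans
    (A.*-congˡ {f} (A.frob-cong (suc s′) (C-cong (sym (E.strictlyInverseʳ δ)) (sym (E.strictlyInverseʳ δ)))))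
    (All.tabulate⁻ (proj₂ (proj₂ covering-elements)) (E.to δ))

  ff≋f : f A.* f A.≈ f
  ff≋f = begin
    f A.* f                     ≈⟨ A.solve 1 (λ e → (A.con true A.:+ e) A.:* (A.con true A.:+ e) A.:= A.con true A.:+ e A.:* e) A.refl ε ⟩
    A.1# A.+ ε A.* ε            ≈⟨ A.+-congˡ {A.1#} (proj₁ (proj₂ covering-elements)) ⟩
    f                           ∎
    where
    open ≋-Reasoning
    ε = N.φ (C θ θ)

  fφx≋f : f A.* N.φ x A.≈ f
  fφx≋f = N.Orthogonal.fφx≈f x-generates form ff≋f covers

  -- As f φ(x) = f, the product of f with φ of a polynomial in `x` is its augmentation times f. The
  -- augmentation is read off by acting on 1, and the two alternatives are its two values.
  fφ-augmentation : ∀ {a} → A.Poly x a →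
    (act a 1# ≈ 0# × f A.* N.φ a A.≈ A.0#) ⊎ (act a 1# ≈ 1# × f A.* N.φ a A.≈ f)
  fφ-augmentation (A.null a≋0) = inj₁ (app a≋0 1# ,
    A.trans (A.*-congˡ {f} (A.trans (A.frob-cong (suc s′) a≋0) (A.frob-0 (suc s′)))) (A.zeroʳ f))
  fφ-augmentation {a} (A.horner {g = g} b p a≋) = by-cases b A.refl (fφ-augmentation p)
    where
    act-a : act a 1# ≈ act A.⟦ b ⟧₂ 1# + act g 1#
    act-a = trans (app a≋ 1#) (trans (act-++ A.⟦ b ⟧₂ (x A.* g) 1#) (+-congˡ
      (trans (act-⊛ x g 1#) (trans (act-comm x g 1#) (act-cong g (trans (act-x 1#) (*-identityˡ 1#)))))))
    fφa : f A.* N.φ a A.≈ f A.* A.⟦ b ⟧₂ A.+ f A.* N.φ g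
    fφa = begin
      f A.* N.φ a
        ≈⟨ A.*-congˡ {f} (A.trans (A.frob-cong (suc s′) a≋) (A.trans (A.frob-+ (suc s′) A.⟦ b ⟧₂ (x A.* g))
             (A.+-cong (A.frob-⟦⟧ (suc s′) b) (A.frob-* (suc s′) x g)))) ⟩
      f A.* (A.⟦ b ⟧₂ A.+ N.φ x A.* N.φ g)
        ≈⟨ A.solve 4 (λ f b x g → f A.:* (b A.:+ x A.:* g) A.:= f A.:* b A.:+ f A.:* x A.:* g) A.refl f A.⟦ b ⟧₂ (N.φ x) (N.φ g) ⟩
      f A.* A.⟦ b ⟧₂ A.+ f A.* N.φ x A.* N.φ g
        ≈⟨ A.+-congˡ {f A.* A.⟦ b ⟧₂} (A.*-congʳ fφx≋f) ⟩
      f A.* A.⟦ b ⟧₂ A.+ f A.* N.φ g ∎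
      where open ≋-Reasoning
    by-cases : ∀ b′ → A.⟦ b ⟧₂ A.≈ A.⟦ b′ ⟧₂ →
      (act g 1# ≈ 0# × f A.* N.φ g A.≈ A.0#) ⊎ (act g 1# ≈ 1# × f A.* N.φ g A.≈ f) →
      (act a 1# ≈ 0# × f A.* N.φ a A.≈ A.0#) ⊎ (act a 1# ≈ 1# × f A.* N.φ a A.≈ f)
    by-cases false eq (inj₁ (u , v)) = inj₁
      (trans act-a (trans (+-cong (app eq 1#) u) (+-identityˡ 0#)) ,
       A.trans fφa (A.trans (A.+-cong (A.trans (A.*-congˡ {f} eq) (A.zeroʳ f)) v) (A.+-identityˡ A.0#)))
    by-cases false eq (inj₂ (u , v)) = inj₂
      (trans act-a (trans (+-cong (app eq 1#) u) (+-identityˡ 1#)) ,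
       A.trans fφa (A.trans (A.+-cong (A.trans (A.*-congˡ {f} eq) (A.zeroʳ f)) v) (A.+-identityˡ f)))
    by-cases true eq (inj₁ (u , v)) = inj₂
      (trans act-a (trans (+-cong (trans (app eq 1#) (act-1 1#)) u) (+-identityʳ 1#)) ,
       A.trans fφa (A.trans (A.+-cong (A.trans (A.*-congˡ {f} eq) (A.*-identityʳ f)) v) (A.+-identityʳ f)))
    by-cases true eq (inj₂ (u , v)) = inj₁
      (trans act-a (trans (+-cong (trans (app eq 1#) (act-1 1#)) u) (characteristic-2 n F 1#)) ,
       A.trans fφa (A.trans (A.+-cong (A.trans (A.*-congˡ {f} eq) (A.*-identityʳ f)) v) (operators-characteristic-2 f)))

  f≋0 : f A.≈ A.0#
  f≋0 = by-cases (fφ-augmentation (x-generates (C δ δ)))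
    where
    δ = proj₁ (trace-one ℕ.z<s)
    by-cases : (act (C δ δ) 1# ≈ 0# × f A.* N.φ (C δ δ) A.≈ A.0#) ⊎ (act (C δ δ) 1# ≈ 1# × f A.* N.φ (C δ δ) A.≈ f) → f A.≈ A.0#
    by-cases (inj₁ (act≈0 , _)) = contradiction (trans (sym (trans (act-C-1 δ) (proj₂ (trace-one ℕ.z<s)))) act≈0) 1≉0
    by-cases (inj₂ (_ , fφC≋f)) = A.trans (A.sym fφC≋f) (covers δ)

  φC≋1 : N.φ (C θ θ) A.≈ A.1#
  φC≋1 = A.sym (A.+≈0⇒≈ f≋0)

  -- φ(C θ θ) = 1 makes C θ θ a unit, so its augmentation, which is tr θ, cannot be 0.
  trθ≈1 : tr θ ≈ 1#
  trθ≈1 = by-cases (idempotent⇒0∨1 (tr² θ))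
    where
    by-cases : tr θ ≈ 0# ⊎ tr θ ≈ 1# → tr θ ≈ 1#
    by-cases (inj₂ eq) = eq
    by-cases (inj₁ eq) = contradiction (begin
      1#                                     ≈⟨ act-1 1# ⟨
      act A.1# 1#                            ≈⟨ app φC≋1 1# ⟨
      act (N.φ (C θ θ)) 1#                   ≈⟨ app (A.*-pow⁻ (suc s′) (C θ θ)) 1# ⟨
      act (C θ θ A.* r) 1#                   ≈⟨ trans (act-⊛ (C θ θ) r 1#) (act-comm (C θ θ) r 1#) ⟩
      act r (act (C θ θ) 1#)                 ≈⟨ act-cong r (trans (act-C-1 θ) eq) ⟩
      act r 0#                               ≈⟨ act-0 r ⟩
      0#                                     ∎) 1≉0
      where
      open ≈-Reasoning
      r = A.pow⁻ (suc s′) (C θ θ)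

  tangent-C : N.Tangent (C θ θ)
  tangent-C = N.tangent-symmetric q′ x^n≋1 (autocorrelation-bit θ) (bit-symmetric θ) (bit-middle θ)
    -- The coefficient at exponent 0 is tr(θ²) = tr(θ).
    (bit-1 (trans (tr-frob₁ θ) trθ≈1))
    (∑-bits q (λ l → autocorrelation θ (suc (l ℕ.+ l))) (λ l → tr² _) (odd-autocorrelations trθ≈1))
    φC≋1

  abstract
    target : ∃[ k ] N.Tangent (A.1# A.+ N.D (suc (k ℕ.+ k)))
    target = N.target

  realise : ∀ {a} → (∃[ g ] ∃[ d ] A.Poly w g × A.Poly w d ×
    (A.1# A.+ x A.* g) A.* (A.1# A.+ x̄ A.* g) A.* (d A.* d) A.* C θ θ A.≈ a) → ∃[ α ] C α α A.≈ a
  realise (g , d , Pg , Pd , eq) = act ((A.1# A.+ x A.* g) A.* d) θ , A.trans (C-norm Pg Pd θ) eq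

  autocorrelationTrinomial : AutocorrelationTrinomial n ℕ.z<s F
  autocorrelationTrinomial = go target
    where
    go : (∃[ k ] N.Tangent (A.1# A.+ N.D (suc (k ℕ.+ k)))) → AutocorrelationTrinomial n ℕ.z<s F
    go (k , tangent) = record
      { k = k
      ; invertible = N.unipotent-inverse (N.Tangent.unipotent tangent)
      ; C≋trinomial = proj₂ α
      }
      where
      α : ∃[ α ] C α α A.≈ A.1# A.+ N.D (suc (k ℕ.+ k))
      α = realise (N.norm-equivalent tangent-C tangent)

-- From the trinomial to weight three and normality

odd≢even : ∀ k l → suc (k ℕ.+ k) ≢ l ℕ.+ l
odd≢even k l eq = ℕ.even≢odd l k (≡.trans (≡.cong (l ℕ.+_) (ℕ.+-identityʳ l))
  (≡.trans (≡.sym eq) (≡.cong (suc ∘ (k ℕ.+_)) (≡.sym (ℕ.+-identityʳ k)))))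

module OddExponent (q k n : ℕ) .{{_ : ℕ.NonZero n}} (n≡4q : n ≡ (q ℕ.+ q) ℕ.+ (q ℕ.+ q)) where

  private
    h : ℕ
    h = q ℕ.+ q

  r r̄ : ℕ
  r = suc (k ℕ.+ k) % n
  r̄ = n ℕ.∸ r

  r<n : r ℕ.< n
  r<n = m%n<n _ n

  -- n is even, so reduction modulo n keeps the exponent odd. The case l = 0 separates `r` from 0,
  -- and l = q, where q + q is n / 2, separates it from n - r.
  r-not-even : ∀ l → r ≢ l ℕ.+ l
  r-not-even l r≡2l = odd≢even k (l ℕ.+ t ℕ.* h) (begin
    suc (k ℕ.+ k)                                      ≡⟨ m≡m%n+[m/n]*n (suc (k ℕ.+ k)) n ⟩
    r ℕ.+ t ℕ.* n                                      ≡⟨ ≡.cong₂ (λ a b → a ℕ.+ t ℕ.* b) r≡2l n≡4q ⟩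
    (l ℕ.+ l) ℕ.+ t ℕ.* (h ℕ.+ h)                      ≡⟨ ≡.cong ((l ℕ.+ l) ℕ.+_) (ℕ.*-distribˡ-+ t h h) ⟩
    (l ℕ.+ l) ℕ.+ (t ℕ.* h ℕ.+ t ℕ.* h)                ≡⟨ double-+ l (t ℕ.* h) ⟩
    (l ℕ.+ t ℕ.* h) ℕ.+ (l ℕ.+ t ℕ.* h)                ∎)
    where
    open ≡.≡-Reasoning
    t = suc (k ℕ.+ k) / n

  r≢0 : r ≢ 0
  r≢0 = r-not-even 0

  r+r̄≡n : r ℕ.+ r̄ ≡ n
  r+r̄≡n = ℕ.m+[n∸m]≡n (ℕ.<⇒≤ r<n)

  r̄≢0 : r̄ ≢ 0
  r̄≢0 r̄≡0 = ℕ.<⇒≢ r<n (≡.trans (≡.sym (ℕ.+-identityʳ r)) (≡.trans (≡.cong (r ℕ.+_) (≡.sym r̄≡0)) r+r̄≡n))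

  r̄<n : r̄ ℕ.< n
  r̄<n = ℕ.∸-monoʳ-< (ℕ.n≢0⇒n>0 r≢0) (ℕ.<⇒≤ r<n)

  r≢r̄ : r ≢ r̄
  r≢r̄ r≡r̄ = r-not-even q (double-injective (≡.trans (≡.cong (r ℕ.+_) r≡r̄) (≡.trans r+r̄≡n n≡4q)))
    where
    double-injective : ∀ {a b} → a ℕ.+ a ≡ b ℕ.+ b → a ≡ b
    double-injective {a} {b} eq = ℕ.*-cancelˡ-≡ a b 2
      (≡.trans (≡.cong (a ℕ.+_) (ℕ.+-identityʳ a)) (≡.trans eq (≡.cong (b ℕ.+_) (≡.sym (ℕ.+-identityʳ b)))))

module WeightThree {c ℓ} (q k n : ℕ) (0<n : 0 ℕ.< n) (n≡4q : n ≡ (q ℕ.+ q) ℕ.+ (q ℕ.+ q))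
  (F : FiniteField (2 ℕ.^ n) c ℓ) where

  open FiniteField F
  open Frobenius n F
  open Char2 commutativeRing (characteristic-2 n F)
  open RangeSum +-commutativeMonoid
  open SemiringExp semiring using (_^_)
  open FrobeniusOperators n F
  open CorrelationForm n 0<n F
  private
    module E = Inverse enumeration
    module W = RangeSum ℕ.+-0-commutativeMonoid
    instance
      n-nonZero : ℕ.NonZero n
      n-nonZero = ℕ.>-nonZero 0<n
  open OddExponent q k n n≡4q

  𝟙 : Bool → ℕ
  𝟙 b = if b then 1 else 0

  trinomial : A.Carrier
  trinomial = A.1# A.+ (x A.^ suc (k ℕ.+ k) A.+ x̄ A.^ suc (k ℕ.+ k))

  act-T : ∀ v → act trinomial v ≈ v + (frob r v + frob r̄ v)
  act-T v = trans (act-++ A.1# (x A.^ m A.+ x̄ A.^ m) v) (+-cong (act-1 v)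
    (trans (act-++ (x A.^ m) (x̄ A.^ m) v) (+-cong (power x^n≋1) (trans (app x̄^m≋ v) (act-^ r̄ v)))))
    where
    m = suc (k ℕ.+ k)
    power : x A.^ n A.≈ A.1# → act (x A.^ m) v ≈ frob r v
    power xⁿ≋1 = trans (app (A.^-% n xⁿ≋1 m) v) (act-^ r v)
    open SetoidReasoning A.setoid
    x^i*x̄^i≋1 : ∀ i → x A.^ i A.* x̄ A.^ i A.≈ A.1#
    x^i*x̄^i≋1 = A.inverse-^ xx̄≋1
    x̄^n≋1 : x̄ A.^ n A.≈ A.1#
    x̄^n≋1 = begin
      x̄ A.^ n              ≈⟨ A.*-identityˡ _ ⟨
      A.1# A.* x̄ A.^ n     ≈⟨ A.*-congʳ x^n≋1 ⟨
      x A.^ n A.* x̄ A.^ n  ≈⟨ x^i*x̄^i≋1 n ⟩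
      A.1#                 ∎
    x̄^m≋ : x̄ A.^ m A.≈ x A.^ r̄
    x̄^m≋ = A.trans (A.^-% n x̄^n≋1 m) (A.sym (A.^-complement xx̄≋1 x^n≋1 r r̄ r+r̄≡n))

  indicator : ℕ → Carrier
  indicator i = ⟦ i ℕ.≡ᵇ 0 ⟧₂ + (⟦ i ℕ.≡ᵇ r ⟧₂ + ⟦ i ℕ.≡ᵇ r̄ ⟧₂)

  ∑-indicator : ∀ v → act trinomial v ≈ ∑< n (λ i → indicator i * frob i v)
  ∑-indicator v = sym (begin
    ∑< n (λ i → indicator i * frob i v)
      ≈⟨ ∑<-cong n (λ i → trans (distribʳ _ _ _) (+-congˡ (distribʳ _ _ _))) ⟩
    ∑< n (λ i → ⟦ i ℕ.≡ᵇ 0 ⟧₂ * frob i v + (⟦ i ℕ.≡ᵇ r ⟧₂ * frob i v + ⟦ i ℕ.≡ᵇ r̄ ⟧₂ * frob i v))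
      ≈⟨ trans (∑<-∙ n _ _) (+-congˡ (∑<-∙ n _ _)) ⟩
    ∑< n (λ i → ⟦ i ℕ.≡ᵇ 0 ⟧₂ * frob i v) + (∑< n (λ i → ⟦ i ℕ.≡ᵇ r ⟧₂ * frob i v) + ∑< n (λ i → ⟦ i ℕ.≡ᵇ r̄ ⟧₂ * frob i v))
      ≈⟨ +-cong (single 0<n) (+-cong (single r<n) (single r̄<n)) ⟩
    v + (frob r v + frob r̄ v)
      ≈⟨ act-T v ⟨
    act trinomial v ∎)
    where
    open SetoidReasoning setoid
    select : ∀ b y → ⟦ b ⟧₂ * y ≈ (if b then y else 0#)
    select false y = zeroˡ y
    select true  y = *-identityˡ y
    single : ∀ {j} → j ℕ.< n → ∑< n (λ i → ⟦ i ℕ.≡ᵇ j ⟧₂ * frob i v) ≈ frob j v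
    single {j} j<n = trans (∑<-cong n (λ i → select (i ℕ.≡ᵇ j) (frob i v))) (∑<-single n (λ i → frob i v) j<n)

  count≡∑ : ∀ {m} (g : Fin m → Carrier) (w : ℕ → ℕ) →
    (∀ i → 𝟙 (not (does (g i ≟ 0#))) ≡ w (toℕ i)) → hammingWeight n F (tabulate g) ≡ W.∑< m w
  count≡∑ {zero}  g w eq = ≡.refl
  count≡∑ {suc m} g w eq = ≡.trans (step (does (g Fin.zero ≟ 0#)))
    (≡.cong₂ ℕ._+_ (eq Fin.zero) (count≡∑ (g ∘ Fin.suc) (w ∘ suc) (eq ∘ Fin.suc)))
    where
    step : ∀ b {t} → (if not b then suc else (λ i → i)) t ≡ 𝟙 (not b) ℕ.+ t
    step false = ≡.refl
    step true  = ≡.refl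

  weight : ℕ → ℕ
  weight i = 𝟙 (i ℕ.≡ᵇ 0) ℕ.+ (𝟙 (i ℕ.≡ᵇ r) ℕ.+ 𝟙 (i ℕ.≡ᵇ r̄))

  ∑-weight : W.∑< n weight ≡ 3
  ∑-weight = ≡.trans (W.∑<-∙ n _ _) (≡.cong₂ ℕ._+_ (W.∑<-single n (λ _ → 1) 0<n)
    (≡.trans (W.∑<-∙ n _ _) (≡.cong₂ ℕ._+_ (W.∑<-single n (λ _ → 1) r<n) (W.∑<-single n (λ _ → 1) r̄<n))))

  -- Coinciding exponents would cancel in the field but count twice in ℕ; disjointness makes the two
  -- sums comparable.
  𝟙-disjoint : ∀ p s t → (T p → ¬ T s) → (T p → ¬ T t) → (T s → ¬ T t) →
    ∀ {y} → y ≈ ⟦ p ⟧₂ + (⟦ s ⟧₂ + ⟦ t ⟧₂) → 𝟙 (not (does (y ≟ 0#))) ≡ 𝟙 p ℕ.+ (𝟙 s ℕ.+ 𝟙 t)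
  𝟙-disjoint p s t ps pt st {y} y≈ = go p s t ps pt st y≈
    where
    zero-case : y ≈ 0# → 𝟙 (not (does (y ≟ 0#))) ≡ 0
    zero-case y≈0 = ≡.cong (𝟙 ∘ not) (dec-true (y ≟ 0#) y≈0)
    one-case : y ≈ 1# → 𝟙 (not (does (y ≟ 0#))) ≡ 1
    one-case y≈1 = ≡.cong (𝟙 ∘ not) (dec-false (y ≟ 0#) (λ y≈0 → 1≉0 (trans (sym y≈1) y≈0)))
    go : ∀ p s t → (T p → ¬ T s) → (T p → ¬ T t) → (T s → ¬ T t) →
      y ≈ ⟦ p ⟧₂ + (⟦ s ⟧₂ + ⟦ t ⟧₂) → 𝟙 (not (does (y ≟ 0#))) ≡ 𝟙 p ℕ.+ (𝟙 s ℕ.+ 𝟙 t)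
    go true  true  _     ps _ _ _ = contradiction tt (ps tt)
    go true  false true  _ pt _ _ = contradiction tt (pt tt)
    go false true  true  _ _ st _ = contradiction tt (st tt)
    go false false false _ _ _ y≈ = zero-case (trans y≈ (trans (+-identityˡ _) (+-identityˡ _)))
    go true  false false _ _ _ y≈ = one-case (trans y≈ (trans (+-congˡ (+-identityˡ _)) (+-identityʳ _)))
    go false true  false _ _ _ y≈ = one-case (trans y≈ (trans (+-identityˡ _) (+-identityʳ _)))
    go false false true  _ _ _ y≈ = one-case (trans y≈ (trans (+-identityˡ _) (+-identityˡ _)))

  𝟙-indicator : ∀ i {y} → y ≈ indicator i → 𝟙 (not (does (y ≟ 0#))) ≡ weight i
  𝟙-indicator i = 𝟙-disjoint (i ℕ.≡ᵇ 0) (i ℕ.≡ᵇ r) (i ℕ.≡ᵇ r̄)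
    (distinct (r≢0 ∘ ≡.sym)) (distinct (r̄≢0 ∘ ≡.sym)) (distinct r≢r̄)
    where
    distinct : ∀ {a b} → a ≢ b → T (i ℕ.≡ᵇ a) → ¬ T (i ℕ.≡ᵇ b)
    distinct {a} {b} a≢b i≡a i≡b = a≢b (≡.trans (≡.sym (ℕ.≡ᵇ⇒≡ i a i≡a)) (ℕ.≡ᵇ⇒≡ i b i≡b))

  module _ {α} (Cα≋T : C α α A.≈ trinomial) where

    weight-three : hammingWeight n F (correspondingVector n F α) ≡ 3
    weight-three = ≡.trans (count≡∑ {n} (λ i → Tr n F (α * α ^ (2 ℕ.^ toℕ i))) weight (λ i → 𝟙-indicator (toℕ i) (entry i))) ∑-weight
      where
      entry : ∀ (i : Fin n) → Tr n F (α * α ^ (2 ℕ.^ toℕ i)) ≈ indicator (toℕ i)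
      entry i = trans (Tr≈tr _) (trans (tr-cong (*-congˡ (sym (frob≈^ (toℕ i) α))))
        (C-coefficient {α} {α} indicator (λ v → trans (app Cα≋T v) (∑-indicator v)) (Fin.toℕ<n i)))

    private
      module V = LeftModule (vectorSpace n F)
      conjugates : Fin n → Carrier
      conjugates i = α ^ (2 ℕ.^ toℕ i)

      combination : (Fin n → Bool) → Carrier
      combination b = linearCombination (vectorSpace n F) b conjugates

    module _ {T⁻¹} (TT⁻¹≋1 : trinomial A.* T⁻¹ A.≈ A.1#) where

      -- A relation among the conjugates is an operator with op α = 0. Then op C(α, α) = C(op α, α)
      -- = 0, and C(α, α) is a unit, so op = 0 and `frob-independent` kills its coefficients.
      independent : LinearlyIndependent (vectorSpace n F) conjugates
      independent b combination≈0 i = by-cases (b i) (trans (reflexive (≡.cong ⟦_⟧₂ (≡.sym (extend-toℕ false b i))))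
        (frob-independent (λ j → ⟦ b̃ j ⟧₂) (λ v → trans (sym (act-op v)) (app op≋0 v)) (Fin.toℕ<n i)))
        where
        b̃ : ℕ → Bool
        b̃ = extend false b
        op : A.Carrier
        op = A.∑< n (λ j → A.⟦ b̃ j ⟧₂ A.* x A.^ j)
        scalar : ∀ b j v → act (A.⟦ b ⟧₂ A.* x A.^ j) v ≈ ⟦ b ⟧₂ * frob j v
        scalar false j v = sym (zeroˡ _)
        scalar true  j v = trans (app (A.*-identityˡ (x A.^ j)) v) (trans (act-^ j v) (sym (*-identityˡ _)))
        act-op : ∀ v → act op v ≈ ∑< n (λ j → ⟦ b̃ j ⟧₂ * frob j v)
        act-op v = trans (act-∑ n (λ j → A.⟦ b̃ j ⟧₂ A.* x A.^ j) v) (∑<-cong n (λ j → scalar (b̃ j) j v))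
        select : ∀ b {y z} → y ≈ z → ⟦ b ⟧₂ * y ≈ (_*₂_ n F b z)
        select false _  = zeroˡ _
        select true  eq = trans (*-identityˡ _) eq
        act-op-α : act op α ≈ 0#
        act-op-α = begin
          act op α                                        ≈⟨ act-op α ⟩
          ∑< n (λ j → ⟦ b̃ j ⟧₂ * frob j α)                ≈⟨ sum≈∑< n (λ j → ⟦ b̃ j ⟧₂ * frob j α) ⟨
          sum {n} (λ i → ⟦ b̃ (toℕ i) ⟧₂ * frob (toℕ i) α)
            ≈⟨ sum-cong-≋ {n} (λ i → trans (*-congʳ (reflexive (≡.cong ⟦_⟧₂ (extend-toℕ false b i)))) (select (b i) (frob≈^ (toℕ i) α))) ⟩
          combination b                                   ≈⟨ combination≈0 ⟩
          0#                                              ∎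
          where
          open SetoidReasoning setoid
          open CommutativeMonoidSum +-commutativeMonoid using (sum; sum-cong-≋)
        op≋0 : op A.≈ A.0#
        op≋0 = begin
          op                          ≈⟨ A.*-identityʳ op ⟨
          op A.* A.1#                 ≈⟨ A.*-congˡ {op} (A.trans (A.*-congʳ Cα≋T) TT⁻¹≋1) ⟨
          op A.* (C α α A.* T⁻¹)      ≈⟨ A.*-assoc op (C α α) T⁻¹ ⟨
          op A.* C α α A.* T⁻¹        ≈⟨ A.*-congʳ (C-actˡ op α α) ⟨
          C (act op α) α A.* T⁻¹      ≈⟨ A.*-congʳ (A.trans (C-cong act-op-α refl) (C-0ˡ α)) ⟩
          A.0# A.* T⁻¹                ≈⟨ A.zeroˡ T⁻¹ ⟩
          A.0#                        ∎
          where open SetoidReasoning A.setoid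
        by-cases : ∀ b → ⟦ b ⟧₂ ≈ 0# → b ≡ false
        by-cases false _   = ≡.refl
        by-cases true  1≈0 = contradiction 1≈0 1≉0

      combination-injective : ∀ b b′ → combination b ≈ combination b′ → ∀ i → b i ≡ b′ i
      combination-injective b b′ eq i = xor≡false (b i) (b′ i) (independent (λ i → b i xor b′ i) (begin
        combination (λ i → b i xor b′ i)
          ≈⟨ sum-cong-≋ {n} (λ i → V.*ₗ-distribʳ (conjugates i) (b i) (b′ i)) ⟩
        sum {n} (λ i → _*₂_ n F (b i) (conjugates i) + _*₂_ n F (b′ i) (conjugates i))
          ≈⟨ ∑-distrib-+ {n} _ _ ⟩
        combination b + combination b′
          ≈⟨ ≈⇒+≈0 eq ⟩
        0# ∎) i)
        where
        open SetoidReasoning setoid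
        open CommutativeMonoidSum +-commutativeMonoid using (sum; sum-cong-≋; ∑-distrib-+)
        xor≡false : ∀ a b → a xor b ≡ false → a ≡ b
        xor≡false false false _ = ≡.refl
        xor≡false true  true  _ = ≡.refl

      -- By counting: the 2 ^ n coefficient vectors have distinct combinations by independence, and
      -- the field has 2 ^ n elements.
      spanning : Spanning (vectorSpace n F) conjugates
      spanning y = coordinates (proj₁ hit) , (begin
        combination (coordinates (proj₁ hit))                        ≈⟨ E.strictlyInverseʳ _ ⟨
        E.from (E.to (combination (coordinates (proj₁ hit))))        ≈⟨ E.from-cong (proj₂ hit) ⟩
        E.from (E.to y)                                              ≈⟨ E.strictlyInverseʳ y ⟩
        y                                                            ∎)
        where
        open SetoidReasoning setoid
        coordinates : Fin (2 ℕ.^ n) → Fin n → Bool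
        coordinates i j = Inverse.to Fin.2↔Bool (finToFun {2} {n} i j)
        injective : ∀ {i j} → E.to (combination (coordinates i)) ≡ E.to (combination (coordinates j)) → i ≡ j
        injective {i} {j} eq = ≡.trans (≡.sym (Fin.funToFin-finToFin {n} {2} i))
          (≡.trans (funToFin-cong (λ l → to-injective (combination-injective (coordinates i) (coordinates j)
              (trans (sym (E.strictlyInverseʳ _)) (trans (E.from-cong eq) (E.strictlyInverseʳ _))) l)))
            (Fin.funToFin-finToFin {n} {2} j))
          where
          to-injective : ∀ {a b} → Inverse.to Fin.2↔Bool a ≡ Inverse.to Fin.2↔Bool b → a ≡ b
          to-injective {a} {b} eq = ≡.trans (≡.sym (Inverse.strictlyInverseʳ Fin.2↔Bool a))
            (≡.trans (≡.cong (Inverse.from Fin.2↔Bool) eq) (Inverse.strictlyInverseʳ Fin.2↔Bool b))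
        hit : ∃[ i ] E.to (combination (coordinates i)) ≡ E.to y
        hit = injective⇒hits (λ i → E.to (combination (coordinates i))) injective (E.to y)

      normal : IsNormal n F α
      normal = independent , spanning

trinomial⇒normal : ∀ {c ℓ} q n (0<n : 0 ℕ.< n) → n ≡ (q ℕ.+ q) ℕ.+ (q ℕ.+ q) →
  (F : FiniteField (2 ℕ.^ n) c ℓ) → AutocorrelationTrinomial n 0<n F →
  Σ[ α ∈ FiniteField.Carrier F ] (IsNormal n F α × hammingWeight n F (correspondingVector n F α) ≡ 3)
trinomial⇒normal q n 0<n n≡4q F trinomial = α , W.normal C≋trinomial invertible , W.weight-three C≋trinomial
  where
  open AutocorrelationTrinomial trinomial
  module W = WeightThree q k n 0<n n≡4q F

open import Data.Nat.Base using (_^_; _<_)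

corollary5p5 : ∀ {c ℓ} (n : ℕ) → 0 < n → 4 ∣ n →
    (F : FiniteField (2 ^ n) c ℓ) →
    Σ[ α ∈ FiniteField.Carrier F ]
    (IsNormal n F α × hammingWeight n F (correspondingVector n F α) ≡ 3)
corollary5p5 n 0<n (divides (suc q′) n≡4q) F = main n (≡.trans n≡4q (quadruple (suc q′))) F
  where
  quadruple : ∀ q → q ℕ.* 4 ≡ (q ℕ.+ q) ℕ.+ (q ℕ.+ q)
  quadruple q = ≡.trans (ℕ.*-distribˡ-+ q 2 2) (≡.cong₂ ℕ._+_ double double)
    where
    double : q ℕ.* 2 ≡ q ℕ.+ q
    double = ≡.trans (ℕ.*-comm q 2) (≡.cong (q ℕ.+_) (ℕ.+-identityʳ q))
  -- With `n` generalised, its equation can be matched with `≡.refl`, as `Construction` takes the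
  -- degree in the form of a sum.
  main : ∀ n → n ≡ (suc q′ ℕ.+ suc q′) ℕ.+ (suc q′ ℕ.+ suc q′) → (F : FiniteField (2 ℕ.^ n) _ _) →
    Σ[ α ∈ FiniteField.Carrier F ] (IsNormal n F α × hammingWeight n F (correspondingVector n F α) ≡ 3)
  main n ≡.refl F = trinomial⇒normal (suc q′) n ℕ.z<s ≡.refl F (Construction.autocorrelationTrinomial q′ F)
corollary5p5 zero () (divides zero _) _
corollary5p5 (suc n) _ (divides zero ()) _
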